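{- Let $V$ be a positive integer divisible by $4$, and write the prime factorization of $V/4$ as $$\frac{V}{4} = 3^{m}\, p_1^{k_1}\cdots p_r^{k_r}\, q_1^{\ell_1}\cdots q_s^{\ell_s},$$ where $p_1,\dots,p_r$ are distinct primes with $p_i\equiv 1\pmod 3$, $q_1,\dots,q_s$ are distinct primes with $q_j\equiv 2\pmod 3$, $m\ge 0$, and all $k_i\ge1$, $\ell_j\ge 1$. Let $\delta(V)$ be the number of trihexes with $V$ vertices that have 3-fold rotational symmetry. Then $\delta(V)=0$ if some $\ell_j$ is odd, and if all $\ell_j$ are even then $$\delta(V)=\prod_{i=1}^{r}(k_i+1).$$
   Context: A trihex is a 3-regular graph embedded in the plane (equivalently, in the sphere) all of whose faces, including the unbounded one, have exactly 3 or exactly 6 sides. Two trihexes are counted as the same if they are isomorphic as graphs via an isomorphism induced by an orientation-preserving homeomorphism of the plane (so a chiral trihex and its mirror image are distinct). A trihex has 3-fold rotational symmetry if it can be embedded on the sphere so that some rotation of the sphere of order 3 induces a graph automorphism of it. -}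

module Defs where

open import Data.Nat using (ℕ; zero; suc; _+_; _*_; _^_; _≤_; _<_; _%_)
open import Data.Nat.Properties using (_≤?_)
open import Data.Nat.Primality using (Prime)
open import Data.Fin using (Fin; toℕ)
open import Data.Fin.Properties using (all?)
open import Data.List using (List; []; _∷_; length; filter; allFin)
open import Data.List.Membership.Propositional using (_∈_)
open import Data.Fin using () renaming (zero to fzero; suc to fsuc)
open import Data.Vec.Functional using (Vector)
open import Data.Product using (Σ; ∃; _×_; _,_)
open import Data.Sum using (_⊎_)
open import Relation.Nullary using (¬_)
open import Relation.Binary.PropositionalEquality using (_≡_; _≢_)

iter : ∀ {a} {A : Set a} → (A → A) → ℕ → A → A
iter f zero    x = x
iter f (suc k) x = f (iter f k x)

prodF : ∀ {r} → (Fin r → ℕ) → ℕ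
prodF {zero}  f = 1
prodF {suc r} f = f fzero * prodF (λ i → f (fsuc i))

-- Combinatorial maps (rotation systems) on the dart set Fin n.
-- σ : rotation of darts around their vertex (counter-clockwise),
-- α : the edge involution (dart ↦ opposite dart),
-- φ = σ ∘ α : the face permutation.  Vertices / edges / faces are the
-- orbits of σ / α / φ.  (This is the standard encoding of a connected
-- graph cellularly embedded in an oriented surface.)

IsOrbitMin : ∀ {n} → (Fin n → Fin n) → Fin n → Set
IsOrbitMin {n} π d = ∀ (k : Fin n) → toℕ d ≤ toℕ (iter π (toℕ k) d)

orbitCount : ∀ {n} → (Fin n → Fin n) → ℕ
orbitCount {n} π =
  length (filter (λ d → all? {P = λ (k : Fin n) → toℕ d ≤ toℕ (iter π (toℕ k) d)} (λ k → toℕ d ≤? toℕ (iter π (toℕ k) d)))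
                 (allFin n))

data Reach {n} (σ α : Fin n → Fin n) (d : Fin n) : Fin n → Set where
  here  : Reach σ α d d
  viaσ  : ∀ {e} → Reach σ α d e → Reach σ α d (σ e)
  viaα  : ∀ {e} → Reach σ α d e → Reach σ α d (α e)

FaceOf3 : ∀ {n} → (Fin n → Fin n) → Fin n → Set
FaceOf3 φ d = (iter φ 3 d ≡ d) × (φ d ≢ d)

FaceOf6 : ∀ {n} → (Fin n → Fin n) → Fin n → Set
FaceOf6 φ d = (iter φ 6 d ≡ d) × (iter φ 2 d ≢ d) × (iter φ 3 d ≢ d)

record Trihex (n : ℕ) : Set where
  field
    σ : Fin n → Fin n
    α : Fin n → Fin n
    σ-cube   : ∀ d → iter σ 3 d ≡ d
    σ-nofix  : ∀ d → σ d ≢ d           -- with σ³ = id: every vertex has degree 3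
    α-invol  : ∀ d → α (α d) ≡ d
    α-nofix  : ∀ d → α d ≢ d
    connected : ∀ d e → Reach σ α d e
    faces    : ∀ d → FaceOf3 (λ x → σ (α x)) d ⊎ FaceOf6 (λ x → σ (α x)) d
    -- Euler's formula V - E + F = 2 (the surface is the sphere)
    planar   : orbitCount σ + orbitCount (λ x → σ (α x)) ≡ orbitCount α + 2

  φ : Fin n → Fin n
  φ x = σ (α x)

  numVertices : ℕ
  numVertices = orbitCount σ

open Trihex public

AnyTrihex : Set
AnyTrihex = Σ ℕ Trihex

-- Orientation-preserving isomorphism: a bijection of darts commuting with
-- σ and α (an orientation-reversing one would conjugate σ to σ⁻¹).
record Iso {n m} (T : Trihex n) (U : Trihex m) : Set where
  field
    to   : Fin n → Fin m
    from : Fin m → Fin n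
    from-to : ∀ d → from (to d) ≡ d
    to-from : ∀ e → to (from e) ≡ e
    pres-σ  : ∀ d → to (σ T d) ≡ σ U (to d)
    pres-α  : ∀ d → to (α T d) ≡ α U (to d)

_≅_ : AnyTrihex → AnyTrihex → Set
(n , T) ≅ (m , U) = Iso T U

-- 3-fold rotational symmetry: an orientation-preserving automorphism of
-- order exactly 3 (the combinatorial shadow of a rotation of order 3 of the
-- sphere that induces an automorphism).
HasThreefoldSymmetry : ∀ {n} → Trihex n → Set
HasThreefoldSymmetry T =
  Σ (Iso T T) λ τ →
    (∀ d → iter (Iso.to τ) 3 d ≡ d) × (∃ λ d → Iso.to τ d ≢ d)

-- δ(V) = N : there are exactly N isomorphism classes of trihexes with V
-- vertices and 3-fold rotational symmetry.  Witnessed by a list of N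
-- representatives, pairwise non-isomorphic, each with V vertices and the
-- symmetry, such that every such trihex is isomorphic to one of them.
SymTrihexV : ℕ → AnyTrihex → Set
SymTrihexV V (n , T) = (numVertices T ≡ V) × HasThreefoldSymmetry T

data Distinct : List AnyTrihex → Set where
  []  : Distinct []
  _∷_ : ∀ {t ts} → (∀ {u} → u ∈ ts → ¬ (t ≅ u)) → Distinct ts → Distinct (t ∷ ts)

δ≡ : ℕ → ℕ → Set
δ≡ V N =
  Σ (List AnyTrihex) λ reps →
    (length reps ≡ N) ×
    (∀ {t} → t ∈ reps → SymTrihexV V t) ×
    Distinct reps ×
    (∀ t → SymTrihexV V t → Σ AnyTrihex λ u → (u ∈ reps) × (t ≅ u))

{-# OPTIONS --safe #-}
module Submission where

-- The darts of the hexagonal tiling form a torsor under ℤ[ω] ⋊ μ₆, so every trihex is a quotient of the tiling.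
-- By Euler's formula a trihex has a triangle. It is a hexagon folded by a half turn, and placing that hexagon at
-- the origin exhibits the darts as (ℤ[ω] / Λ) × ℤ/3 for a lattice Λ, which lies in 2ℤ[ω] because no edge is folded.
-- A symmetry of order 3 cannot just translate the base dart by some w, since commuting with the half turn gives
-- 2w ∈ Λ and order 3 gives 3w ∈ Λ. Hence it rotates the base dart, Λ is stable under ω, and Λ = 2L for an ideal L
-- of norm V/4. Conversely every such ideal arises, and it is recovered from the trihex because the translations
-- fixing any given dart form 2L. So δ(V) is the number of ideals of norm V/4. An ideal is g ⟨M , ω − c⟩ for a unique
-- triple with 0 ≤ c < M and M ∣ c² + c + 1, and these triples are counted one prime at a time, using the Chinese
-- remainder theorem and Hensel's lemma.

-- Evenness of Λ: in these coordinates α is v ↦ -(v + 1), so 2w + 1 ∈ Λ would make α fix a dart, and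
-- stability under ω carries the classes of ω and ω² modulo 2 to that of 1. The index k ∈ ℤ/3 is a
-- genuine coordinate only if no translation takes the base dart to one of its rotated copies; such
-- a translation could be moved to one that makes φ² or σ fix a dart. For the converse the delicate
-- axiom is planarity. A dart (v , k) is triangular exactly when 2v ∈ 2L, so the triangular darts
-- are L / 2L × ℤ/3, twelve in number, and twelve is what Euler's formula demands. For the count, an
-- ideal whose norm contains p^k is either p times an ideal with p^(k-2) in its norm, or it carries
-- a root of z² + z + 1 modulo p^k. For k ≥ 1 there are two roots if p ≡ 1 modulo 3 and none if p ≡
-- 2; for p = 3 there is one modulo 3 and none modulo 9. The recursion turns these into the local
-- factors k + 1, then 1 or 0 by the parity of k, and 1.

module OrbitCounting where

  -- Counting the cycles of a finite permutation by their least elements.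

  open import Defs
  open import Data.Nat using (ℕ; zero; suc; _+_; _*_; _∸_; _≤_; _<_; _%_; _/_; NonZero)
  open import Data.Nat.Properties
  open import Data.Nat.DivMod using (m≡m%n+[m/n]*n; m%n<n)
  open import Data.Fin using (Fin; toℕ; fromℕ<) renaming (zero to fzero; suc to fsuc)
  open import Data.Fin.Properties using (all?; toℕ<n; toℕ-fromℕ<; toℕ-injective; injective⇒≤) renaming (_≟_ to _≟ᶠ_)
  open import Data.Fin.Permutation using (Permutation; permutation)
  open import Data.List using (length; filter; tabulate)
  open import Data.Product using (∃; _×_; _,_; proj₁; proj₂)
  open import Data.Sum using (inj₁; inj₂)
  open import Function using (_∘_; id)
  open import Relation.Nullary using (¬_; Dec; yes; no; contradiction)
  open import Relation.Unary using (Decidable)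
  open import Relation.Binary.Definitions using (tri<; tri≈; tri>)
  open import Relation.Binary.PropositionalEquality using (_≡_; _≢_; refl; sym; trans; cong; cong₂; subst; module ≡-Reasoning)
  open import Algebra.Properties.CommutativeMonoid.Sum +-0-commutativeMonoid using (sum; sum-cong-≗; ∑-comm; sum-permute)

  ind : ∀ {p} {P : Set p} → Dec P → ℕ
  ind (yes _) = 1
  ind (no _)  = 0

  ind-yes : ∀ {p} {P : Set p} (P? : Dec P) → P → ind P? ≡ 1
  ind-yes (yes _) _ = refl
  ind-yes (no ¬p) p = contradiction p ¬p

  ind-no : ∀ {p} {P : Set p} (P? : Dec P) → ¬ P → ind P? ≡ 0
  ind-no (yes p) ¬p = contradiction p ¬p
  ind-no (no _)  _  = refl

  count : ∀ {n p} {P : Fin n → Set p} → Decidable P → ℕ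
  count P? = sum (λ i → ind (P? i))

  length-filter-tabulate : ∀ {a p} {A : Set a} {P : A → Set p} (P? : Decidable P) {n} (f : Fin n → A) →
    length (filter P? (tabulate f)) ≡ sum (λ i → ind (P? (f i)))
  length-filter-tabulate P? {zero}  f = refl
  length-filter-tabulate P? {suc n} f with P? (f fzero)
  ... | yes _ = cong suc (length-filter-tabulate P? (f ∘ fsuc))
  ... | no  _ = length-filter-tabulate P? (f ∘ fsuc)

  sum-const : ∀ n c → sum {n} (λ _ → c) ≡ n * c
  sum-const zero    c = refl
  sum-const (suc n) c = cong (c +_) (sum-const n c)

  sum-zero : ∀ {n} (f : Fin n → ℕ) → (∀ i → f i ≡ 0) → sum f ≡ 0
  sum-zero {n} f f≡0 = trans (sum-cong-≗ f≡0) (trans (sum-const n 0) (*-zeroʳ n))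

  count-singleton : ∀ {n p} {P : Fin n → Set p} (P? : Decidable P) i → P i → (∀ j → P j → j ≡ i) → count P? ≡ 1
  count-singleton {suc n} P? fzero Pi uniq =
    cong₂ _+_ (ind-yes (P? fzero) Pi)
              (sum-zero (λ j → ind (P? (fsuc j))) (λ j → ind-no (P? (fsuc j)) (λ q → contradiction (uniq _ q) λ ())))
  count-singleton {suc n} P? (fsuc i) Pi uniq =
    cong₂ _+_ (ind-no (P? fzero) (λ q → contradiction (uniq _ q) λ ()))
              (count-singleton (P? ∘ fsuc) i Pi (λ j q → fsuc-inj (uniq _ q)))
    where
    fsuc-inj : ∀ {m} {a b : Fin m} → fsuc a ≡ fsuc b → a ≡ b
    fsuc-inj refl = refl

  -- Double counting of the pairs (i , d) with `h i ≡ d`: each i lies in one pair, each d in one or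
  -- none according to `P`.
  count-injective-image : ∀ {n m p} {P : Fin n → Set p} (P? : Decidable P) (h : Fin m → Fin n) →
    (∀ {i j} → h i ≡ h j → i ≡ j) → (∀ i → P (h i)) → (∀ d → P d → ∃ λ i → h i ≡ d) → count P? ≡ m
  count-injective-image {n} {m} P? h inj sound complete = begin
    sum (λ d → ind (P? d))                   ≡⟨ sum-cong-≗ fibre ⟨
    sum (λ d → sum (λ i → ind (h i ≟ᶠ d)))   ≡⟨ ∑-comm (λ d i → ind (h i ≟ᶠ d)) ⟩
    sum (λ i → sum (λ d → ind (h i ≟ᶠ d)))   ≡⟨ sum-cong-≗ (λ i → count-singleton (h i ≟ᶠ_) (h i) refl (λ _ → sym)) ⟩
    sum {m} (λ _ → 1)                        ≡⟨ sum-const m 1 ⟩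
    m * 1                                    ≡⟨ *-identityʳ m ⟩
    m ∎
    where
    open ≡-Reasoning
    fibre : ∀ d → sum (λ i → ind (h i ≟ᶠ d)) ≡ ind (P? d)
    fibre d with P? d
    ... | yes Pd with complete d Pd
    ...   | i , hi≡d = count-singleton (λ j → h j ≟ᶠ d) i hi≡d (λ j hj≡d → inj (trans hj≡d (sym hi≡d)))
    fibre d | no ¬Pd = sum-zero _ (λ i → ind-no (h i ≟ᶠ d) (λ hi≡d → ¬Pd (subst _ hi≡d (sound i))))

  argmin : ∀ {p} (f : Fin (suc p) → ℕ) → ∃ λ i → ∀ j → f i ≤ f j
  argmin {zero}  f = fzero , λ { fzero → ≤-refl }
  argmin {suc p} f with argmin (f ∘ fsuc)
  ... | i , min with ≤-total (f fzero) (f (fsuc i))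
  ...   | inj₁ le = fzero , λ { fzero → ≤-refl ; (fsuc j) → ≤-trans le (min j) }
  ...   | inj₂ ge = fsuc i , λ { fzero → ge ; (fsuc j) → min j }

  module _ {a} {A : Set a} (f : A → A) where

    iter-+ : ∀ i j x → iter f (i + j) x ≡ iter f i (iter f j x)
    iter-+ zero    j x = refl
    iter-+ (suc i) j x = cong f (iter-+ i j x)

    iter-multiple : ∀ p {x} → iter f p x ≡ x → ∀ q → iter f (q * p) x ≡ x
    iter-multiple p fix zero    = refl
    iter-multiple p fix (suc q) = trans (iter-+ p (q * p) _) (trans (cong (iter f p) (iter-multiple p fix q)) fix)

    iter-% : ∀ p .{{_ : NonZero p}} {x} → iter f p x ≡ x → ∀ k → iter f k x ≡ iter f (k % p) x
    iter-% p {x} fix k = begin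
      iter f k x                             ≡⟨ cong (λ l → iter f l x) (m≡m%n+[m/n]*n k p) ⟩
      iter f (k % p + k / p * p) x           ≡⟨ iter-+ (k % p) _ x ⟩
      iter f (k % p) (iter f (k / p * p) x)  ≡⟨ cong (iter f (k % p)) (iter-multiple p fix (k / p)) ⟩
      iter f (k % p) x ∎
      where open ≡-Reasoning

  ExactPeriod : ∀ {n} → (Fin n → Fin n) → ℕ → Fin n → Set
  ExactPeriod π p d = (iter π p d ≡ d) × (∀ k → 0 < k → k < p → iter π k d ≢ d)

  module _ {n} (π : Fin n → Fin n) where

    orbitMin? : Decidable (IsOrbitMin π)
    orbitMin? d = all? (λ k → toℕ d ≤? toℕ (iter π (toℕ k) d))

    orbitCount≡count : orbitCount π ≡ count orbitMin?
    orbitCount≡count = length-filter-tabulate orbitMin? id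

    module _ {p} {d : Fin n} (exact : ExactPeriod π (suc p) d) where
      private
        fix : iter π (suc p) d ≡ d
        fix = proj₁ exact

        return : ∀ {i j} → i ≤ suc p → iter π (suc p ∸ i + j) (iter π i d) ≡ iter π j d
        return {i} {j} i≤p = begin
          iter π (suc p ∸ i + j) (iter π i d)   ≡⟨ iter-+ π (suc p ∸ i + j) i d ⟨
          iter π (suc p ∸ i + j + i) d          ≡⟨ cong (λ l → iter π l d) eq ⟩
          iter π (j + suc p) d                  ≡⟨ iter-+ π j (suc p) d ⟩
          iter π j (iter π (suc p) d)           ≡⟨ cong (iter π j) fix ⟩
          iter π j d ∎
          where
          open ≡-Reasoning
          eq : suc p ∸ i + j + i ≡ j + suc p
          eq = trans (+-assoc (suc p ∸ i) j i) (trans (cong (suc p ∸ i +_) (+-comm j i))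
                 (trans (sym (+-assoc (suc p ∸ i) i j)) (trans (cong (_+ j) (m∸n+n≡m i≤p)) (+-comm (suc p) j))))

        inj< : ∀ i j → i < j → j < suc p → iter π i d ≢ iter π j d
        inj< i j i<j j<p eq = proj₂ exact (suc p ∸ j + i) (≤-trans (m<n⇒0<n∸m j<p) (m≤m+n _ i)) bound (begin
          iter π (suc p ∸ j + i) d                    ≡⟨ iter-+ π (suc p ∸ j) i d ⟩
          iter π (suc p ∸ j) (iter π i d)             ≡⟨ cong (iter π (suc p ∸ j)) eq ⟩
          iter π (suc p ∸ j) (iter π j d)             ≡⟨ cong (λ l → iter π l (iter π j d)) (+-identityʳ (suc p ∸ j)) ⟨
          iter π (suc p ∸ j + 0) (iter π j d)         ≡⟨ return {j} {0} (<⇒≤ j<p) ⟩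
          d ∎)
          where
          open ≡-Reasoning
          bound : suc p ∸ j + i < suc p
          bound = subst (suc p ∸ j + i <_) (m∸n+n≡m (<⇒≤ j<p)) (+-monoʳ-< (suc p ∸ j) i<j)

        orbit : Fin (suc p) → Fin n
        orbit k = iter π (toℕ k) d

        orbit-injective : ∀ {i j} → orbit i ≡ orbit j → i ≡ j
        orbit-injective {i} {j} eq with <-cmp (toℕ i) (toℕ j)
        ... | tri< i<j _ _ = contradiction eq (inj< _ _ i<j (toℕ<n j))
        ... | tri≈ _ i≡j _ = toℕ-injective i≡j
        ... | tri> _ _ j<i = contradiction (sym eq) (inj< _ _ j<i (toℕ<n i))

        onto : ∀ l → ∃ λ k → orbit k ≡ iter π l d
        onto l = fromℕ< (m%n<n l (suc p)) ,
          trans (cong (λ r → iter π r d) (toℕ-fromℕ< (m%n<n l (suc p)))) (sym (iter-% π (suc p) fix l))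

        -- `IsOrbitMin` inspects only the first n iterates. A cycle has at most n elements, so this
        -- already covers all of it.
        p<n : suc p ≤ n
        p<n = injective⇒≤ orbit-injective

        below : ∀ i → IsOrbitMin π (orbit i) → ∀ j → toℕ (orbit i) ≤ toℕ (orbit j)
        below i min j = subst (λ e → toℕ (orbit i) ≤ toℕ e) reach (min k)
          where
          r = (suc p ∸ toℕ i + toℕ j) % suc p
          r<p : r < suc p
          r<p = m%n<n (suc p ∸ toℕ i + toℕ j) (suc p)
          k : Fin n
          k = fromℕ< (<-≤-trans r<p p<n)
          orbit-fix : iter π (suc p) (orbit i) ≡ orbit i
          orbit-fix = trans (sym (iter-+ π (suc p) (toℕ i) d)) (trans (cong (λ l → iter π l d) (+-comm (suc p) (toℕ i)))
                        (trans (iter-+ π (toℕ i) (suc p) d) (cong (iter π (toℕ i)) fix)))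
          reach : iter π (toℕ k) (orbit i) ≡ orbit j
          reach = trans (cong (λ l → iter π l (orbit i)) (toℕ-fromℕ< (<-≤-trans r<p p<n)))
                    (trans (sym (iter-% π (suc p) orbit-fix (suc p ∸ toℕ i + toℕ j))) (return (<⇒≤ (toℕ<n i))))

      count-orbitMin : sum {suc p} (λ k → ind (orbitMin? (iter π (toℕ k) d))) ≡ 1
      count-orbitMin with argmin (toℕ ∘ orbit)
      ... | i , min = count-singleton (orbitMin? ∘ orbit) i isMin
                        (λ j jmin → orbit-injective (toℕ-injective (≤-antisym (below j jmin i) (min j))))
        where
        isMin : IsOrbitMin π (orbit i)
        isMin k with onto (toℕ k + toℕ i)
        ... | l , eq = subst (λ e → toℕ (orbit i) ≤ toℕ e) (trans eq (iter-+ π (toℕ k) (toℕ i) d)) (min l)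

    module _ {m} (π^m : ∀ d → iter π (suc m) d ≡ d) where

      private
        π-perm : Permutation n n
        π-perm = permutation π (iter π m) right left
          where
          right : ∀ d → π (iter π m d) ≡ d
          right = π^m
          left : ∀ d → iter π m (π d) ≡ d
          left d = trans (sym (iter-+ π m 1 d)) (trans (cong (λ l → iter π l d) (+-comm m 1)) (π^m d))

        sum-iter : ∀ k (Q : Fin n → ℕ) → sum (λ d → Q (iter π k d)) ≡ sum Q
        sum-iter zero    Q = refl
        sum-iter (suc k) Q = trans (sum-iter k (Q ∘ π)) (sym (sum-permute Q π-perm))

      -- Each power of `π` permutes the darts, so each of the `suc m` inner terms contributes the
      -- full sum. Here `suc m` is a common period, possibly a multiple of some cycle lengths: 6
      -- treats triangles and hexagons at once.
      sum-over-orbits : (Q : Fin n → ℕ) → sum (λ d → sum {suc m} (λ k → Q (iter π (toℕ k) d))) ≡ suc m * sum Q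
      sum-over-orbits Q = begin
        sum (λ d → sum {suc m} (λ k → Q (iter π (toℕ k) d)))  ≡⟨ ∑-comm {n} {suc m} (λ d k → Q (iter π (toℕ k) d)) ⟩
        sum {suc m} (λ k → sum (λ d → Q (iter π (toℕ k) d)))  ≡⟨ sum-cong-≗ {suc m} (λ k → sum-iter (toℕ k) Q) ⟩
        sum {suc m} (λ _ → sum Q)                             ≡⟨ sum-const (suc m) (sum Q) ⟩
        suc m * sum Q ∎
        where open ≡-Reasoning

      orbitCount-free : (∀ d → ExactPeriod π (suc m) d) → suc m * orbitCount π ≡ n
      orbitCount-free exact = begin
        suc m * orbitCount π     ≡⟨ cong (suc m *_) orbitCount≡count ⟩
        suc m * count orbitMin?  ≡⟨ sum-over-orbits (ind ∘ orbitMin?) ⟨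
        sum (λ d → sum {suc m} (λ k → ind (orbitMin? (iter π (toℕ k) d)))) ≡⟨ sum-cong-≗ (λ d → count-orbitMin (exact d)) ⟩
        sum {n} (λ _ → 1)        ≡⟨ sum-const n 1 ⟩
        n * 1                    ≡⟨ *-identityʳ n ⟩
        n ∎
        where open ≡-Reasoning

      -- Only orbit minima inside `P` are weighed, and each cycle in `P` has one. This divisibility,
      -- with period 3, later decides whether primitive cube roots of unity exist modulo a prime.
      count-free : ∀ {p} {P : Fin n → Set p} (P? : Decidable P) → (∀ d → P d → P (π d)) →
        (∀ d → P d → ExactPeriod π (suc m) d) → ∃ λ c → count P? ≡ suc m * c
      count-free {P = P} P? closed exact = sum Q , trans (sum-cong-≗ (λ d → sym (total d (P? d)))) (sum-over-orbits Q)
        where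
        Q : Fin n → ℕ
        Q d = ind (P? d) * ind (orbitMin? d)

        forth : ∀ k d → P d → P (iter π k d)
        forth zero    d Pd = Pd
        forth (suc k) d Pd = closed _ (forth k d Pd)

        back : ∀ k d → k ≤ suc m → P (iter π k d) → P d
        back k d k≤m Pk = subst P (trans (sym (iter-+ π (suc m ∸ k) k d))
                            (trans (cong (λ l → iter π l d) (m∸n+n≡m k≤m)) (π^m d))) (forth (suc m ∸ k) _ Pk)

        total : ∀ d (Pd? : Dec (P d)) → sum {suc m} (λ k → Q (iter π (toℕ k) d)) ≡ ind Pd?
        total d (yes Pd) = trans (sum-cong-≗ {suc m} (λ k → trans (cong (_* ind (orbitMin? (iter π (toℕ k) d))) (ind-yes (P? _) (forth (toℕ k) d Pd)))
                                                 (*-identityˡ _)))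
                         (count-orbitMin (exact d Pd))
        total d (no ¬Pd) = sum-zero {suc m} _ (λ k → cong (_* ind (orbitMin? (iter π (toℕ k) d)))
                                            (ind-no (P? _) (¬Pd ∘ back (toℕ k) d (<⇒≤ (toℕ<n k)))))

-- Euler's formula as a count of triangular darts.

module EulerFormula where

  open import Defs
  open OrbitCounting
  open import Data.Nat using (ℕ; suc; _+_; _*_; s≤s)
  open import Data.Nat.Properties
  open import Data.Nat.Tactic.RingSolver using (solve-∀)
  open import Data.Fin using (Fin; toℕ)
  open import Data.Fin.Properties using () renaming (_≟_ to _≟ᶠ_)
  open import Data.Product using (_,_)
  open import Data.Sum using (_⊎_; inj₁; inj₂)
  open import Function using (_∘_)
  open import Relation.Nullary using (Dec; yes; no; contradiction)
  open import Relation.Unary using (Decidable)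
  open import Relation.Binary.PropositionalEquality using (_≡_; _≢_; sym; trans; cong; cong₂; module ≡-Reasoning)
  open import Algebra.Properties.CommutativeMonoid.Sum +-0-commutativeMonoid using (sum; sum-cong-≗; ∑-distrib-+)

  module _ {n} {π : Fin n → Fin n} {d : Fin n} where

    exactPeriod-2 : iter π 2 d ≡ d → π d ≢ d → ExactPeriod π 2 d
    exactPeriod-2 fix π≢ = fix , λ { 1 _ _ → π≢ ; (suc (suc _)) _ (s≤s (s≤s ())) }

    exactPeriod-3 : iter π 3 d ≡ d → π d ≢ d → ExactPeriod π 3 d
    exactPeriod-3 fix π≢ = fix , λ
      { 1 _ _ → π≢
      ; 2 _ _ eq → π≢ (trans (sym (cong π eq)) fix)
      ; (suc (suc (suc _))) _ (s≤s (s≤s (s≤s ()))) }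

    exactPeriod-6 : FaceOf6 π d → ExactPeriod π 6 d
    exactPeriod-6 (fix , π²≢ , π³≢) = fix , λ
      { 1 _ _ eq → π²≢ (trans (cong π eq) eq)
      ; 2 _ _ → π²≢
      ; 3 _ _ → π³≢
      ; 4 _ _ eq → π²≢ (trans (sym (cong (iter π 2) eq)) fix)
      ; 5 _ _ eq → π²≢ (let eq′ = trans (sym (cong π eq)) fix in trans (cong π eq′) eq′)
      ; (suc (suc (suc (suc (suc (suc _)))))) _ (s≤s (s≤s (s≤s (s≤s (s≤s (s≤s ())))))) }

  -- Raw permutations take the place of a `Trihex` because the same count must also supply the field
  -- `planar` of a trihex under construction.
  module _ {n} {σ α : Fin n → Fin n}
    (σ-cube : ∀ d → iter σ 3 d ≡ d) (σ-nofix : ∀ d → σ d ≢ d)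
    (α-invol : ∀ d → α (α d) ≡ d) (α-nofix : ∀ d → α d ≢ d)
    (faces : ∀ d → FaceOf3 (λ x → σ (α x)) d ⊎ FaceOf6 (λ x → σ (α x)) d) where

    private
      φ′ : Fin n → Fin n
      φ′ x = σ (α x)

    triangular? : Decidable (λ d → iter φ′ 3 d ≡ d)
    triangular? d = iter φ′ 3 d ≟ᶠ d

    3*vertices : 3 * orbitCount σ ≡ n
    3*vertices = orbitCount-free σ {2} σ-cube (λ d → exactPeriod-3 (σ-cube d) (σ-nofix d))

    2*edges : 2 * orbitCount α ≡ n
    2*edges = orbitCount-free α {1} α-invol (λ d → exactPeriod-2 (α-invol d) (α-nofix d))

    φ^6≡id : ∀ d → iter φ′ 6 d ≡ d
    φ^6≡id d with faces d
    ... | inj₁ (fix , _) = trans (cong (iter φ′ 3) fix) fix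
    ... | inj₂ (fix , _) = fix

    -- Six steps of the face permutation run once around a hexagon and twice around a triangle, so
    -- they meet the least dart of the face once or twice.
    6*faces : 6 * orbitCount φ′ ≡ n + count triangular?
    6*faces = begin
      6 * orbitCount φ′                              ≡⟨ cong (6 *_) (orbitCount≡count φ′) ⟩
      6 * count (orbitMin? φ′)                       ≡⟨ sum-over-orbits φ′ {5} φ^6≡id Q ⟨
      sum (λ d → sum {6} (λ k → Q (iter φ′ (toℕ k) d)))  ≡⟨ sum-cong-≗ (λ d → local d (faces d) (triangular? d)) ⟩
      sum (λ d → 1 + ind (triangular? d))           ≡⟨ ∑-distrib-+ (λ _ → 1) (ind ∘ triangular?) ⟩
      sum {n} (λ _ → 1) + count triangular?         ≡⟨ cong (_+ count triangular?) (trans (sum-const n 1) (*-identityʳ n)) ⟩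
      n + count triangular? ∎
      where
      open ≡-Reasoning
      Q : Fin n → ℕ
      Q d = ind (orbitMin? φ′ d)

      local : ∀ d → FaceOf3 φ′ d ⊎ FaceOf6 φ′ d → (t : Dec (iter φ′ 3 d ≡ d)) →
              sum {6} (λ k → Q (iter φ′ (toℕ k) d)) ≡ 1 + ind t
      local d (inj₁ (fix , _)) (no ¬fix) = contradiction fix ¬fix
      local d (inj₂ (_ , _ , ¬fix)) (yes fix) = contradiction fix ¬fix
      local d (inj₂ f6) (no _) = count-orbitMin φ′ (exactPeriod-6 f6)
      local d (inj₁ (fix , φ≢)) (yes _) = begin
        Q d + (Q (φ′ d) + (Q (iter φ′ 2 d) + (Q (iter φ′ 3 d) + (Q (iter φ′ 4 d) + (Q (iter φ′ 5 d) + 0)))))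
          ≡⟨ cong (λ e → Q d + (Q (φ′ d) + (Q (iter φ′ 2 d) + (Q e + (Q (φ′ e) + (Q (φ′ (φ′ e)) + 0)))))) fix ⟩
        Q d + (Q (φ′ d) + (Q (iter φ′ 2 d) + (Q d + (Q (φ′ d) + (Q (φ′ (φ′ d)) + 0)))))
          ≡⟨ twice (Q d) (Q (φ′ d)) (Q (iter φ′ 2 d)) ⟩
        2 * (Q d + (Q (φ′ d) + (Q (iter φ′ 2 d) + 0)))
          ≡⟨ cong (2 *_) (count-orbitMin φ′ (exactPeriod-3 fix φ≢)) ⟩
        2 ∎
        where
        twice : ∀ a b c → a + (b + (c + (a + (b + (c + 0))))) ≡ 2 * (a + (b + (c + 0)))
        twice = solve-∀

    private
      -- With V = n/3, E = n/2 and F = (n + t)/6 for t triangular darts, V - E + F = t/6. The factor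
      -- 6 clears the denominators, and the sphere is characterised by t = 12.
      6*E-F : 6 * (orbitCount σ + orbitCount φ′) + 12 ≡ 6 * (orbitCount α + 2) + count triangular?
      6*E-F = begin
        6 * (orbitCount σ + orbitCount φ′) + 12               ≡⟨ eq₁ (orbitCount σ) (orbitCount φ′) ⟩
        2 * (3 * orbitCount σ) + 6 * orbitCount φ′ + 12       ≡⟨ cong₂ (λ a b → 2 * a + b + 12) 3*vertices 6*faces ⟩
        2 * n + (n + count triangular?) + 12                 ≡⟨ eq₂ n (count triangular?) ⟩
        3 * n + 12 + count triangular?                       ≡⟨ cong (λ a → 3 * a + 12 + count triangular?) 2*edges ⟨
        3 * (2 * orbitCount α) + 12 + count triangular?      ≡⟨ eq₃ (orbitCount α) (count triangular?) ⟩
        6 * (orbitCount α + 2) + count triangular? ∎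
        where
        open ≡-Reasoning
        eq₁ : ∀ v f → 6 * (v + f) + 12 ≡ 2 * (3 * v) + 6 * f + 12
        eq₁ = solve-∀
        eq₂ : ∀ n t → 2 * n + (n + t) + 12 ≡ 3 * n + 12 + t
        eq₂ = solve-∀
        eq₃ : ∀ e t → 3 * (2 * e) + 12 + t ≡ 6 * (e + 2) + t
        eq₃ = solve-∀

    planar⇒triangular≡12 : orbitCount σ + orbitCount φ′ ≡ orbitCount α + 2 → count triangular? ≡ 12
    planar⇒triangular≡12 planar =
      sym (+-cancelˡ-≡ (6 * (orbitCount α + 2)) _ _ (trans (cong (λ a → 6 * a + 12) (sym planar)) 6*E-F))

    triangular≡12⇒planar : count triangular? ≡ 12 → orbitCount σ + orbitCount φ′ ≡ orbitCount α + 2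
    triangular≡12⇒planar t≡12 =
      *-cancelˡ-≡ _ _ 6 (+-cancelʳ-≡ 12 _ _ (trans 6*E-F (cong (6 * (orbitCount α + 2) +_) t≡12)))

-- Ideals of ℤ[ω] in normal form and their residue classes.

module EisensteinIdeals where

  open import Data.Nat as ℕ using (ℕ; zero; suc; NonZero)
  import Data.Nat.Properties as ℕ
  import Data.Nat.Divisibility as ℕ
  open import Data.Integer using (ℤ; +_; _+_; _*_; -_; _-_; ∣_∣; 0ℤ; 1ℤ)
  open import Data.Integer.Properties using (pos-*; ∣i∣≡0⇒i≡0; i-j≡0⇒i≡j; +-injective; ∣m⊝n∣≤m⊔n; [+m]-[+n]≡m⊖n; *-zeroˡ)
  open import Data.Integer.DivMod using (_%ℕ_; _/ℕ_; n%ℕd<d; a≡a%ℕn+[a/ℕn]*n)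
  open import Data.Integer.Divisibility.Signed using (_∣_; divides; ∣⇒∣ᵤ; ∣m∣n⇒∣m+n; ∣m⇒∣-m; *-cancelˡ-∣; ∣-refl)
  open import Data.Integer.Tactic.RingSolver using (solve-∀)
  open import Data.Fin using (Fin; toℕ; fromℕ<)
  open import Data.Fin.Properties using (toℕ<n; toℕ-fromℕ<; toℕ-injective)
  open import Data.Product using (_×_; _,_; proj₁; proj₂)
  open import Relation.Nullary using (contradiction)
  open import Relation.Binary.PropositionalEquality using (_≡_; refl; sym; trans; cong; cong₂; subst; subst₂; module ≡-Reasoning)

  ∣-resp : ∀ {k i j} → i ≡ j → k ∣ i → k ∣ j
  ∣-resp refl d = d

  residue-unique : ∀ {m i j} → i ℕ.< m → j ℕ.< m → + m ∣ + i - + j → i ≡ j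
  residue-unique {m} {i} {j} i<m j<m m∣ with ∣ + i - + j ∣ in eq
  ... | zero  = +-injective (i-j≡0⇒i≡j (+ i) (+ j) (∣i∣≡0⇒i≡0 eq))
  ... | suc l = contradiction (subst (m ℕ.∣_) eq (∣⇒∣ᵤ m∣)) (ℕ.>⇒∤ l<m)
    where
    l<m : suc l ℕ.< m
    l<m = subst (ℕ._< m) eq (subst (ℕ._< m) (cong ∣_∣ (sym ([+m]-[+n]≡m⊖n i j))) (ℕ.≤-<-trans (∣m⊝n∣≤m⊔n i j) (ℕ.⊔-lub i<m j<m)))

  n∣a-a%n : ∀ a n .{{_ : NonZero n}} → + n ∣ a - + (a %ℕ n)
  n∣a-a%n a n = divides (a /ℕ n) (trans (cong (_- + (a %ℕ n)) (a≡a%ℕn+[a/ℕn]*n a n)) (eq (+ (a %ℕ n)) (a /ℕ n * + n)))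
    where
    eq : ∀ r q → r + q - r ≡ q
    eq = solve-∀

  -- The minimal polynomial of ω; its roots modulo M are the possible images of ω in ℤ/M.
  F : ℤ → ℤ
  F z = z * z + z + 1ℤ

  -- The pair (x , y) stands for the Eisenstein integer x + y ω, where ω² + ω + 1 = 0.
  Eis : Set
  Eis = ℤ × ℤ

  infixl 6 _⊕_
  _⊕_ : Eis → Eis → Eis
  (x , y) ⊕ (x′ , y′) = x + x′ , y + y′

  ⊖_ : Eis → Eis
  ⊖ (x , y) = - x , - y

  ω· : Eis → Eis
  ω· (x , y) = - y , x - y

  -- For M ∣ c² + c + 1 this is the ideal G ⟨ M , ω − c ⟩ of index G² M.
  record Ideal (G M c : ℕ) (v : Eis) : Set where
    constructor _&_
    field
      G∣y     : + G ∣ proj₂ v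
      GM∣x+cy : + G * + M ∣ proj₁ v + + c * proj₂ v

  open Ideal

  module _ {G M c : ℕ} where

    Ideal-⊕ : ∀ {v w} → Ideal G M c v → Ideal G M c w → Ideal G M c (v ⊕ w)
    Ideal-⊕ {x , y} {x′ , y′} (g & m) (g′ & m′) = ∣m∣n⇒∣m+n g g′ & ∣-resp (eq x y x′ y′ (+ c)) (∣m∣n⇒∣m+n m m′)
      where
      eq : ∀ x y x′ y′ c → (x + c * y) + (x′ + c * y′) ≡ x + x′ + c * (y + y′)
      eq = solve-∀

    Ideal-⊖ : ∀ {v} → Ideal G M c v → Ideal G M c (⊖ v)
    Ideal-⊖ {x , y} (g & m) = ∣m⇒∣-m g & ∣-resp (eq x y (+ c)) (∣m⇒∣-m m)
      where
      eq : ∀ x y c → - (x + c * y) ≡ - x + c * - y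
      eq = solve-∀

    -- x + c y is the value of x + y ω at ω = c. Multiplication by ω turns it into c (x + c y) - y
    -- F(c), which is where M has to divide F(c).
    Ideal-ω : + M ∣ F (+ c) → ∀ {v} → Ideal G M c v → Ideal G M c (ω· v)
    Ideal-ω (divides q Fc) {x , y} (divides k y≡kG & divides l eq) =
      divides (l * + M - + c * k - k) (trans (cong₂ _-_ x≡ y≡kG) (eq₁ l (+ G) (+ M) (+ c) k)) &
      divides (+ c * l - k * q) (begin
        - y + + c * (x - y)                                     ≡⟨ eq₂ x y (+ c) ⟩
        + c * (x + + c * y) - y * F (+ c)                       ≡⟨ cong₂ _-_ (cong (+ c *_) eq) (cong₂ _*_ y≡kG Fc) ⟩
        + c * (l * (+ G * + M)) - k * + G * (q * + M)           ≡⟨ eq₃ (+ c) l (+ G) (+ M) k q ⟩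
        (+ c * l - k * q) * (+ G * + M) ∎)
      where
      open ≡-Reasoning
      x≡ : x ≡ l * (+ G * + M) - + c * (k * + G)
      x≡ = trans (e x y (+ c)) (cong₂ (λ a b → a - + c * b) eq y≡kG)
        where
        e : ∀ x y c → x ≡ (x + c * y) - c * y
        e = solve-∀
      eq₁ : ∀ l G M c k → (l * (G * M) - c * (k * G)) - k * G ≡ (l * M - c * k - k) * G
      eq₁ = solve-∀
      eq₂ : ∀ x y c → - y + c * (x - y) ≡ c * (x + c * y) - y * (c * c + c + 1ℤ)
      eq₂ = solve-∀
      eq₃ : ∀ c l G M k q → c * (l * (G * M)) - k * G * (q * M) ≡ (c * l - k * q) * (G * M)
      eq₃ = solve-∀

    module _ .{{_ : NonZero G}} .{{_ : NonZero M}} where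
      private
        instance
          GM-nonZero : NonZero (G ℕ.* M)
          GM-nonZero = ℕ.m*n≢0 G M

      -- Subtracting `y /ℕ G` copies of the basis vector G (ω - c) brings y into the range below G
      -- and adds c times that multiple of G to x, which is then reduced modulo G M.
      reduce : Eis → Fin G × Fin (G ℕ.* M)
      reduce (x , y) = fromℕ< (n%ℕd<d y G) , fromℕ< (n%ℕd<d (x + + c * (y /ℕ G * + G)) (G ℕ.* M))

      representative : Fin G × Fin (G ℕ.* M) → Eis
      representative (i , j) = + toℕ j , + toℕ i

      reduce-congruent : ∀ v → Ideal G M c (v ⊕ (⊖ representative (reduce v)))
      reduce-congruent (x , y)
        rewrite toℕ-fromℕ< (n%ℕd<d y G) | toℕ-fromℕ< (n%ℕd<d (x + + c * (y /ℕ G * + G)) (G ℕ.* M)) =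
        n∣a-a%n y G &
        ∣-resp eq (subst (_∣ z - + (z %ℕ (G ℕ.* M))) (pos-* G M) (n∣a-a%n z (G ℕ.* M)))
        where
        z = x + + c * (y /ℕ G * + G)
        eq : z - + (z %ℕ (G ℕ.* M)) ≡ (x - + (z %ℕ (G ℕ.* M))) + + c * (y - + (y %ℕ G))
        eq = trans (e x (+ c) (y /ℕ G * + G) (+ (z %ℕ (G ℕ.* M))) (+ (y %ℕ G)))
                   (cong (λ u → (x - + (z %ℕ (G ℕ.* M))) + + c * (u - + (y %ℕ G))) (sym (a≡a%ℕn+[a/ℕn]*n y G)))
          where
          e : ∀ x c q r s → x + c * q - r ≡ (x - r) + c * ((s + q) - s)
          e = solve-∀

      representative-unique : ∀ {p q} → Ideal G M c (representative p ⊕ (⊖ representative q)) → p ≡ q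
      representative-unique {i , j} {i′ , j′} (g & m) with toℕ-injective (residue-unique (toℕ<n i) (toℕ<n i′) g)
      ... | refl = cong (i ,_) (toℕ-injective (residue-unique (toℕ<n j) (toℕ<n j′)
                     (subst₂ _∣_ (sym (pos-* G M)) (e (+ toℕ j - + toℕ j′) (+ c) (+ toℕ i)) m)))
        where
        e : ∀ x c y → x + c * (y - y) ≡ x
        e = solve-∀

      reduce-cong : ∀ {v w} → Ideal G M c (v ⊕ (⊖ w)) → reduce v ≡ reduce w
      reduce-cong {v} {w} d = representative-unique
        (subst (Ideal G M c) (eq v w (representative (reduce v)) (representative (reduce w)))
          (Ideal-⊕ d (Ideal-⊕ (Ideal-⊖ (reduce-congruent v)) (reduce-congruent w))))
        where
        e : ∀ v w r s → (v - w) + (- (v - r) + (w - s)) ≡ r - s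
        e = solve-∀
        eq : ∀ v w r s → (v ⊕ (⊖ w)) ⊕ ((⊖ (v ⊕ (⊖ r))) ⊕ (w ⊕ (⊖ s))) ≡ r ⊕ (⊖ s)
        eq (v , v′) (w , w′) (r , r′) (s , s′) = cong₂ _,_ (e v w r s) (e v′ w′ r′ s′)

      reduce-injective : ∀ {v w} → reduce v ≡ reduce w → Ideal G M c (v ⊕ (⊖ w))
      reduce-injective {v} {w} r≡ = subst (Ideal G M c) (eq v w (representative (reduce v)))
        (Ideal-⊕ (reduce-congruent v)
          (Ideal-⊖ (subst (λ r → Ideal G M c (w ⊕ (⊖ representative r))) (sym r≡) (reduce-congruent w))))
        where
        e : ∀ v w r → (v - r) + - (w - r) ≡ v - w
        e = solve-∀
        eq : ∀ v w r → (v ⊕ (⊖ r)) ⊕ (⊖ (w ⊕ (⊖ r))) ≡ v ⊕ (⊖ w)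
        eq (v , v′) (w , w′) (r , r′) = cong₂ _,_ (e v w r) (e v′ w′ r′)

      reduce-representative : ∀ p → reduce (representative p) ≡ p
      reduce-representative p = representative-unique
        (subst (Ideal G M c) (eq (representative p) (representative (reduce (representative p)))) (Ideal-⊖ (reduce-congruent (representative p))))
        where
        e : ∀ v r → - (v - r) ≡ r - v
        e = solve-∀
        eq : ∀ v r → ⊖ (v ⊕ (⊖ r)) ≡ r ⊕ (⊖ v)
        eq (v , v′) (r , r′) = cong₂ _,_ (e v r) (e v′ r′)

    generator₁∈Ideal : Ideal G M c (+ G * + M , 0ℤ)
    generator₁∈Ideal = divides 0ℤ (sym (*-zeroˡ (+ G))) & divides 1ℤ (e (+ G) (+ M) (+ c))
      where
      e : ∀ G M c → G * M + c * 0ℤ ≡ 1ℤ * (G * M)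
      e = solve-∀

    generator₂∈Ideal : Ideal G M c (- (+ G * + c) , + G)
    generator₂∈Ideal = ∣-refl & divides 0ℤ (e (+ G) (+ c) (+ M))
      where
      e : ∀ G c M → - (G * c) + c * G ≡ 0ℤ * (G * M)
      e = solve-∀

  Ideal-⊆⇒G∣ : ∀ {G M c G′ M′ c′} → (∀ v → Ideal G M c v → Ideal G′ M′ c′ v) → G′ ℕ.∣ G
  Ideal-⊆⇒G∣ {G} {M} {c} to = ∣⇒∣ᵤ (G∣y (to (- (+ G * + c) , + G) generator₂∈Ideal))

  module _ {G} .{{_ : NonZero G}} {M c M′ c′} (to : ∀ v → Ideal G M c v → Ideal G M′ c′ v) where

    Ideal-⊆⇒M∣ : M′ ℕ.∣ M
    Ideal-⊆⇒M∣ = ∣⇒∣ᵤ (*-cancelˡ-∣ (+ G) (∣-resp (e (+ G * + M) (+ c′)) (GM∣x+cy (to (+ G * + M , 0ℤ) generator₁∈Ideal))))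
      where
      e : ∀ x c → x + c * 0ℤ ≡ x
      e = solve-∀

    Ideal-⊆⇒M∣c′-c : + M′ ∣ + c′ - + c
    Ideal-⊆⇒M∣c′-c = *-cancelˡ-∣ (+ G) (∣-resp (e (+ G) (+ c) (+ c′)) (GM∣x+cy (to (- (+ G * + c) , + G) generator₂∈Ideal)))
      where
      e : ∀ G c c′ → - (G * c) + c′ * G ≡ G * (c′ - c)
      e = solve-∀

  -- Mutual inclusion, tested on the basis vectors G M and G (ω - c), makes the invariants divide
  -- each other and leaves c determined modulo M.
  Ideal-unique : ∀ {G M c G′ M′ c′} .{{_ : NonZero G}} → c ℕ.< M → c′ ℕ.< M′ →
    (∀ v → Ideal G M c v → Ideal G′ M′ c′ v) → (∀ v → Ideal G′ M′ c′ v → Ideal G M c v) →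
    (G ≡ G′) × (M ≡ M′) × (c ≡ c′)
  Ideal-unique {G} {M} {c} {G′} {M′} {c′} c<M c′<M′ to from = step (ℕ.∣-antisym (Ideal-⊆⇒G∣ from) (Ideal-⊆⇒G∣ to)) from to
    where
    step : ∀ {G′} → G ≡ G′ → (∀ v → Ideal G′ M′ c′ v → Ideal G M c v) → (∀ v → Ideal G M c v → Ideal G′ M′ c′ v) →
           (G ≡ G′) × (M ≡ M′) × (c ≡ c′)
    step refl from to = refl , M≡M′ , sym (residue-unique c′<M′ (subst (c ℕ.<_) M≡M′ c<M) (Ideal-⊆⇒M∣c′-c to))
      where
      M≡M′ : M ≡ M′
      M≡M′ = ℕ.∣-antisym (Ideal-⊆⇒M∣ from) (Ideal-⊆⇒M∣ to)

-- Normal form of a lattice stable under ω.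

module HermiteNormalForm where

  open EisensteinIdeals
  open import Data.Nat as ℕ using (ℕ; zero; suc; NonZero; s≤s)
  import Data.Nat.Properties as ℕ
  import Data.Nat.Divisibility as ℕ
  open import Data.Integer using (ℤ; +_; -[1+_]; _+_; _*_; -_; _-_; 0ℤ; 1ℤ)
  open import Data.Integer.Properties using (pos-*)
  open import Data.Integer.DivMod using (_%ℕ_; _/ℕ_; n%ℕd<d; a≡a%ℕn+[a/ℕn]*n)
  open import Data.Integer.Divisibility.Signed using (_∣_; divides; ∣⇒∣ᵤ; ∣m∣n⇒∣m+n; ∣-refl; ∣m⇒∣-m; *-cancelˡ-∣)
  open import Data.Integer.Tactic.RingSolver using (solve-∀)
  open import Data.Fin using (Fin; toℕ; fromℕ<)
  open import Data.Fin.Properties using (any?; toℕ-fromℕ<)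
  open import Data.Product using (∃; _×_; _,_)
  open import Data.Sum using (inj₁; inj₂)
  open import Relation.Nullary using (¬_; yes; no; contradiction)
  open import Relation.Unary using (Decidable)
  open import Relation.Binary.PropositionalEquality using (_≡_; refl; sym; trans; cong; cong₂; subst; subst₂; module ≡-Reasoning)

  least : {P : ℕ → Set} → Decidable P → ∀ n → P n → ∃ λ m → P m × (∀ k → k ℕ.< m → ¬ P k)
  least {P} P? n Pn = search n 0 (λ _ ()) (subst P (sym (ℕ.+-identityʳ n)) Pn)
    where
    search : ∀ l m → (∀ k → k ℕ.< m → ¬ P k) → P (l ℕ.+ m) → ∃ λ m → P m × (∀ k → k ℕ.< m → ¬ P k)
    search zero    m below Pm = m , Pm , below
    search (suc l) m below Pn with P? m
    ... | yes Pm = m , Pm , below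
    ... | no ¬Pm = search l (suc m) below′ (subst P (sym (ℕ.+-suc l m)) Pn)
      where
      below′ : ∀ k → k ℕ.< suc m → ¬ P k
      below′ k k<1+m with ℕ.m<1+n⇒m<n∨m≡n k<1+m
      ... | inj₁ k<m  = below k k<m
      ... | inj₂ refl = ¬Pm

  module _ (S : ℤ → Set) (S-+ : ∀ {x y} → S x → S y → S (x + y)) (S-neg : ∀ {x} → S x → S (- x)) where

    private
      S-scaleℕ : ∀ n {x} → S x → S (+ n * x)
      S-scaleℕ zero {x} Sx = subst S (e x) (S-+ Sx (S-neg Sx))
        where
        e : ∀ x → x + - x ≡ 0ℤ * x
        e = solve-∀
      S-scaleℕ (suc n) {x} Sx = subst S (e (+ n) x) (S-+ Sx (S-scaleℕ n Sx))
        where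
        e : ∀ n x → x + n * x ≡ (1ℤ + n) * x
        e = solve-∀

    -- The predicate is arbitrary so that it also covers the multiples of a fixed vector that lie in
    -- a lattice, that are realised by a word, or that are compatible with a rotation.
    subgroup-scale : ∀ k {x} → S x → S (k * x)
    subgroup-scale (+ n)    Sx = S-scaleℕ n Sx
    subgroup-scale -[1+ n ] {x} Sx = subst S (e (+ suc n) x) (S-neg (S-scaleℕ (suc n) Sx))
      where
      e : ∀ n x → - (n * x) ≡ - n * x
      e = solve-∀

    private
      cancel : ∀ r z → (r + z) + - z ≡ r
      cancel = solve-∀

      0+z≡z : ∀ z → 0ℤ + z ≡ z
      0+z≡z = solve-∀

    least-divides : ∀ a → S (+ suc a) → (∀ k → k ℕ.< a → ¬ S (+ suc k)) → ∀ x → S x → + suc a ∣ x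
    least-divides a Sa below x Sx = go (x %ℕ suc a) (x /ℕ suc a) (n%ℕd<d x (suc a)) (a≡a%ℕn+[a/ℕn]*n x (suc a))
      where
      go : ∀ r q → r ℕ.< suc a → x ≡ + r + q * + suc a → + suc a ∣ x
      go zero    q _         eq = divides q (trans eq (0+z≡z _))
      go (suc r) q (s≤s r<a) eq = contradiction
        (subst S (trans (cong (_+ - (q * + suc a)) eq) (cancel (+ suc r) (q * + suc a))) (S-+ Sx (S-neg (subgroup-scale q Sa))))
        (below r r<a)

  module _ (Λ : Eis → Set)
    (Λ-⊕ : ∀ {v w} → Λ v → Λ w → Λ (v ⊕ w)) (Λ-⊖ : ∀ {v} → Λ v → Λ (⊖ v)) (Λ-ω : ∀ {v} → Λ v → Λ (ω· v)) where

    private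
      Λ-scale : ∀ k {x y} → Λ (x , y) → Λ (k * x , k * y)
      Λ-scale k {x} {y} Λv = subst₂ (λ a b → Λ (a , b)) (comm x k) (comm y k)
        (subgroup-scale (λ k → Λ (x * k , y * k)) add neg k (subst₂ (λ a b → Λ (a , b)) (one x) (one y) Λv))
        where
        comm : ∀ x k → x * (k * 1ℤ) ≡ k * x
        comm = solve-∀
        one : ∀ x → x ≡ x * 1ℤ
        one = solve-∀
        dist : ∀ x k l → x * k + x * l ≡ x * (k + l)
        dist = solve-∀
        dneg : ∀ x k → - (x * k) ≡ x * - k
        dneg = solve-∀
        add : ∀ {k l} → Λ (x * k , y * k) → Λ (x * l , y * l) → Λ (x * (k + l) , y * (k + l))
        add {k} {l} p q = subst₂ (λ a b → Λ (a , b)) (dist x k l) (dist y k l) (Λ-⊕ p q)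
        neg : ∀ {k} → Λ (x * k , y * k) → Λ (x * - k , y * - k)
        neg {k} p = subst₂ (λ a b → Λ (a , b)) (dneg x k) (dneg y k) (Λ-⊖ p)

      Result : Set
      Result = ∃ λ G → ∃ λ M → ∃ λ c → NonZero G × (c ℕ.< M) × (+ M ∣ F (+ c)) ×
        (∀ v → Λ v → Ideal G M c v) × (∀ v → Ideal G M c v → Λ v)

      from-basis : ∀ G .{{_ : NonZero G}} M c → c ℕ.< M → Λ (+ G * + M , 0ℤ) → Λ (- (+ G * + c) , + G) →
        (∀ x → Λ (x , 0ℤ) → + G * + M ∣ x) → (∀ x y → Λ (x , y) → + G ∣ y) → Result
      from-basis G M c c<M Λ₁ Λ₂ GM∣ G∣ = G , M , c , ℕ.≢-nonZero (ℕ.≢-nonZero⁻¹ G) , c<M , M∣Fc , to , from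
        where
        to : ∀ v → Λ v → Ideal G M c v
        to (x , y) Λv with G∣ x y Λv
        ... | divides k y≡kG = divides k y≡kG & ∣-resp (trans (e₃ x k (+ G) (+ c)) (cong (λ z → x + + c * z) (sym y≡kG)))
                (GM∣ _ (subst (λ z → Λ (x + (- k) * - (+ G * + c) , z)) (trans (cong (_+ (- k) * + G) y≡kG) (e₂ k (+ G)))
                  (Λ-⊕ Λv (Λ-scale (- k) Λ₂))))
          where
          e₂ : ∀ k G → k * G + (- k) * G ≡ 0ℤ
          e₂ = solve-∀
          e₃ : ∀ x k G c → x + (- k) * - (G * c) ≡ x + c * (k * G)
          e₃ = solve-∀

        from : ∀ v → Ideal G M c v → Λ v
        from (x , y) (divides k y≡kG & divides l eq) =
          subst₂ (λ a b → Λ (a , b)) x≡ (trans (e₂ k (+ G) l) (sym y≡kG)) (Λ-⊕ (Λ-scale k Λ₂) (Λ-scale l Λ₁))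
          where
          e₁ : ∀ k G c l M → k * - (G * c) + l * (G * M) ≡ l * (G * M) - c * (k * G)
          e₁ = solve-∀
          e₂ : ∀ k G l → k * G + l * 0ℤ ≡ k * G
          e₂ = solve-∀
          e₃ : ∀ x c y → (x + c * y) - c * y ≡ x
          e₃ = solve-∀
          x≡ : k * - (+ G * + c) + l * (+ G * + M) ≡ x
          x≡ = trans (e₁ k (+ G) (+ c) l (+ M))
                 (trans (cong₂ (λ u w → u - + c * w) (sym eq) (sym y≡kG)) (e₃ x (+ c) y))

        -- The vector ω · G (ω - c) lies in Λ, and its value at ω = c is -G F(c); so G M divides G
        -- F(c).
        M∣Fc : + M ∣ F (+ c)
        M∣Fc = *-cancelˡ-∣ (+ G) (∣-resp (e (+ G) (+ c)) (∣m⇒∣-m (Ideal.GM∣x+cy (to _ (Λ-ω Λ₂)))))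
          where
          e : ∀ G c → - (- G + c * (- (G * c) - G)) ≡ G * (c * c + c + 1ℤ)
          e = solve-∀

      -- Stability under ω forces the least positive second coordinate G to divide both a and b.
      from-minima : ∀ a G b → Λ (+ suc a , 0ℤ) → Λ (+ b , + suc G) →
        (∀ x → Λ (x , 0ℤ) → + suc a ∣ x) → (∀ x y → Λ (x , y) → + suc G ∣ y) → Result
      from-minima a-1 G-1 b Λa Λb a∣ G∣ = go (∣⇒∣ᵤ G∣a) (∣⇒∣ᵤ G∣b)
        where
        a = suc a-1
        G = suc G-1

        G∣a : + G ∣ + a
        G∣a = ∣-resp (e (+ a)) (G∣ _ _ (Λ-ω Λa))
          where
          e : ∀ z → z - 0ℤ ≡ z
          e = solve-∀

        G∣b : + G ∣ + b
        G∣b = ∣-resp (e (+ b) (+ G)) (∣m∣n⇒∣m+n (G∣ _ _ (Λ-ω Λb)) ∣-refl)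
          where
          e : ∀ b G → b - G + G ≡ b
          e = solve-∀

        module _ (M B : ℕ) (b≡BG : b ≡ B ℕ.* G) (c : ℕ) (q : ℤ) (-B≡ : - + B ≡ + c + q * + M) (Λ₁ : Λ (+ G * + M , 0ℤ)) where
          -- As b = B G and -B = c + q M, adding q copies of G M to the lattice point (b , G) yields
          -- G (ω - c).
          Λ₂ : Λ (- (+ G * + c) , + G)
          Λ₂ = subst₂ (λ u w → Λ (u , w)) (begin
                 + b + q * (+ G * + M)          ≡⟨ cong (_+ q * (+ G * + M)) (trans (cong +_ b≡BG) (pos-* B G)) ⟩
                 + B * + G + q * (+ G * + M)    ≡⟨ e₁ (+ B) (+ G) q (+ M) ⟩
                 - (+ G * (- + B - q * + M))    ≡⟨ cong (λ u → - (+ G * (u - q * + M))) -B≡ ⟩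
                 - (+ G * (+ c + q * + M - q * + M)) ≡⟨ e₂ (+ G) (+ c) (q * + M) ⟩
                 - (+ G * + c) ∎) (e₃ q (+ G)) (Λ-⊕ Λb (Λ-scale q Λ₁))
            where
            open ≡-Reasoning
            e₁ : ∀ B G q M → B * G + q * (G * M) ≡ - (G * (- B - q * M))
            e₁ = solve-∀
            e₂ : ∀ G c z → - (G * (c + z - z)) ≡ - (G * c)
            e₂ = solve-∀
            e₃ : ∀ q G → G + q * 0ℤ ≡ G
            e₃ = solve-∀

        go : G ℕ.∣ a → G ℕ.∣ b → Result
        go (ℕ.divides (suc M-1) a≡MG) (ℕ.divides B b≡BG) =
          from-basis G M c (n%ℕd<d (- + B) M) Λ₁ (Λ₂ M B b≡BG c (- + B /ℕ M) (a≡a%ℕn+[a/ℕn]*n (- + B) M) Λ₁)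
            (λ x Λx → subst (_∣ x) a≡ (a∣ x Λx)) G∣
          where
          M = suc M-1
          c = (- + B) %ℕ M
          a≡ : + a ≡ + G * + M
          a≡ = trans (cong +_ (trans a≡MG (ℕ.*-comm M G))) (pos-* G M)
          Λ₁ : Λ (+ G * + M , 0ℤ)
          Λ₁ = subst (λ z → Λ (z , 0ℤ)) a≡ Λa

    -- One positive integer in Λ bounds both searches: it bounds the least positive integer a of Λ,
    -- and ω a has second coordinate a, which bounds the least positive height.
    hermiteNormalForm : Decidable Λ → ∀ a → Λ (+ suc a , 0ℤ) → Result
    hermiteNormalForm Λ? a₀ Λa₀ with least {λ a → Λ (+ suc a , 0ℤ)} (λ a → Λ? (+ suc a , 0ℤ)) a₀ Λa₀
    ... | a , Λa , a-least = G-step (least R? a (Λ⇒R _ a Λωa))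
      where
      -- First coordinates matter only modulo a, so whether Λ has a point at height d + 1 is a
      -- finite question.
      R : ℕ → Set
      R d = ∃ λ (x : Fin (suc a)) → Λ (+ toℕ x , + suc d)

      R? : Decidable R
      R? d = any? (λ x → Λ? (+ toℕ x , + suc d))

      Λ⇒R : ∀ x d → Λ (x , + suc d) → R d
      Λ⇒R x d Λv = go (x %ℕ suc a) (x /ℕ suc a) (n%ℕd<d x (suc a)) (a≡a%ℕn+[a/ℕn]*n x (suc a))
        where
        e : ∀ r q a → (r + q * a) + (- q) * a ≡ r
        e = solve-∀
        e′ : ∀ q d → d + (- q) * 0ℤ ≡ d
        e′ = solve-∀
        go : ∀ r q → r ℕ.< suc a → x ≡ + r + q * + suc a → R d
        go r q r<a eq = fromℕ< r<a , subst₂ (λ u w → Λ (u , w))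
          (trans (cong (_+ (- q) * + suc a) eq) (trans (e (+ r) q (+ suc a)) (cong +_ (sym (toℕ-fromℕ< r<a)))))
          (e′ q (+ suc d)) (Λ-⊕ Λv (Λ-scale (- q) Λa))

      Λωa : Λ (- 0ℤ , + suc a)
      Λωa = subst (λ z → Λ (- 0ℤ , z)) (e (+ suc a)) (Λ-ω Λa)
        where
        e : ∀ z → z - 0ℤ ≡ z
        e = solve-∀

      G-step : (∃ λ G → R G × (∀ k → k ℕ.< G → ¬ R k)) → Result
      G-step (G , (b , Λb) , G-least) = from-minima a G (toℕ b) Λa Λb
        (least-divides (λ x → Λ (x , 0ℤ)) Λ-⊕ Λ-⊖ a Λa a-least)
        (λ x y Λv → least-divides (λ y → ∃ λ x → Λ (x , y)) (λ { (_ , p) (_ , q) → _ , Λ-⊕ p q }) (λ { (_ , p) → _ , Λ-⊖ p })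
          G (_ , Λb) (λ { k k<G (x , p) → G-least k k<G (Λ⇒R x k p) }) y (x , Λv))

-- Coordinates on the darts of the folded tiling.

module DartCoordinates where

  open import Defs
  open EisensteinIdeals
  open HermiteNormalForm using (subgroup-scale)
  open import Data.Nat using (ℕ; zero; suc)
  open import Data.Integer using (+_; _+_; _*_; -_; _-_; 0ℤ; 1ℤ)
  open import Data.Integer.Tactic.RingSolver using (solve-∀)
  open import Data.Fin using (Fin) renaming (zero to fzero; suc to fsuc)
  open import Data.List using (List; []; _∷_; _++_)
  open import Data.Bool using (Bool; true; false)
  open import Data.Product using (∃; _×_; _,_; proj₁; proj₂)
  open import Function using (_∘_)
  open import Relation.Binary.PropositionalEquality using (_≡_; _≢_; refl; sym; trans; cong; cong₂; subst; module ≡-Reasoning)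

  next : Fin 3 → Fin 3
  next fzero               = fsuc fzero
  next (fsuc fzero)        = fsuc (fsuc fzero)
  next (fsuc (fsuc fzero)) = fzero

  next³ : ∀ k → next (next (next k)) ≡ k
  next³ fzero               = refl
  next³ (fsuc fzero)        = refl
  next³ (fsuc (fsuc fzero)) = refl

  next≢ : ∀ k → next k ≢ k
  next≢ fzero               ()
  next≢ (fsuc fzero)        ()
  next≢ (fsuc (fsuc fzero)) ()

  next²≢ : ∀ k → next (next k) ≢ k
  next²≢ fzero               ()
  next²≢ (fsuc fzero)        ()
  next²≢ (fsuc (fsuc fzero)) ()

  𝟙 : Eis
  𝟙 = 1ℤ , 0ℤ

  -- ρ is multiplication by −ω, the rotation by −60°.
  ρ : Eis → Eis
  ρ (x , y) = y , y - x

  ρ⁻¹ : Eis → Eis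
  ρ⁻¹ (x , y) = x - y , x

  -- The darts of the hexagonal tiling, modulo the half turn about the centre of the hexagon at the origin.
  -- A dart is reached from the base dart by rotating k times about the origin and then translating by v in
  -- its own frame, so that φ acts as (v , k) ↦ (−ω v , k + 1).
  Dart : Set
  Dart = Eis × Fin 3

  σ̂ : Dart → Dart
  σ̂ (v , k) = ω· (v ⊕ 𝟙) , next k

  α̂ : Dart → Dart
  α̂ (v , k) = ⊖ (v ⊕ 𝟙) , k

  φ̂ : Dart → Dart
  φ̂ (v , k) = ρ v , next k

  σ̂α̂ : ∀ p → σ̂ (α̂ p) ≡ φ̂ p
  σ̂α̂ ((x , y) , k) = cong (_, next k) (cong₂ _,_ (e₁ y) (e₂ x y))
    where
    e₁ : ∀ y → - (- (y + 0ℤ) + 0ℤ) ≡ y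
    e₁ = solve-∀
    e₂ : ∀ x y → (- (x + 1ℤ) + 1ℤ) - (- (y + 0ℤ) + 0ℤ) ≡ y - x
    e₂ = solve-∀

  α̂² : ∀ p → α̂ (α̂ p) ≡ p
  α̂² ((x , y) , k) = cong (_, k) (cong₂ _,_ (e₁ x) (e₂ y))
    where
    e₁ : ∀ x → - (- (x + 1ℤ) + 1ℤ) ≡ x
    e₁ = solve-∀
    e₂ : ∀ x → - (- (x + 0ℤ) + 0ℤ) ≡ x
    e₂ = solve-∀

  σ̂³ : ∀ p → σ̂ (σ̂ (σ̂ p)) ≡ p
  σ̂³ ((x , y) , k) = cong₂ _,_ (cong₂ _,_ (e₁ x y) (e₂ x y)) (next³ k)
    where
    e₁ : ∀ x y → - (((- (y + 0ℤ)) + 1ℤ - ((x + 1ℤ - (y + 0ℤ)) + 0ℤ)) + 0ℤ) ≡ x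
    e₁ = solve-∀
    e₂ : ∀ x y → (- ((x + 1ℤ - (y + 0ℤ)) + 0ℤ) + 1ℤ) - (((- (y + 0ℤ)) + 1ℤ - ((x + 1ℤ - (y + 0ℤ)) + 0ℤ)) + 0ℤ) ≡ y
    e₂ = solve-∀

  ρ³ : ∀ v → ρ (ρ (ρ v)) ≡ ⊖ v
  ρ³ (x , y) = cong₂ _,_ (e₁ x y) (e₂ x y)
    where
    e₁ : ∀ x y → (y - x) - y ≡ - x
    e₁ = solve-∀
    e₂ : ∀ x y → ((y - x) - y) - (y - x) ≡ - y
    e₂ = solve-∀

  ρ-⊕ : ∀ v w → ρ (v ⊕ w) ≡ ρ v ⊕ ρ w
  ρ-⊕ (x , y) (x′ , y′) = cong (y + y′ ,_) (e x y x′ y′)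
    where
    e : ∀ x y x′ y′ → (y + y′) - (x + x′) ≡ (y - x) + (y′ - x′)
    e = solve-∀

  ⊖⊖ : ∀ v → ⊖ (⊖ v) ≡ v
  ⊖⊖ (x , y) = cong₂ _,_ (e x) (e y)
    where
    e : ∀ x → - - x ≡ x
    e = solve-∀

  ⊕-cancelˡ : ∀ v w → (v ⊕ w) ⊕ (⊖ v) ≡ w
  ⊕-cancelˡ (x , y) (x′ , y′) = cong₂ _,_ (e x x′) (e y y′)
    where
    e : ∀ x y → (x + y) - x ≡ y
    e = solve-∀

  -- Words in σ (true) and α (false), acting from right to left.
  act : ∀ {a} {A : Set a} → (A → A) → (A → A) → List Bool → A → A
  act s a []          x = x
  act s a (true ∷ u)  x = s (act s a u x)
  act s a (false ∷ u) x = a (act s a u x)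

  act-++ : ∀ {a} {A : Set a} (s t : A → A) u w x → act s t (u ++ w) x ≡ act s t u (act s t w x)
  act-++ s t []          w x = refl
  act-++ s t (true ∷ u)  w x = cong s (act-++ s t u w x)
  act-++ s t (false ∷ u) w x = cong t (act-++ s t u w x)

  private
    record Translates (u : List Bool) (w : Eis) : Set where
      constructor translates
      field run : ∀ v k → act σ̂ α̂ u (v , k) ≡ (v ⊕ w , k)
    open Translates

    ActsAsφ^ : ℕ → List Bool → Set
    ActsAsφ^ n u = ∀ p → act σ̂ α̂ u p ≡ iter φ̂ n p

    φ^-word : ∀ n → ∃ (ActsAsφ^ n)
    φ^-word zero    = [] , λ _ → refl
    φ^-word (suc n) with φ^-word n
    ... | u , h = true ∷ false ∷ u , λ p → trans (σ̂α̂ _) (cong φ̂ (h p))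

    -- φ³ acts as the half turn v ↦ -v and α as v ↦ -(v + 1), so φ³ α adds 1.
    translates-1 : ∀ {u} → ActsAsφ^ 3 u → Translates (u ++ false ∷ []) 𝟙
    translates-1 {u} φ³ = translates λ v k → trans (act-++ σ̂ α̂ u (false ∷ []) (v , k)) (trans (φ³ (α̂ (v , k)))
      (cong₂ _,_ (trans (ρ³ (⊖ (v ⊕ 𝟙))) (⊖⊖ (v ⊕ 𝟙))) (next³ k)))

    translates-⊕ : ∀ {u u′ w w′} → Translates u w → Translates u′ w′ → Translates (u ++ u′) (w ⊕ w′)
    translates-⊕ {u} {u′} {w} {w′} (translates t) (translates t′) = translates λ v k → trans (act-++ σ̂ α̂ u u′ (v , k)) (trans (cong (act σ̂ α̂ u) (t′ v k))
      (trans (t (v ⊕ w′) k) (cong (_, k) (e v w w′))))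
      where
      e₁ : ∀ x y z → x + z + y ≡ x + (y + z)
      e₁ = solve-∀
      e : ∀ v w w′ → (v ⊕ w′) ⊕ w ≡ v ⊕ (w ⊕ w′)
      e (x , y) (x′ , y′) (x″ , y″) = cong₂ _,_ (e₁ x x′ x″) (e₁ y y′ y″)

    -- Conjugation by φ, with φ⁵ as its inverse: ρ⁶ = 1, and six steps bring k back.
    translates-ρ⁻¹ : ∀ {a b u w} → ActsAsφ^ 5 a → ActsAsφ^ 1 b → Translates u w → Translates (a ++ u ++ b) (ρ⁻¹ w)
    translates-ρ⁻¹ {a} {b} {u} {w} φ⁵ φ¹ (translates t) = translates λ v k → begin
      act σ̂ α̂ (a ++ u ++ b) (v , k)                     ≡⟨ act-++ σ̂ α̂ a (u ++ b) (v , k) ⟩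
      act σ̂ α̂ a (act σ̂ α̂ (u ++ b) (v , k))              ≡⟨ cong (act σ̂ α̂ a) (act-++ σ̂ α̂ u b (v , k)) ⟩
      act σ̂ α̂ a (act σ̂ α̂ u (act σ̂ α̂ b (v , k)))         ≡⟨ cong (λ p → act σ̂ α̂ a (act σ̂ α̂ u p)) (φ¹ (v , k)) ⟩
      act σ̂ α̂ a (act σ̂ α̂ u (ρ v , next k))              ≡⟨ cong (act σ̂ α̂ a) (t (ρ v) (next k)) ⟩
      act σ̂ α̂ a (ρ v ⊕ w , next k)                      ≡⟨ φ⁵ (ρ v ⊕ w , next k) ⟩
      iter φ̂ 5 (ρ v ⊕ w , next k)                       ≡⟨ cong₂ _,_ (rot v w) (trans (next³ (next (next (next k)))) (next³ k)) ⟩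
      (v ⊕ ρ⁻¹ w , k) ∎
      where
      open ≡-Reasoning
      e₁ : ∀ x y z w → - ((y - x) + w) - (- (y + z)) ≡ x + (z - w)
      e₁ = solve-∀
      e₂ : ∀ x y z w → (- ((y - x) + w) - (- (y + z))) - (- ((y - x) + w)) ≡ y + z
      e₂ = solve-∀
      rot : ∀ v w → ρ (ρ (ρ (ρ (ρ (ρ v ⊕ w))))) ≡ v ⊕ ρ⁻¹ w
      rot v@(x , y) w@(z , z′) = trans (cong (ρ ∘ ρ) (ρ³ (ρ v ⊕ w))) (cong₂ _,_ (e₁ x y z z′) (e₂ x y z z′))

    Translatable : Eis → Set
    Translatable w = ∃ λ u → Translates u w

    translatable-ρ⁻¹ : ∀ w → Translatable w → Translatable (ρ⁻¹ w)
    translatable-ρ⁻¹ w (u , t) = conjugate (φ^-word 5) (φ^-word 1)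
      where
      conjugate : ∃ (ActsAsφ^ 5) → ∃ (ActsAsφ^ 1) → Translatable (ρ⁻¹ w)
      conjugate (a , φ⁵) (b , φ¹) = a ++ u ++ b , translates-ρ⁻¹ {a} {b} φ⁵ φ¹ t

    translatable-⊖ : ∀ {w} → Translatable w → Translatable (⊖ w)
    translatable-⊖ {w} t = subst Translatable (e w)
      (translatable-ρ⁻¹ (ρ⁻¹ (ρ⁻¹ w)) (translatable-ρ⁻¹ (ρ⁻¹ w) (translatable-ρ⁻¹ w t)))
      where
      e₁ : ∀ x y → ((x - y) - x) - (x - y) ≡ - x
      e₁ = solve-∀
      e₂ : ∀ x y → (x - y) - x ≡ - y
      e₂ = solve-∀
      e : ∀ w → ρ⁻¹ (ρ⁻¹ (ρ⁻¹ w)) ≡ ⊖ w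
      e (x , y) = cong₂ _,_ (e₁ x y) (e₂ x y)

    translatable-⊕ : ∀ {w w′} → Translatable w → Translatable w′ → Translatable (w ⊕ w′)
    translatable-⊕ {w} {w′} (u , t) (u′ , t′) = u ++ u′ , translates-⊕ t t′

  abstract
    -- The word depends on w alone and not on the dart. Being a word in σ and α, it is respected by
    -- every isomorphism.
    translation-word : ∀ w → ∃ λ u → ∀ v k → act σ̂ α̂ u (v , k) ≡ (v ⊕ w , k)
    translation-word (x , y) = proj₁ word , run (proj₂ word)
      where
      e₁ : ∀ x → x * 1ℤ + 0ℤ ≡ x
      e₁ = solve-∀
      e₂ : ∀ y → 0ℤ + y * 1ℤ ≡ y
      e₂ = solve-∀
      1-Translatable : Translatable 𝟙
      1-Translatable = unit (φ^-word 3)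
        where
        unit : ∃ (ActsAsφ^ 3) → Translatable 𝟙
        unit (a , φ³) = a ++ false ∷ [] , translates-1 {a} φ³
      along-1 : Translatable (x * 1ℤ , 0ℤ)
      along-1 = subgroup-scale (λ x → Translatable (x , 0ℤ)) translatable-⊕ translatable-⊖ x 1-Translatable
      -- ρ⁻² is multiplication by ω, so conjugating the translation by 1 twice gives the translation
      -- by ω.
      along-ω : Translatable (0ℤ , y * 1ℤ)
      along-ω = subgroup-scale (λ y → Translatable (0ℤ , y)) translatable-⊕ translatable-⊖ y
        (translatable-ρ⁻¹ (ρ⁻¹ 𝟙) (translatable-ρ⁻¹ 𝟙 1-Translatable))
      word : Translatable (x , y)
      word = subst Translatable (cong₂ _,_ (e₁ x) (e₂ y)) (translatable-⊕ along-1 along-ω)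

  -- Presents the darts as (ℤ[ω] / Λ) × ℤ/3 without forming a quotient: `dart` is the projection,
  -- `coords` an arbitrary section, and `dart-cong` with `dart-injective` identifies the fibres with
  -- the cosets of the ideal.
  record Coordinates (G M c : ℕ) {n} (s a : Fin n → Fin n) : Set where
    field
      dart      : Dart → Fin n
      coords    : Fin n → Dart
      dart-coords : ∀ d → dart (coords d) ≡ d
      dart-cong : ∀ v w k → Ideal G M c (v ⊕ (⊖ w)) → dart (v , k) ≡ dart (w , k)
      dart-injective : ∀ p q → dart p ≡ dart q → (proj₂ p ≡ proj₂ q) × Ideal G M c (proj₁ p ⊕ (⊖ proj₁ q))
      dart-σ    : ∀ p → s (dart p) ≡ dart (σ̂ p)
      dart-α    : ∀ p → a (dart p) ≡ dart (α̂ p)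

    dart-act : ∀ u p → act s a u (dart p) ≡ dart (act σ̂ α̂ u p)
    dart-act []          p = refl
    dart-act (true ∷ u)  p = trans (cong s (dart-act u p)) (dart-σ _)
    dart-act (false ∷ u) p = trans (cong a (dart-act u p)) (dart-α _)

    dart-φ : ∀ p → s (a (dart p)) ≡ dart (φ̂ p)
    dart-φ p = trans (dart-act (true ∷ false ∷ []) p) (cong dart (σ̂α̂ p))

    dart-φ^ : ∀ n p → iter (λ x → s (a x)) n (dart p) ≡ dart (iter φ̂ n p)
    dart-φ^ zero    p = refl
    dart-φ^ (suc n) p = trans (cong (λ x → s (a x)) (dart-φ^ n p)) (dart-φ _)

    by-coords : ∀ {ℓ} (P : Fin n → Set ℓ) → (∀ p → P (dart p)) → ∀ d → P d
    by-coords P h d = subst P (dart-coords d) (h (coords d))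

  module _ {n m} (T : Trihex n) (U : Trihex m) where
    open Coordinates

    coordinates⇒iso : ∀ {G M c} → Coordinates G M c (σ T) (α T) → Coordinates G M c (σ U) (α U) → Iso T U
    coordinates⇒iso C D = record
      { to      = to C D
      ; from    = to D C
      ; from-to = to-to C D
      ; to-from = to-to D C
      ; pres-σ  = by-coords C (λ d → to C D (σ T d) ≡ σ U (to C D d)) (λ p → trans (cong (to C D) (dart-σ C p)) (trans (to-dart C D (σ̂ p))
                    (trans (sym (dart-σ D p)) (cong (σ U) (sym (to-dart C D p))))))
      ; pres-α  = by-coords C (λ d → to C D (α T d) ≡ α U (to C D d)) (λ p → trans (cong (to C D) (dart-α C p)) (trans (to-dart C D (α̂ p))
                    (trans (sym (dart-α D p)) (cong (α U) (sym (to-dart C D p))))))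
      }
      where
      module _ {n m G M c} {s a : Fin n → Fin n} {s′ a′ : Fin m → Fin m} (C : Coordinates G M c s a) (D : Coordinates G M c s′ a′) where
        to : Fin n → Fin m
        to d = dart D (coords C d)

        to-dart : ∀ p → to (dart C p) ≡ dart D p
        to-dart p with coords C (dart C p) | dart-coords C (dart C p)
        ... | (w , l) | eq with dart-injective C (w , l) p eq
        ...   | refl , d = dart-cong D w (proj₁ p) l d

      to-to : ∀ {n m G M c} {s a : Fin n → Fin n} {s′ a′ : Fin m → Fin m} (C : Coordinates G M c s a) (D : Coordinates G M c s′ a′) →
              ∀ d → to D C (to C D d) ≡ d
      to-to C D = by-coords C (λ d → to D C (to C D d) ≡ d) (λ p → trans (cong (to D C) (to-dart C D p)) (to-dart D C p))

    -- The isomorphism may send the base dart anywhere, but the translation word adds w at every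
    -- dart. If it fixes the base dart, it fixes the image, and there the coordinates differ by
    -- exactly w.
    iso⇒Ideal-⊆ : ∀ {G M c G′ M′ c′} → Coordinates G M c (σ T) (α T) → Coordinates G′ M′ c′ (σ U) (α U) → Iso T U →
      ∀ w → Ideal G M c w → Ideal G′ M′ c′ w
    iso⇒Ideal-⊆ {G} {M} {c} {G′} {M′} {c′} C D h w w∈ = subst (Ideal G′ M′ c′) (⊕-cancelˡ (proj₁ q) w) (proj₂ (dart-injective D (proj₁ q ⊕ w , proj₂ q) q (begin
        dart D (proj₁ q ⊕ w , proj₂ q)          ≡⟨ cong (dart D) (t (proj₁ q) (proj₂ q)) ⟨
        dart D (act σ̂ α̂ u q)                    ≡⟨ dart-act D u q ⟨
        act (σ U) (α U) u (dart D q)            ≡⟨ cong (act (σ U) (α U) u) (dart-coords D _) ⟩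
        act (σ U) (α U) u (Iso.to h d₀)         ≡⟨ commutes u ⟨
        Iso.to h (act (σ T) (α T) u d₀)         ≡⟨ cong (Iso.to h) (dart-act C u o) ⟩
        Iso.to h (dart C (act σ̂ α̂ u o))         ≡⟨ cong (Iso.to h ∘ dart C) (t (proj₁ o) (proj₂ o)) ⟩
        Iso.to h (dart C (proj₁ o ⊕ w , fzero)) ≡⟨ cong (Iso.to h) (dart-cong C (proj₁ o ⊕ w) (proj₁ o) fzero
                                                     (subst (Ideal G M c) (sym (⊕-cancelˡ (proj₁ o) w)) w∈)) ⟩
        Iso.to h d₀                             ≡⟨ dart-coords D _ ⟨
        dart D q ∎)))
      where
      open ≡-Reasoning
      u = proj₁ (translation-word w)
      t = proj₂ (translation-word w)
      o : Dart
      o = (0ℤ , 0ℤ) , fzero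
      d₀ = dart C o
      q = coords D (Iso.to h d₀)
      commutes : ∀ u → Iso.to h (act (σ T) (α T) u d₀) ≡ act (σ U) (α U) u (Iso.to h d₀)
      commutes []          = refl
      commutes (true ∷ u)  = trans (Iso.pres-σ h _) (cong (σ U) (commutes u))
      commutes (false ∷ u) = trans (Iso.pres-α h _) (cong (α U) (commutes u))

-- Coordinates modulo a doubled ideal define a trihex with threefold symmetry.

module TrihexFromCoordinates where

  open import Defs
  open OrbitCounting
  open EulerFormula
  open EisensteinIdeals
  open DartCoordinates
  open import Data.Nat as ℕ using (ℕ; zero; suc; NonZero)
  import Data.Nat.Properties as ℕ
  import Data.Nat.Divisibility as ℕ
  open import Data.Integer using (ℤ; +_; _+_; _*_; -_; _-_; 0ℤ; 1ℤ)
  import Data.Integer.Properties as ℤ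
  open import Data.Integer.Properties using (pos-*)
  open import Data.Integer.DivMod using (_%ℕ_; n%ℕd<d)
  open import Data.Integer.Divisibility.Signed using (_∣_; divides; ∣⇒∣ᵤ; ∣-trans; ∣m⇒∣m*n; ∣m∣n⇒∣m-n; ∣m∣n⇒∣m+n; ∣n⇒∣m*n; ∣-refl; *-cancelʳ-∣)
  open import Data.Integer.Tactic.RingSolver using (solve-∀)
  open import Data.Fin using (Fin; toℕ; fromℕ<; combine; remQuot) renaming (zero to fzero; suc to fsuc)
  open import Data.Fin.Properties using (combine-remQuot; remQuot-combine; toℕ<n; toℕ-fromℕ<; toℕ-injective) renaming (_≟_ to _≟ᶠ_)
  open import Data.List using ([]; _∷_)
  open import Data.Bool using (true; false)
  open import Data.Product using (∃; _×_; _,_; proj₁; proj₂)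
  open import Data.Sum using (_⊎_; inj₁; inj₂)
  open import Function using (_∘_)
  open import Relation.Nullary using (¬_; yes; no; contradiction)
  open import Relation.Binary.PropositionalEquality using (_≡_; _≢_; refl; sym; trans; cong; cong₂; subst; subst₂; module ≡-Reasoning)

  +2* : ∀ g → + (2 ℕ.* g) ≡ + 2 * + g
  +2* g = pos-* 2 g

  next-transitive : ∀ k l → ∃ λ j → iter next j k ≡ l
  next-transitive fzero               fzero               = 0 , refl
  next-transitive fzero               (fsuc fzero)        = 1 , refl
  next-transitive fzero               (fsuc (fsuc fzero)) = 2 , refl
  next-transitive (fsuc fzero)        fzero               = 2 , refl
  next-transitive (fsuc fzero)        (fsuc fzero)        = 0 , refl
  next-transitive (fsuc fzero)        (fsuc (fsuc fzero)) = 1 , refl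
  next-transitive (fsuc (fsuc fzero)) fzero               = 1 , refl
  next-transitive (fsuc (fsuc fzero)) (fsuc fzero)        = 2 , refl
  next-transitive (fsuc (fsuc fzero)) (fsuc (fsuc fzero)) = 0 , refl

  Reach-trans : ∀ {n} {s a : Fin n → Fin n} {d e e′} → Reach s a d e → Reach s a e e′ → Reach s a d e′
  Reach-trans r here      = r
  Reach-trans r (viaσ r′) = viaσ (Reach-trans r r′)
  Reach-trans r (viaα r′) = viaα (Reach-trans r r′)

  Reach-act : ∀ {n} {s a : Fin n → Fin n} u d → Reach s a d (act s a u d)
  Reach-act []          d = here
  Reach-act (true ∷ u)  d = viaσ (Reach-act u d)
  Reach-act (false ∷ u) d = viaα (Reach-act u d)

  module _ {g M c : ℕ} .{{_ : NonZero g}} .{{_ : NonZero M}} where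

    private
      2∣2g : + 2 ∣ + (2 ℕ.* g)
      2∣2g = divides (+ g) (trans (+2* g) (e (+ g)))
        where
        e : ∀ g → + 2 * g ≡ g * + 2
        e = solve-∀

    Ideal-even : ∀ {v} → Ideal (2 ℕ.* g) M c v → (+ 2 ∣ proj₁ v) × (+ 2 ∣ proj₂ v)
    Ideal-even {x , y} (G∣y & GM∣x+cy) =
      ∣-resp (e x (+ c * y)) (∣m∣n⇒∣m-n (∣-trans (∣m⇒∣m*n (+ M) 2∣2g) GM∣x+cy) (∣n⇒∣m*n (+ c) 2∣y)) , 2∣y
      where
      2∣y = ∣-trans 2∣2g G∣y
      e : ∀ x z → (x + z) - z ≡ x
      e = solve-∀

    private
      -- The four classes of the ideal g ⟨ M , ω − c ⟩ modulo its double.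
      halfPeriod : Fin 2 → Fin 2 → Eis
      halfPeriod i j = + toℕ i * (+ g * + M) - + toℕ j * (+ g * + c) , + toℕ j * + g

      double∈ : ∀ i j → Ideal (2 ℕ.* g) M c ((⊖ halfPeriod i j) ⊕ (⊖ halfPeriod i j))
      double∈ i j = divides (- + toℕ j) (trans (e₁ (+ toℕ j) (+ g)) (cong (- + toℕ j *_) (sym (+2* g)))) &
        divides (- + toℕ i) (trans (e₂ (+ toℕ i) (+ toℕ j) (+ g) (+ M) (+ c)) (cong (λ G → - + toℕ i * (G * + M)) (sym (+2* g))))
        where
        e₁ : ∀ j g → - (j * g) - j * g ≡ - j * (+ 2 * g)
        e₁ = solve-∀
        e₂ : ∀ i j g M c → - (i * (g * M) - j * (g * c)) - (i * (g * M) - j * (g * c)) + c * (- (j * g) - j * g) ≡ - i * (+ 2 * g * M)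
        e₂ = solve-∀

      halfPeriod-injective : ∀ i j i′ j′ → Ideal (2 ℕ.* g) M c (halfPeriod i j ⊕ (⊖ halfPeriod i′ j′)) → (i ≡ i′) × (j ≡ j′)
      halfPeriod-injective i j i′ j′ (G∣ & GM∣) = i≡i′ , j≡j′
        where
        instance
          gM≢0 : NonZero (g ℕ.* M)
          gM≢0 = ℕ.m*n≢0 g M
        e₁ : ∀ j j′ g → j * g + - (j′ * g) ≡ (j - j′) * g
        e₁ = solve-∀
        e₂ : ∀ i i′ j g M c → (i * (g * M) - j * (g * c)) + - (i′ * (g * M) - j * (g * c)) + c * (j * g + - (j * g)) ≡ (i - i′) * (g * M)
        e₂ = solve-∀
        j≡j′ : j ≡ j′
        j≡j′ = toℕ-injective (residue-unique (toℕ<n j) (toℕ<n j′)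
          (*-cancelʳ-∣ (+ g) (subst₂ _∣_ (+2* g) (e₁ (+ toℕ j) (+ toℕ j′) (+ g)) G∣)))
        assoc : ∀ g M → + 2 * g * M ≡ + 2 * (g * M)
        assoc = solve-∀
        GM≡ : + (2 ℕ.* g) * + M ≡ + 2 * + (g ℕ.* M)
        GM≡ = trans (cong (_* + M) (+2* g)) (trans (assoc (+ g) (+ M)) (cong (+ 2 *_) (sym (pos-* g M))))
        diff : (+ toℕ i * (+ g * + M) - + toℕ j * (+ g * + c)) + - (+ toℕ i′ * (+ g * + M) - + toℕ j′ * (+ g * + c)) + + c * (+ toℕ j * + g + - (+ toℕ j′ * + g))
               ≡ (+ toℕ i - + toℕ i′) * + (g ℕ.* M)
        diff = trans (cong (λ l → (+ toℕ i * (+ g * + M) - + toℕ j * (+ g * + c)) + - (+ toℕ i′ * (+ g * + M) - + toℕ l * (+ g * + c)) + + c * (+ toℕ j * + g + - (+ toℕ l * + g))) (sym j≡j′))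
                 (trans (e₂ (+ toℕ i) (+ toℕ i′) (+ toℕ j) (+ g) (+ M) (+ c)) (cong ((+ toℕ i - + toℕ i′) *_) (sym (pos-* g M))))
        i≡i′ : i ≡ i′
        i≡i′ = toℕ-injective (residue-unique (toℕ<n i) (toℕ<n i′) (*-cancelʳ-∣ (+ (g ℕ.* M)) (subst₂ _∣_ GM≡ diff GM∣)))

      -- If -2v has coefficients l and k in the basis 2gM, 2g (ω - c), then v has coefficients -l
      -- and -k in the basis gM, g (ω - c), and their parities select the class.
      halfPeriod-complete : ∀ v → Ideal (2 ℕ.* g) M c ((⊖ v) ⊕ (⊖ v)) → ∃ λ i → ∃ λ j → Ideal (2 ℕ.* g) M c (halfPeriod i j ⊕ (⊖ v))
      halfPeriod-complete (x , y) (divides k 2y≡ & divides l eq) =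
        fromℕ< (n%ℕd<d l′ 2) , fromℕ< (n%ℕd<d k′ 2) , subst (λ w → Ideal (2 ℕ.* g) M c (w ⊕ (⊖ (x , y)))) hp≡
          (nearby (l′ %ℕ 2) (k′ %ℕ 2) (n∣a-a%n l′ 2) (n∣a-a%n k′ 2))
        where
        k′ = - k
        l′ = - l
        hp : ℕ → ℕ → Eis
        hp i j = + i * (+ g * + M) - + j * (+ g * + c) , + j * + g
        hp≡ : hp (l′ %ℕ 2) (k′ %ℕ 2) ≡ halfPeriod (fromℕ< (n%ℕd<d l′ 2)) (fromℕ< (n%ℕd<d k′ 2))
        hp≡ = cong₂ hp (sym (toℕ-fromℕ< (n%ℕd<d l′ 2))) (sym (toℕ-fromℕ< (n%ℕd<d k′ 2)))

        y≡ : y ≡ k′ * + g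
        y≡ = ℤ.*-cancelˡ-≡ (+ 2) _ _ (trans (e₁ y) (trans (cong -_ 2y≡) (trans (cong (λ G → - (k * G)) (+2* g)) (e₂ k (+ g)))))
          where
          e₁ : ∀ y → + 2 * y ≡ - (- y - y)
          e₁ = solve-∀
          e₂ : ∀ k g → - (k * (+ 2 * g)) ≡ + 2 * (- k * g)
          e₂ = solve-∀

        x≡ : x ≡ l′ * (+ g * + M) - + c * (k′ * + g)
        x≡ = trans (e₀ x (+ c) y) (cong₂ (λ a b → a - + c * b) x+cy≡ y≡)
          where
          e₀ : ∀ x c y → x ≡ (x + c * y) - c * y
          e₀ = solve-∀
          e₁ : ∀ x c y → + 2 * (x + c * y) ≡ - ((- x - x) + c * (- y - y))
          e₁ = solve-∀
          e₂ : ∀ l g M → - (l * (+ 2 * g * M)) ≡ + 2 * (- l * (g * M))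
          e₂ = solve-∀
          x+cy≡ : x + + c * y ≡ l′ * (+ g * + M)
          x+cy≡ = ℤ.*-cancelˡ-≡ (+ 2) _ _ (trans (e₁ x (+ c) y) (trans (cong -_ eq) (trans (cong (λ G → - (l * (G * + M))) (+2* g)) (e₂ l (+ g) (+ M)))))

        nearby : ∀ i j → + 2 ∣ l′ - + i → + 2 ∣ k′ - + j → Ideal (2 ℕ.* g) M c (hp i j ⊕ (⊖ (x , y)))
        nearby i j (divides p l′-i≡) (divides q k′-j≡) =
          divides (- q) (trans (cong (λ z → + j * + g + - z) y≡) (trans (e₁ (+ j) (+ g) k′) (trans (cong (λ z → - z * + g) k′-j≡)
            (trans (e₂ q (+ g)) (cong (- q *_) (sym (+2* g))))))) &
          divides (- p) (trans (cong₂ (λ a b → + i * (+ g * + M) - + j * (+ g * + c) + - a + + c * (+ j * + g + - b)) x≡ y≡)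
            (trans (e₃ (+ i) (+ j) (+ g) (+ M) (+ c) l′ k′) (trans (cong (λ z → - z * (+ g * + M)) l′-i≡)
            (trans (e₄ p (+ g) (+ M)) (cong (λ G → - p * (G * + M)) (sym (+2* g)))))))
          where
          e₁ : ∀ j g k → j * g + - (k * g) ≡ - (k - j) * g
          e₁ = solve-∀
          e₂ : ∀ q g → - (q * + 2) * g ≡ - q * (+ 2 * g)
          e₂ = solve-∀
          e₃ : ∀ i j g M c l k → i * (g * M) - j * (g * c) + - (l * (g * M) - c * (k * g)) + c * (j * g + - (k * g)) ≡ - (l - i) * (g * M)
          e₃ = solve-∀
          e₄ : ∀ p g M → - (p * + 2) * (g * M) ≡ - p * (+ 2 * g * M)
          e₄ = solve-∀

    module _ {n} {s a : Fin n → Fin n} (C : Coordinates (2 ℕ.* g) M c s a) where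
      open Coordinates C

      private
        f : Fin n → Fin n
        f x = s (a x)

        distinct-k : ∀ {v w k l} → k ≢ l → dart (v , k) ≢ dart (w , l)
        distinct-k {v} {w} {k} {l} k≢l eq = k≢l (proj₁ (dart-injective (v , k) (w , l) eq))

        s-cube : ∀ d → iter s 3 d ≡ d
        s-cube = by-coords _ (λ p → trans (dart-act (true ∷ true ∷ true ∷ []) p) (cong dart (σ̂³ p)))

        s-nofix : ∀ d → s d ≢ d
        s-nofix = by-coords _ (λ p eq → distinct-k (next≢ (proj₂ p)) (trans (sym (dart-σ p)) eq))

        a-invol : ∀ d → a (a d) ≡ d
        a-invol = by-coords _ (λ p → trans (dart-act (false ∷ false ∷ []) p) (cong dart (α̂² p)))

        -- A dart fixed by α would put -(2v + 1) into the ideal, whose elements have even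
        -- coordinates.
        a-nofix : ∀ d → a d ≢ d
        a-nofix = by-coords _ λ { p@((x , y) , k) eq →
          odd x (proj₁ (Ideal-even (proj₂ (dart-injective (α̂ p) p (trans (sym (dart-α p)) eq))))) }
          where
          odd : ∀ x → ¬ (+ 2 ∣ - (x + 1ℤ) + - x)
          odd x 2∣ = contradiction (∣⇒∣ᵤ (∣-resp (e x) (∣m∣n⇒∣m+n 2∣ (∣m⇒∣m*n x ∣-refl)))) (ℕ.>⇒∤ (ℕ.s≤s (ℕ.s≤s ℕ.z≤n)))
            where
            e : ∀ x → - (x + 1ℤ) + - x + + 2 * x ≡ - 1ℤ
            e = solve-∀

        φ³-dart : ∀ v k → iter f 3 (dart (v , k)) ≡ dart (⊖ v , k)
        φ³-dart v k = trans (dart-φ^ 3 (v , k)) (cong dart (cong₂ _,_ (ρ³ v) (next³ k)))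

        f^6 : ∀ d → iter f 6 d ≡ d
        f^6 = by-coords _ λ { (v , k) → trans (cong (iter f 3) (φ³-dart v k)) (trans (φ³-dart (⊖ v) k) (cong (λ w → dart (w , k)) (⊖⊖ v))) }

        f-nofix : ∀ d → f d ≢ d
        f-nofix = by-coords _ (λ p eq → distinct-k (next≢ (proj₂ p)) (trans (sym (dart-φ p)) eq))

        f²-nofix : ∀ d → iter f 2 d ≢ d
        f²-nofix = by-coords _ (λ p eq → distinct-k (next²≢ (proj₂ p)) (trans (sym (dart-φ^ 2 p)) eq))

        s-faces : ∀ d → FaceOf3 f d ⊎ FaceOf6 f d
        s-faces d with iter f 3 d ≟ᶠ d
        ... | yes fix = inj₁ (fix , f-nofix d)
        ... | no ¬fix = inj₂ (f^6 d , f²-nofix d , ¬fix)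

        reach-φ^ : ∀ j d → Reach s a d (iter f j d)
        reach-φ^ zero    d = here
        reach-φ^ (suc j) d = viaσ (viaα (reach-φ^ j d))

        reach-translate : ∀ v w k → Reach s a (dart (v , k)) (dart (w , k))
        reach-translate v w k = subst (Reach s a (dart (v , k)))
          (trans (dart-act u (v , k)) (cong dart (trans (t v k) (cong (_, k) (e v w))))) (Reach-act u (dart (v , k)))
          where
          u = proj₁ (translation-word (w ⊕ (⊖ v)))
          t = proj₂ (translation-word (w ⊕ (⊖ v)))
          e₁ : ∀ x y → x + (y - x) ≡ y
          e₁ = solve-∀
          e : ∀ v w → v ⊕ (w ⊕ (⊖ v)) ≡ w
          e (x , y) (x′ , y′) = cong₂ _,_ (e₁ x x′) (e₁ y y′)

        φ̂^-k : ∀ j p → proj₂ (iter φ̂ j p) ≡ iter next j (proj₂ p)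
        φ̂^-k zero    p = refl
        φ̂^-k (suc j) p = cong next (φ̂^-k j p)

        -- A power of φ adjusts k, then a translation word adjusts v.
        s-connected : ∀ d e → Reach s a d e
        s-connected d e = by-coords (λ d → Reach s a d e) (λ p → by-coords (Reach s a (dart p)) (λ q → connect p q) e) d
          where
          connect : ∀ p q → Reach s a (dart p) (dart q)
          connect p (w , l) with next-transitive (proj₂ p) l
          ... | j , eq = Reach-trans (subst (Reach s a (dart p)) (trans (dart-φ^ j p) (cong (λ k → dart (v′ , k)) (trans (φ̂^-k j p) eq))) (reach-φ^ j (dart p)))
                           (reach-translate v′ w l)
            where v′ = proj₁ (iter φ̂ j p)

        triangle : Fin 3 × Fin 2 × Fin 2 → Fin n
        triangle (k , i , j) = dart (halfPeriod i j , k)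

        split : Fin 12 → Fin 3 × Fin 2 × Fin 2
        split t = proj₁ (remQuot {3} 4 t) , remQuot {2} 2 (proj₂ (remQuot {3} 4 t))

        join : Fin 3 × Fin 2 × Fin 2 → Fin 12
        join (k , i , j) = combine k (combine i j)

        join-split : ∀ t → join (split t) ≡ t
        join-split t = trans (cong (combine (proj₁ (remQuot {3} 4 t))) (combine-remQuot {2} 2 (proj₂ (remQuot {3} 4 t)))) (combine-remQuot {3} 4 t)

        split-join : ∀ p → split (join p) ≡ p
        split-join (k , i , j) = trans (cong (λ q → proj₁ q , remQuot {2} 2 (proj₂ q)) (remQuot-combine k (combine i j)))
                                   (cong (k ,_) (remQuot-combine i j))

        triangle-injective : ∀ p q → triangle p ≡ triangle q → p ≡ q
        triangle-injective (k , i , j) (k′ , i′ , j′) eq = cong₂ _,_ (proj₁ same) (cong₂ _,_ (proj₁ same′) (proj₂ same′))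
          where
          same  = dart-injective (halfPeriod i j , k) (halfPeriod i′ j′ , k′) eq
          same′ = halfPeriod-injective i j i′ j′ (proj₂ same)

        -- φ³ sends v to -v, so triangular means 2v in the doubled ideal, that is v in the ideal
        -- itself: four classes for each of three values of k.
        triangles≡12 : count (triangular? s-cube s-nofix a-invol a-nofix s-faces) ≡ 12
        triangles≡12 = count-injective-image _ (λ t → triangle (split t))
          (λ {t} {t′} eq → trans (sym (join-split t)) (trans (cong join (triangle-injective (split t) (split t′) eq)) (join-split t′)))
          (λ t → sound (split t)) (by-coords (λ d → iter f 3 d ≡ d → ∃ λ t → triangle (split t) ≡ d) complete)
          where
          sound : ∀ q → iter f 3 (triangle q) ≡ triangle q
          sound (k , i , j) = trans (φ³-dart (halfPeriod i j) k) (dart-cong _ _ k (double∈ i j))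
          complete : ∀ p → iter f 3 (dart p) ≡ dart p → ∃ λ t → triangle (split t) ≡ dart p
          complete (v , k) fix = locate (halfPeriod-complete v (proj₂ (dart-injective (⊖ v , k) (v , k) (trans (sym (φ³-dart v k)) fix))))
            where
            locate : (∃ λ i → ∃ λ j → Ideal (2 ℕ.* g) M c (halfPeriod i j ⊕ (⊖ v))) → _
            locate (i , j , d) = join (k , i , j) , trans (cong triangle (split-join (k , i , j))) (dart-cong _ v k d)

      trihex : Trihex n
      trihex = record
        { σ = s ; α = a ; σ-cube = s-cube ; σ-nofix = s-nofix ; α-invol = a-invol ; α-nofix = a-nofix
        ; connected = s-connected ; faces = s-faces
        ; planar = triangular≡12⇒planar s-cube s-nofix a-invol a-nofix s-faces triangles≡12 }

      private
        -- The symmetry of order 3. The maps `σ̂` and `α̂` treat v in the same way for every k, so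
        -- advancing k alone commutes with both.
        turn : Fin n → Fin n
        turn d = dart (proj₁ (coords d) , next (proj₂ (coords d)))

        turn-dart : ∀ v k → turn (dart (v , k)) ≡ dart (v , next k)
        turn-dart v k with coords (dart (v , k)) | dart-coords (dart (v , k))
        ... | w , l | eq with dart-injective (w , l) (v , k) eq
        ...   | refl , d = dart-cong w v (next l) d

        turn³ : ∀ d → iter turn 3 d ≡ d
        turn³ = by-coords _ λ { (v , k) → trans (cong (turn ∘ turn) (turn-dart v k)) (trans (cong turn (turn-dart v (next k)))
          (trans (turn-dart v (next (next k))) (cong (λ l → dart (v , l)) (next³ k)))) }

      threefold : HasThreefoldSymmetry trihex
      threefold = record
        { to = turn ; from = turn ∘ turn ; from-to = turn³ ; to-from = turn³
        ; pres-σ = by-coords (λ d → turn (s d) ≡ s (turn d)) λ { p@(v , k) → trans (cong turn (dart-σ p)) (trans (turn-dart _ (next k))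
                     (trans (sym (dart-σ (v , next k))) (cong s (sym (turn-dart v k))))) }
        ; pres-α = by-coords (λ d → turn (a d) ≡ a (turn d)) λ { p@(v , k) → trans (cong turn (dart-α p)) (trans (turn-dart _ k)
                     (trans (sym (dart-α (v , next k))) (cong a (sym (turn-dart v k))))) }
        } , turn³ , dart o , λ eq → distinct-k (next≢ fzero) (trans (sym (turn-dart (0ℤ , 0ℤ) fzero)) eq)
        where
        o : Dart
        o = (0ℤ , 0ℤ) , fzero

-- Existence of the trihex of every ideal.

module IdealTrihexes where

  open import Defs
  open EulerFormula
  open EisensteinIdeals
  open DartCoordinates
  open TrihexFromCoordinates
  open import Data.Nat as ℕ using (ℕ; NonZero)
  import Data.Nat.Properties as ℕ
  import Data.Nat.Tactic.RingSolver as ℕ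
  open import Data.Integer using (+_; _+_; _*_; -_; _-_; 0ℤ; 1ℤ)
  open import Data.Integer.Divisibility.Signed using (_∣_)
  open import Data.Integer.Tactic.RingSolver using (solve-∀)
  open import Data.Fin using (Fin; combine; remQuot)
  open import Data.Fin.Properties using (combine-injective; combine-remQuot)
  open import Data.Product using (∃; _×_; _,_; proj₁; proj₂)
  open import Relation.Binary.PropositionalEquality using (_≡_; refl; sym; trans; cong; cong₂; subst; module ≡-Reasoning)

  ω-⊖ : ∀ v w → ω· (v ⊕ 𝟙) ⊕ (⊖ ω· (w ⊕ 𝟙)) ≡ ω· (v ⊕ (⊖ w))
  ω-⊖ (x , y) (x′ , y′) = cong₂ _,_ (e₁ y y′) (e₂ x y x′ y′)
    where
    e₁ : ∀ y y′ → - (y + 0ℤ) + - - (y′ + 0ℤ) ≡ - (y + - y′)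
    e₁ = solve-∀
    e₂ : ∀ x y x′ y′ → (x + 1ℤ - (y + 0ℤ)) + - (x′ + 1ℤ - (y′ + 0ℤ)) ≡ (x + - x′) - (y + - y′)
    e₂ = solve-∀

  ⊖-⊖ : ∀ v w → (⊖ (v ⊕ 𝟙)) ⊕ (⊖ (⊖ (w ⊕ 𝟙))) ≡ ⊖ (v ⊕ (⊖ w))
  ⊖-⊖ (x , y) (x′ , y′) = cong₂ _,_ (e₁ x x′) (e₂ y y′)
    where
    e₁ : ∀ y y′ → - (y + 1ℤ) + - - (y′ + 1ℤ) ≡ - (y + - y′)
    e₁ = solve-∀
    e₂ : ∀ y y′ → - (y + 0ℤ) + - - (y′ + 0ℤ) ≡ - (y + - y′)
    e₂ = solve-∀

  module _ (G M c : ℕ) .{{_ : NonZero G}} .{{_ : NonZero M}} (M∣Fc : + M ∣ F (+ c)) where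

    size : ℕ
    size = 3 ℕ.* (G ℕ.* (G ℕ.* M))

    private
      index : Fin 3 → Fin G × Fin (G ℕ.* M) → Fin size
      index k r = combine k (combine (proj₁ r) (proj₂ r))

      toDart : Dart → Fin size
      toDart (v , k) = index k (reduce {G} {M} {c} v)

      fromDart : Fin size → Dart
      fromDart d = representative {G} {M} {c} (remQuot {G} (G ℕ.* M) (proj₂ kr)) , proj₁ kr
        where kr = remQuot {3} (G ℕ.* (G ℕ.* M)) d

      to-from : ∀ d → toDart (fromDart d) ≡ d
      to-from d = trans (cong (index (proj₁ kr)) (reduce-representative {G} {M} {c} (remQuot {G} (G ℕ.* M) (proj₂ kr))))
        (trans (cong (combine (proj₁ kr)) (combine-remQuot {G} (G ℕ.* M) (proj₂ kr))) (combine-remQuot {3} (G ℕ.* (G ℕ.* M)) d))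
        where kr = remQuot {3} (G ℕ.* (G ℕ.* M)) d

      to-cong : ∀ v w k → Ideal G M c (v ⊕ (⊖ w)) → toDart (v , k) ≡ toDart (w , k)
      to-cong v w k d = cong (index k) (reduce-cong {v = v} {w} d)

      to-injective : ∀ p q → toDart p ≡ toDart q → (proj₂ p ≡ proj₂ q) × Ideal G M c (proj₁ p ⊕ (⊖ proj₁ q))
      to-injective (v , k) (w , l) eq = proj₁ outer , reduce-injective {v = v} {w} (cong₂ _,_ (proj₁ inner) (proj₂ inner))
        where
        r = reduce {G} {M} {c} v
        r′ = reduce {G} {M} {c} w
        outer = combine-injective k (combine (proj₁ r) (proj₂ r)) l (combine (proj₁ r′) (proj₂ r′)) eq
        inner = combine-injective (proj₁ r) (proj₂ r) (proj₁ r′) (proj₂ r′) (proj₂ outer)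

      s : Fin size → Fin size
      s d = toDart (σ̂ (fromDart d))

      a : Fin size → Fin size
      a d = toDart (α̂ (fromDart d))

      same : ∀ p → (proj₂ (fromDart (toDart p)) ≡ proj₂ p) × Ideal G M c (proj₁ (fromDart (toDart p)) ⊕ (⊖ proj₁ p))
      same p = to-injective (fromDart (toDart p)) p (to-from (toDart p))

      coordinates : Coordinates G M c s a
      coordinates = record
        { dart = toDart ; coords = fromDart ; dart-coords = to-from ; dart-cong = to-cong ; dart-injective = to-injective
        ; dart-σ = λ p → move p (fromDart (toDart p)) (same p)
        ; dart-α = λ p → move′ p (fromDart (toDart p)) (same p) }
        where
        -- `fromDart (toDart p)` is only congruent to p. Under v ↦ ω (v + 1) differences are
        -- multiplied by ω, which preserves the ideal because c is a root of `F` modulo M.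
        move : ∀ p q → (proj₂ q ≡ proj₂ p) × Ideal G M c (proj₁ q ⊕ (⊖ proj₁ p)) → toDart (σ̂ q) ≡ toDart (σ̂ p)
        move (v , k) (w , .k) (refl , d) = to-cong (ω· (w ⊕ 𝟙)) (ω· (v ⊕ 𝟙)) (next k) (subst (Ideal G M c) (sym (ω-⊖ w v)) (Ideal-ω M∣Fc {w ⊕ (⊖ v)} d))
        move′ : ∀ p q → (proj₂ q ≡ proj₂ p) × Ideal G M c (proj₁ q ⊕ (⊖ proj₁ p)) → toDart (α̂ q) ≡ toDart (α̂ p)
        move′ (v , k) (w , .k) (refl , d) = to-cong (⊖ (w ⊕ 𝟙)) (⊖ (v ⊕ 𝟙)) k (subst (Ideal G M c) (sym (⊖-⊖ w v)) (Ideal-⊖ {v = w ⊕ (⊖ v)} d))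

    abstract
      standardCoordinates : ∃ λ s → ∃ λ a → Coordinates G M c {size} s a
      standardCoordinates = s , a , coordinates

  3*numVertices : ∀ {n} (T : Trihex n) → 3 ℕ.* numVertices T ≡ n
  3*numVertices T = 3*vertices (σ-cube T) (σ-nofix T) (α-invol T) (α-nofix T) (faces T)

  -- The doubled ideal has index 4 g² M, so there are 3 · 4 g² M darts, three at each vertex.
  record IdealTrihex (g M c : ℕ) : Set where
    field
      {n}         : ℕ
      T           : Trihex n
      vertices    : numVertices T ≡ 4 ℕ.* (g ℕ.* g ℕ.* M)
      symmetric   : HasThreefoldSymmetry T
      coordinates : Coordinates (2 ℕ.* g) M c (σ T) (α T)

  module _ {g M c : ℕ} .{{_ : NonZero g}} .{{_ : NonZero M}} where

    private
      fromCoordinates : ∀ {n} {s a : Fin n → Fin n} → Coordinates (2 ℕ.* g) M c s a → n ≡ 3 ℕ.* (4 ℕ.* (g ℕ.* g ℕ.* M)) →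
        IdealTrihex g M c
      fromCoordinates C n≡ = record
        { T = trihex {g} {M} {c} C
        ; vertices = ℕ.*-cancelˡ-≡ _ _ 3 (trans (3*numVertices (trihex {g} {M} {c} C)) n≡)
        ; symmetric = threefold {g} {M} {c} C
        ; coordinates = C }

      size≡ : ∀ g M → 3 ℕ.* (2 ℕ.* g ℕ.* (2 ℕ.* g ℕ.* M)) ≡ 3 ℕ.* (4 ℕ.* (g ℕ.* g ℕ.* M))
      size≡ = ℕ.solve-∀

    abstract
      idealTrihex : + M ∣ F (+ c) → IdealTrihex g M c
      idealTrihex M∣Fc = fromCoordinates (proj₂ (proj₂ (standardCoordinates (2 ℕ.* g) M c {{ℕ.m*n≢0 2 g}} M∣Fc))) (size≡ g M)

-- The translation action of ℤ[ω] on the darts of an arbitrary trihex.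

module TranslationAction where

  open EisensteinIdeals
  open DartCoordinates using (ρ; 𝟙; ρ-⊕)
  open HermiteNormalForm using (subgroup-scale)
  open import Data.Nat using (zero; suc)
  open import Data.Integer using (ℤ; +_; -[1+_]; _+_; _*_; -_; _-_; 0ℤ; 1ℤ; -1ℤ)
  open import Data.Integer.Tactic.RingSolver using (solve-∀)
  open import Data.Product using (_,_)
  open import Relation.Binary.PropositionalEquality using (_≡_; refl; sym; trans; cong; cong₂; subst; module ≡-Reasoning)
  open import Defs using (iter)

  ℤ-induction : (P : ℤ → Set) → P 0ℤ → (∀ x → P x → P (1ℤ + x)) → (∀ x → P x → P (-1ℤ + x)) → ∀ x → P x
  ℤ-induction P z s p (+ zero)       = z
  ℤ-induction P z s p (+ suc n)      = s (+ n) (ℤ-induction P z s p (+ n))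
  ℤ-induction P z s p -[1+ zero ]    = p 0ℤ z
  ℤ-induction P z s p -[1+ suc n ]   = p -[1+ n ] (ℤ-induction P z s p -[1+ n ])

  record Bijection (D : Set) : Set where
    field
      to from : D → D
      to-from : ∀ d → to (from d) ≡ d
      from-to : ∀ d → from (to d) ≡ d

  open Bijection

  module _ {D : Set} where

    pow : Bijection D → ℤ → D → D
    pow f (+ n)    = iter (to f) n
    pow f -[1+ n ] = iter (from f) (suc n)

    module _ (f : Bijection D) where

      pow-suc : ∀ x d → pow f (1ℤ + x) d ≡ to f (pow f x d)
      pow-suc (+ n)          d = refl
      pow-suc -[1+ zero ]    d = sym (to-from f d)
      pow-suc -[1+ suc n ]   d = sym (to-from f _)

      pow-pred : ∀ x d → pow f (-1ℤ + x) d ≡ from f (pow f x d)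
      pow-pred x d = trans (sym (from-to f _)) (cong (from f) (trans (sym (pow-suc (-1ℤ + x) d)) (cong (λ z → pow f z d) (e x))))
        where
        e : ∀ x → 1ℤ + (-1ℤ + x) ≡ x
        e = solve-∀

      pow-+ : ∀ x y d → pow f (x + y) d ≡ pow f x (pow f y d)
      pow-+ x y d = ℤ-induction (λ x → pow f (x + y) d ≡ pow f x (pow f y d)) base step back x
        where
        e₀ : ∀ y → 0ℤ + y ≡ y
        e₀ = solve-∀
        assoc : ∀ a x y → a + x + y ≡ a + (x + y)
        assoc = solve-∀
        base : pow f (0ℤ + y) d ≡ pow f y d
        base = cong (λ z → pow f z d) (e₀ y)
        step : ∀ x → pow f (x + y) d ≡ pow f x (pow f y d) → pow f (1ℤ + x + y) d ≡ pow f (1ℤ + x) (pow f y d)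
        step x ih = trans (cong (λ z → pow f z d) (assoc 1ℤ x y)) (trans (pow-suc (x + y) d) (trans (cong (to f) ih) (sym (pow-suc x _))))
        back : ∀ x → pow f (x + y) d ≡ pow f x (pow f y d) → pow f (-1ℤ + x + y) d ≡ pow f (-1ℤ + x) (pow f y d)
        back x ih = trans (cong (λ z → pow f z d) (assoc -1ℤ x y)) (trans (pow-pred (x + y) d) (trans (cong (from f) ih) (sym (pow-pred x _))))

      pow-natural : (h : D → D) → (∀ d → h (to f d) ≡ to f (h d)) → ∀ x d → h (pow f x d) ≡ pow f x (h d)
      pow-natural h comm x d = ℤ-induction (λ x → h (pow f x d) ≡ pow f x (h d)) refl
        (λ x ih → trans (cong h (pow-suc x d)) (trans (comm _) (trans (cong (to f) ih) (sym (pow-suc x (h d))))))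
        (λ x ih → trans (cong h (pow-pred x d)) (trans (comm′ _) (trans (cong (from f) ih) (sym (pow-pred x (h d)))))) x
        where
        comm′ : ∀ d → h (from f d) ≡ from f (h d)
        comm′ d = trans (sym (from-to f _)) (cong (from f) (trans (sym (comm _)) (cong h (to-from f d))))

  -- `T-natural` records that translations are words in φ and α and their inverses: whatever
  -- commutes with φ and α commutes with all of them, automorphisms in particular.
  record Translations {D : Set} (φ a : D → D) : Set where
    field
      T         : Eis → D → D
      T-0       : ∀ d → T (0ℤ , 0ℤ) d ≡ d
      T-⊕       : ∀ v w d → T (v ⊕ w) d ≡ T v (T w d)
      T-𝟙       : ∀ d → T 𝟙 d ≡ φ (φ (φ (a d)))
      φ-T       : ∀ v d → φ (T v d) ≡ T (ρ v) (φ d)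
      T-natural : (h : D → D) → (∀ d → h (φ d) ≡ φ (h d)) → (∀ d → h (a d) ≡ a (h d)) → ∀ v d → h (T v d) ≡ T v (h d)

  -- In the tiling, X = φ³α and Y = φαφ² translate a dart by 1 and by ω in its own frame. The relation (φα)³ = 1,
  -- read as φαφαφ = α, says that they commute and how φ conjugates them.
  module _ {D : Set} (φ a : D → D)
    (φ⁶ : ∀ d → φ (φ (φ (φ (φ (φ d))))) ≡ d) (a² : ∀ d → a (a d) ≡ d) (φa³ : ∀ d → φ (a (φ (a (φ (a d))))) ≡ d) where

    private
      relation : ∀ d → φ (a (φ (a (φ d)))) ≡ a d
      relation d = trans (cong (λ e → φ (a (φ (a (φ e))))) (sym (a² d))) (φa³ (a d))

      φ² φ³ φ⁴ φ⁵ : D → D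
      φ² d = φ (φ d)
      φ³ d = φ (φ² d)
      φ⁴ d = φ (φ³ d)
      φ⁵ d = φ (φ⁴ d)

      X : Bijection D
      X = record
        { to = λ d → φ³ (a d) ; from = λ d → a (φ³ d)
        ; to-from = λ d → trans (cong φ³ (a² _)) (φ⁶ d)
        ; from-to = λ d → trans (cong a (φ⁶ _)) (a² d) }

      Y : Bijection D
      Y = record
        { to = λ d → φ (a (φ² d)) ; from = λ d → φ⁴ (a (φ⁵ d))
        ; to-from = λ d → trans (cong (λ e → φ (a e)) (φ⁶ _)) (trans (cong φ (a² _)) (φ⁶ d))
        ; from-to = λ d → trans (cong (λ e → φ⁴ (a e)) (φ⁶ _)) (trans (cong φ⁴ (a² _)) (φ⁶ d)) }

      XY : ∀ d → to X (to Y d) ≡ φ² (a (φ d))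
      XY d = cong φ² (relation (φ d))

      YX : ∀ d → to Y (to X d) ≡ φ² (a (φ d))
      YX d = cong φ (trans (sym (relation (φ⁵ (a d)))) (trans (cong (λ e → φ (a (φ (a e)))) (φ⁶ (a d))) (cong (λ e → φ (a (φ e))) (a² d))))

      shift : Eis → D → D
      shift (x , y) d = pow X x (pow Y y d)

      Y-commutes-X^ : ∀ x d → to Y (pow X x d) ≡ pow X x (to Y d)
      Y-commutes-X^ = pow-natural X (to Y) (λ d → trans (YX d) (sym (XY d)))

      commute : ∀ x y d → pow Y y (pow X x d) ≡ pow X x (pow Y y d)
      commute x y d = sym (pow-natural Y (pow X x) (λ e → sym (Y-commutes-X^ x e)) y d)

      shift-⊕ : ∀ v w d → shift (v ⊕ w) d ≡ shift v (shift w d)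
      shift-⊕ (x , y) (x′ , y′) d = begin
        pow X (x + x′) (pow Y (y + y′) d)              ≡⟨ pow-+ X x x′ _ ⟩
        pow X x (pow X x′ (pow Y (y + y′) d))          ≡⟨ cong (λ e → pow X x (pow X x′ e)) (pow-+ Y y y′ d) ⟩
        pow X x (pow X x′ (pow Y y (pow Y y′ d)))      ≡⟨ cong (pow X x) (commute x′ y _) ⟨
        pow X x (pow Y y (pow X x′ (pow Y y′ d))) ∎
        where open ≡-Reasoning

      record Conjugates (v : Eis) : Set where
        constructor conjugates
        field run : ∀ d → φ (shift v d) ≡ shift (ρ v) (φ d)
      open Conjugates

      conjugates-⊕ : ∀ {v w} → Conjugates v → Conjugates w → Conjugates (v ⊕ w)
      conjugates-⊕ {v} {w} p q = conjugates λ d → begin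
        φ (shift (v ⊕ w) d)              ≡⟨ cong φ (shift-⊕ v w d) ⟩
        φ (shift v (shift w d))          ≡⟨ run p _ ⟩
        shift (ρ v) (φ (shift w d))      ≡⟨ cong (shift (ρ v)) (run q d) ⟩
        shift (ρ v) (shift (ρ w) (φ d))  ≡⟨ shift-⊕ (ρ v) (ρ w) _ ⟨
        shift (ρ v ⊕ ρ w) (φ d)          ≡⟨ cong (λ u → shift u (φ d)) (ρ-⊕ v w) ⟨
        shift (ρ (v ⊕ w)) (φ d) ∎
        where open ≡-Reasoning

      inverse : ∀ v → v ⊕ (⊖ v) ≡ (0ℤ , 0ℤ)
      inverse (x , y) = cong₂ _,_ (e x) (e y)
        where
        e : ∀ x → x - x ≡ 0ℤ
        e = solve-∀

      ρ-inverse : ∀ v → ρ (⊖ v) ⊕ ρ v ≡ (0ℤ , 0ℤ)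
      ρ-inverse (x , y) = cong₂ _,_ (e₁ y) (e₂ x y)
        where
        e₁ : ∀ y → - y + y ≡ 0ℤ
        e₁ = solve-∀
        e₂ : ∀ x y → (- y - - x) + (y - x) ≡ 0ℤ
        e₂ = solve-∀

      conjugates-⊖ : ∀ {v} → Conjugates v → Conjugates (⊖ v)
      conjugates-⊖ {v} p = conjugates λ d → begin
        φ (shift (⊖ v) d)                                      ≡⟨ cong (λ u → shift u (φ (shift (⊖ v) d))) (ρ-inverse v) ⟨
        shift (ρ (⊖ v) ⊕ ρ v) (φ (shift (⊖ v) d))              ≡⟨ shift-⊕ (ρ (⊖ v)) (ρ v) _ ⟩
        shift (ρ (⊖ v)) (shift (ρ v) (φ (shift (⊖ v) d)))      ≡⟨ cong (shift (ρ (⊖ v))) (run p _) ⟨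
        shift (ρ (⊖ v)) (φ (shift v (shift (⊖ v) d)))          ≡⟨ cong (λ e → shift (ρ (⊖ v)) (φ e)) (shift-⊕ v (⊖ v) d) ⟨
        shift (ρ (⊖ v)) (φ (shift (v ⊕ (⊖ v)) d))              ≡⟨ cong (λ u → shift (ρ (⊖ v)) (φ (shift u d))) (inverse v) ⟩
        shift (ρ (⊖ v)) (φ d) ∎
        where open ≡-Reasoning

      -- It suffices to treat 1 and ω: φ X = Y⁻¹ φ because ρ 1 = -ω, and φ Y = X Y φ because ρ ω = 1
      -- + ω.
      all-conjugate : ∀ v → Conjugates v
      all-conjugate (x , y) = subst Conjugates (cong₂ _,_ (e₁ x) (e₂ y)) (conjugates-⊕
        (subgroup-scale (λ x → Conjugates (x , 0ℤ)) conjugates-⊕ conjugates-⊖ x (conjugates λ d → sym (cong φ⁴ (cong a (φ⁶ d)))))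
        (subgroup-scale (λ y → Conjugates (0ℤ , y)) conjugates-⊕ conjugates-⊖ y (conjugates λ d → sym (XY (φ d)))))
        where
        e₁ : ∀ x → x * 1ℤ + 0ℤ ≡ x
        e₁ = solve-∀
        e₂ : ∀ y → 0ℤ + y * 1ℤ ≡ y
        e₂ = solve-∀

    abstract
      translations : Translations φ a
      translations = record
        { T = shift ; T-0 = λ _ → refl ; T-⊕ = shift-⊕ ; T-𝟙 = λ _ → refl ; φ-T = λ v → run (all-conjugate v)
        ; T-natural = λ { h hφ ha (x , y) d →
            let hφ² = λ e → trans (hφ (φ e)) (cong φ (hφ e))
                hφ³ = λ e → trans (hφ (φ (φ e))) (cong φ (hφ² e)) in
            trans (pow-natural X h (λ e → trans (hφ³ (a e)) (cong φ³ (ha e))) x (pow Y y d))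
              (cong (pow X x) (pow-natural Y h (λ e → trans (hφ (a (φ² e))) (cong φ (trans (ha (φ² e)) (cong a (hφ² e))))) y d)) } }

-- Every trihex with threefold symmetry comes from an ideal.

module SymmetricTrihexes where

  open import Defs
  open OrbitCounting
  open EulerFormula
  open EisensteinIdeals
  open HermiteNormalForm
  open DartCoordinates
  open TranslationAction
  open import Data.Nat as ℕ using (ℕ; suc; NonZero; s≤s)
  import Data.Nat.Properties as ℕ
  import Data.Nat.Divisibility as ℕ
  open import Data.Integer using (+_; _+_; _*_; -_; _-_; 0ℤ; 1ℤ)
  open import Data.Integer.DivMod using (_%ℕ_; _/ℕ_; n%ℕd<d; a≡a%ℕn+[a/ℕn]*n)
  open import Data.Integer.Divisibility.Signed using (_∣_; divides; ∣⇒∣ᵤ)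
  open import Data.Integer.Tactic.RingSolver using (solve-∀)
  open import Data.Fin using (Fin; toℕ) renaming (zero to fzero; suc to fsuc)
  open import Data.Fin.Properties using (any?; pigeonhole) renaming (_≟_ to _≟ᶠ_)
  open import Data.Product using (∃; _×_; _,_; proj₁; proj₂)
  open import Data.Sum using (inj₁; inj₂)
  open import Data.Empty using (⊥)
  open import Function using (_∘_)
  open import Relation.Nullary using (¬_; Dec; yes; no; contradiction)
  open import Relation.Binary.PropositionalEquality using (_≡_; _≢_; refl; sym; trans; cong; cong₂; subst; module ≡-Reasoning)

  private
    ⊕-comm : ∀ v w → v ⊕ w ≡ w ⊕ v
    ⊕-comm (x , y) (x′ , y′) = cong₂ _,_ (e x x′) (e y y′)
      where
      e : ∀ x y → x + y ≡ y + x
      e = solve-∀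

    ⊖-inverse : ∀ v → (⊖ v) ⊕ v ≡ (0ℤ , 0ℤ)
    ⊖-inverse (x , y) = cong₂ _,_ (e x) (e y)
      where
      e : ∀ x → - x + x ≡ 0ℤ
      e = solve-∀

    ρρ⁻¹ : ∀ v → ρ (ρ⁻¹ v) ≡ v
    ρρ⁻¹ (x , y) = cong (x ,_) (e x y)
      where
      e : ∀ x y → x - (x - y) ≡ y
      e = solve-∀

    ρ⁻²≡ω : ∀ v → ρ⁻¹ (ρ⁻¹ v) ≡ ω· v
    ρ⁻²≡ω (x , y) = cong (_, x - y) (e x y)
      where
      e : ∀ x y → (x - y) - x ≡ - y
      e = solve-∀

    ⊖ω≡ρ : ∀ v → ⊖ (ω· v) ≡ ρ v
    ⊖ω≡ρ (x , y) = cong₂ _,_ (e₁ y) (e₂ x y)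
      where
      e₁ : ∀ y → - - y ≡ y
      e₁ = solve-∀
      e₂ : ∀ x y → - (x - y) ≡ y - x
      e₂ = solve-∀

    ⊖ω²≡ρ⁻¹ : ∀ v → ⊖ (ω· (ω· v)) ≡ ρ⁻¹ v
    ⊖ω²≡ρ⁻¹ (x , y) = cong₂ _,_ (e₁ x y) (e₂ x y)
      where
      e₁ : ∀ x y → - - (x - y) ≡ x - y
      e₁ = solve-∀
      e₂ : ∀ x y → - (- y - (x - y)) ≡ x
      e₂ = solve-∀

  module Classification {n} (𝕋 : Trihex n) (d₀ : Fin n) (φ³d₀ : iter (φ 𝕋) 3 d₀ ≡ d₀) (sym𝕋 : HasThreefoldSymmetry 𝕋) where

    private
      s = σ 𝕋
      a = α 𝕋

    module Action (f : Fin n → Fin n) (f≡ : ∀ d → f d ≡ s (a d)) (f⁶ : ∀ d → f (f (f (f (f (f d))))) ≡ d)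
      (f³d₀ : f (f (f d₀)) ≡ d₀) (f²-nofix : ∀ d → f (f d) ≢ d) (tr : Translations f a) where
      open Translations tr

      s≡ : ∀ d → s d ≡ f (a d)
      s≡ d = sym (trans (f≡ (a d)) (cong s (α-invol 𝕋 d)))

      f-injective : ∀ {d e} → f d ≡ f e → d ≡ e
      f-injective {d} {e} eq = trans (sym (f⁶ d)) (trans (cong (λ z → f (f (f (f (f z))))) eq) (f⁶ e))

      T-inverse : ∀ v {d e} → T v d ≡ e → T (⊖ v) e ≡ d
      T-inverse v {d} {e} eq = trans (cong (T (⊖ v)) (sym eq)) (trans (sym (T-⊕ (⊖ v) v d)) (trans (cong (λ u → T u d) (⊖-inverse v)) (T-0 d)))

      T-injective : ∀ v {d e} → T v d ≡ T v e → d ≡ e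
      T-injective v {d} {e} eq = trans (sym (T-inverse v eq)) (T-inverse v refl)

      T-comm : ∀ v w d → T v (T w d) ≡ T w (T v d)
      T-comm v w d = trans (sym (T-⊕ v w d)) (trans (cong (λ u → T u d) (⊕-comm v w)) (T-⊕ w v d))

      f³-T : ∀ v d → f (f (f (T v d))) ≡ T (⊖ v) (f (f (f d)))
      f³-T v d = begin
        f (f (f (T v d)))                ≡⟨ cong (f ∘ f) (φ-T v d) ⟩
        f (f (T (ρ v) (f d)))            ≡⟨ cong f (φ-T (ρ v) (f d)) ⟩
        f (T (ρ (ρ v)) (f (f d)))        ≡⟨ φ-T (ρ (ρ v)) (f (f d)) ⟩
        T (ρ (ρ (ρ v))) (f (f (f d)))    ≡⟨ cong (λ u → T u (f (f (f d)))) (ρ³ v) ⟩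
        T (⊖ v) (f (f (f d))) ∎
        where open ≡-Reasoning

      a≡ : ∀ d → a d ≡ f (f (f (T 𝟙 d)))
      a≡ d = sym (trans (cong (f ∘ f ∘ f) (T-𝟙 d)) (f⁶ (a d)))

      -- As φ⁶ = 1, α is φ³ after the translation by 1, and φ³ reverses translations.
      a-T : ∀ v d → a (T v d) ≡ T (⊖ (v ⊕ 𝟙)) (f (f (f d)))
      a-T v d = trans (a≡ _) (trans (cong (f ∘ f ∘ f) (trans (sym (T-⊕ 𝟙 v d)) (cong (λ u → T u d) (⊕-comm 𝟙 v)))) (f³-T (v ⊕ 𝟙) d))

      rot : Fin 3 → Fin n
      rot fzero               = d₀
      rot (fsuc fzero)        = f d₀
      rot (fsuc (fsuc fzero)) = f (f d₀)

      f-rot : ∀ k → f (rot k) ≡ rot (next k)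
      f-rot fzero               = refl
      f-rot (fsuc fzero)        = refl
      f-rot (fsuc (fsuc fzero)) = f³d₀

      f³-rot : ∀ k → f (f (f (rot k))) ≡ rot k
      f³-rot k = trans (cong (f ∘ f) (f-rot k)) (trans (cong f (f-rot (next k))) (trans (f-rot (next (next k))) (cong rot (next³ k))))

      toDart : Dart → Fin n
      toDart (v , k) = T v (rot k)

      toDart-φ : ∀ p → f (toDart p) ≡ toDart (φ̂ p)
      toDart-φ (v , k) = trans (φ-T v (rot k)) (cong (T (ρ v)) (f-rot k))

      toDart-α : ∀ p → a (toDart p) ≡ toDart (α̂ p)
      toDart-α (v , k) = trans (a-T v (rot k)) (cong (T (⊖ (v ⊕ 𝟙))) (f³-rot k))

      toDart-σ : ∀ p → s (toDart p) ≡ toDart (σ̂ p)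
      toDart-σ p = trans (s≡ _) (trans (cong f (toDart-α p)) (trans (toDart-φ (α̂ p)) (cong toDart (trans (sym (σ̂α̂ (α̂ p))) (cong σ̂ (α̂² p))))))

      o : Dart
      o = (0ℤ , 0ℤ) , fzero

      -- The darts having coordinates contain d₀ and are closed under σ and α.
      surjective : ∀ {e} → Reach s a d₀ e → ∃ λ p → toDart p ≡ e
      surjective here     = o , T-0 d₀
      surjective (viaσ r) = σ̂ (proj₁ ih) , trans (sym (toDart-σ (proj₁ ih))) (cong s (proj₂ ih))
        where ih = surjective r
      surjective (viaα r) = α̂ (proj₁ ih) , trans (sym (toDart-α (proj₁ ih))) (cong a (proj₂ ih))
        where ih = surjective r

      locate : ∀ e → ∃ λ p → toDart p ≡ e
      locate e = surjective (connected 𝕋 d₀ e)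

      record Λ (v : Eis) : Set where
        constructor fixes
        field fixed : T v d₀ ≡ d₀
      open Λ

      Λ? : ∀ v → Dec (Λ v)
      Λ? v with T v d₀ ≟ᶠ d₀
      ... | yes eq = yes (fixes eq)
      ... | no neq = no (neq ∘ fixed)

      Λ-⊕ : ∀ {v w} → Λ v → Λ w → Λ (v ⊕ w)
      Λ-⊕ {v} {w} (fixes p) (fixes q) = fixes (trans (T-⊕ v w d₀) (trans (cong (T v) q) p))

      Λ-⊖ : ∀ {v} → Λ v → Λ (⊖ v)
      Λ-⊖ {v} (fixes p) = fixes (T-inverse v p)

      stab-f : ∀ v d → T v (f d) ≡ f d → T (ρ⁻¹ v) d ≡ d
      stab-f v d eq = f-injective (trans (φ-T (ρ⁻¹ v) d) (trans (cong (λ u → T u (f d)) (ρρ⁻¹ v)) eq))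

      τ : Fin n → Fin n
      τ = Iso.to (proj₁ sym𝕋)

      τ-a : ∀ d → τ (a d) ≡ a (τ d)
      τ-a = Iso.pres-α (proj₁ sym𝕋)

      τ-f : ∀ d → τ (f d) ≡ f (τ d)
      τ-f d = trans (cong τ (f≡ d)) (trans (Iso.pres-σ (proj₁ sym𝕋) (a d)) (trans (cong s (τ-a d)) (sym (f≡ (τ d)))))

      τ-T : ∀ v d → τ (T v d) ≡ T v (τ d)
      τ-T = T-natural τ τ-f τ-a

      -- An automorphism fixing d₀ commutes with φ and with translations, hence fixes every dart;
      -- but τ is not the identity.
      τ-moves-d₀ : τ d₀ ≢ d₀
      τ-moves-d₀ τd₀ = proj₂ (proj₂ (proj₂ sym𝕋)) (trans (cong τ (sym eq)) (trans (τ-fixes (proj₁ at)) eq))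
        where
        at = locate (proj₁ (proj₂ (proj₂ sym𝕋)))
        eq = proj₂ at
        τ-rot : ∀ k → τ (rot k) ≡ rot k
        τ-rot fzero               = τd₀
        τ-rot (fsuc fzero)        = trans (τ-f d₀) (cong f τd₀)
        τ-rot (fsuc (fsuc fzero)) = trans (τ-f (f d₀)) (cong f (trans (τ-f d₀) (cong f τd₀)))
        τ-fixes : ∀ p → τ (toDart p) ≡ toDart p
        τ-fixes (v , k) = trans (τ-T v (rot k)) (cong (T v) (τ-rot k))

      -- A symmetry that translates the base dart by w commutes with the half turn, so 2w ∈ Λ; hence τ² fixes d₀, and so does τ = τ³.
      τ-not-translation : ∀ w → τ d₀ ≢ T w d₀
      τ-not-translation w eq = τ-moves-d₀ (trans (cong τ (sym τ²d₀)) (proj₁ (proj₂ sym𝕋) d₀))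
        where
        flip : T (⊖ w) d₀ ≡ T w d₀
        flip = begin
          T (⊖ w) d₀               ≡⟨ cong (T (⊖ w)) f³d₀ ⟨
          T (⊖ w) (f (f (f d₀)))   ≡⟨ f³-T w d₀ ⟨
          f (f (f (T w d₀)))       ≡⟨ cong (f ∘ f ∘ f) eq ⟨
          f (f (f (τ d₀)))         ≡⟨ cong (f ∘ f) (τ-f d₀) ⟨
          f (f (τ (f d₀)))         ≡⟨ cong f (τ-f (f d₀)) ⟨
          f (τ (f (f d₀)))         ≡⟨ τ-f (f (f d₀)) ⟨
          τ (f (f (f d₀)))         ≡⟨ cong τ f³d₀ ⟩
          τ d₀                     ≡⟨ eq ⟩
          T w d₀ ∎
          where open ≡-Reasoning
        τ²d₀ : τ (τ d₀) ≡ d₀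
        τ²d₀ = trans (cong τ eq) (trans (τ-T w d₀) (trans (cong (T w) (trans eq (sym flip)))
                 (trans (sym (T-⊕ w (⊖ w) d₀)) (trans (cong (λ u → T u d₀) (trans (⊕-comm w (⊖ w)) (⊖-inverse w))) (T-0 d₀)))))

      -- τ d₀ is a translate of φ d₀ or φ² d₀. Its stabilizer contains Λ, since τ commutes with
      -- translations, and equals that of the untranslated dart, since translations commute. Pulling
      -- back through φ applies ρ⁻¹ to stabilizers, and ρ⁻² = ω.
      Λ-ω : ∀ {v} → Λ v → Λ (ω· v)
      Λ-ω {v} Λv = go (proj₁ at) (proj₂ at) Λv
        where
        at = locate (τ d₀)
        stab-rot : ∀ w k → T w (rot k) ≡ τ d₀ → ∀ {v} → Λ v → T v (rot k) ≡ rot k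
        stab-rot w k eq {v} (fixes p) = T-injective w (trans (T-comm w v (rot k)) (trans (cong (T v) eq)
          (trans (sym (τ-T v d₀)) (trans (cong τ p) (sym eq)))))
        go : ∀ p → toDart p ≡ τ d₀ → ∀ {v} → Λ v → Λ (ω· v)
        go (w , fzero) eq Λv = contradiction (sym eq) (τ-not-translation w)
        go (w , fsuc fzero) eq {v} Λv = subst Λ (ρ⁻²≡ω v) (Λ-ρ⁻¹ (Λ-ρ⁻¹ Λv))
          where
          Λ-ρ⁻¹ : ∀ {v} → Λ v → Λ (ρ⁻¹ v)
          Λ-ρ⁻¹ {v} Λv = fixes (stab-f v d₀ (stab-rot w (fsuc fzero) eq Λv))
        go (w , fsuc (fsuc fzero)) eq {v} Λv =
          subst Λ (ρ⁻²≡ω v) (fixes (stab-f (ρ⁻¹ v) d₀ (stab-f v (f d₀) (stab-rot w (fsuc (fsuc fzero)) eq Λv))))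

      Λ-ρ : ∀ {v} → Λ v → Λ (ρ v)
      Λ-ρ {v} Λv = subst Λ (⊖ω≡ρ v) (Λ-⊖ {ω· v} (Λ-ω Λv))

      -- Together with `stab-Λ`: φ changes stabilizers by ρ, under which Λ is now invariant, so the
      -- three rotated base darts share the stabilizer Λ.
      Λ-stab : ∀ k {v} → T v (rot k) ≡ rot k → Λ v
      Λ-stab fzero eq = fixes eq
      Λ-stab (fsuc fzero) {v} eq = subst Λ (ρρ⁻¹ v) (Λ-ρ (fixes (stab-f v d₀ eq)))
      Λ-stab (fsuc (fsuc fzero)) {v} eq = subst Λ (trans (cong ρ (ρρ⁻¹ (ρ⁻¹ v))) (ρρ⁻¹ v))
        (Λ-ρ {ρ (ρ⁻¹ (ρ⁻¹ v))} (Λ-ρ {ρ⁻¹ (ρ⁻¹ v)} (fixes (stab-f (ρ⁻¹ v) d₀ (stab-f v (f d₀) eq)))))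

      Λ-ρ⁻¹ : ∀ {v} → Λ v → Λ (ρ⁻¹ v)
      Λ-ρ⁻¹ {v} Λv = subst Λ (⊖ω²≡ρ⁻¹ v) (Λ-⊖ {ω· (ω· v)} (Λ-ω {ω· v} (Λ-ω Λv)))

      stab-Λ : ∀ k {v} → Λ v → T v (rot k) ≡ rot k
      stab-Λ k {v} = go k v
        where
        up : ∀ v d → T (ρ⁻¹ v) d ≡ d → T v (f d) ≡ f d
        up v d eq = trans (cong (λ u → T u (f d)) (sym (ρρ⁻¹ v))) (trans (sym (φ-T (ρ⁻¹ v) d)) (cong f eq))
        go : ∀ k v → Λ v → T v (rot k) ≡ rot k
        go fzero               v Λv = fixed Λv
        go (fsuc fzero)        v Λv = up v d₀ (fixed (Λ-ρ⁻¹ Λv))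
        go (fsuc (fsuc fzero)) v Λv = up v (f d₀) (up (ρ⁻¹ v) d₀ (fixed (Λ-ρ⁻¹ {ρ⁻¹ v} (Λ-ρ⁻¹ Λv))))

      -- Translating d₀ by w changes u by (1 − ω²) w, which brings u to 0, 1 or −1; then φ² or σ has a fixed dart.
      nofix-rot₂ : ∀ u → T u (f (f d₀)) ≢ d₀
      nofix-rot₂ (x , y) eq = go ((x + y) %ℕ 3) ((x + y) /ℕ 3) (n%ℕd<d (x + y) 3) (a≡a%ℕn+[a/ℕn]*n (x + y) 3)
        where
        moved : ∀ u w t → u ⊕ w ≡ t ⊕ ρ (ρ w) → T u (f (f d₀)) ≡ d₀ → T t (f (f (T w d₀))) ≡ T w d₀
        moved u w t u+w≡ eq = begin
          T t (f (f (T w d₀)))             ≡⟨ cong (T t) (trans (cong f (φ-T w d₀)) (φ-T (ρ w) (f d₀))) ⟩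
          T t (T (ρ (ρ w)) (f (f d₀)))     ≡⟨ T-⊕ t (ρ (ρ w)) _ ⟨
          T (t ⊕ ρ (ρ w)) (f (f d₀))       ≡⟨ cong (λ z → T z (f (f d₀))) (trans (sym u+w≡) (⊕-comm u w)) ⟩
          T (w ⊕ u) (f (f d₀))             ≡⟨ T-⊕ w u _ ⟩
          T w (T u (f (f d₀)))             ≡⟨ cong (T w) eq ⟩
          T w d₀ ∎
          where open ≡-Reasoning

        -- Since ω ≡ 1 modulo 1 - ω², the class of u = x + y ω is that of x + y modulo 3. When x + y
        -- = t + 3b, the shift w = -b + (b - y) ω replaces u by t.
        shifted : ∀ t b → x + y ≡ t + + 3 * b → T (t , 0ℤ) (f (f (T (- b , b - y) d₀))) ≡ T (- b , b - y) d₀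
        shifted t b x+y≡ = moved (x , y) (- b , b - y) (t , 0ℤ)
          (cong₂ _,_ (trans (cong (_+ - b) (trans (e₀ x y) (cong (_- y) x+y≡))) (e₁ t b y)) (e₂ b y)) eq
          where
          e₀ : ∀ x y → x ≡ (x + y) - y
          e₀ = solve-∀
          e₁ : ∀ t b y → (t + + 3 * b) - y + - b ≡ t + ((b - y) - - b)
          e₁ = solve-∀
          e₂ : ∀ b y → y + (b - y) ≡ 0ℤ + (((b - y) - - b) - (b - y))
          e₂ = solve-∀

        unmoved : ∀ d → T (0ℤ , 0ℤ) (f (f d)) ≢ d
        unmoved d eq = f²-nofix d (trans (sym (T-0 _)) eq)

        plus : ∀ d → T 𝟙 (f (f d)) ≢ d
        plus d eq = σ-nofix 𝕋 (f e) (trans (s≡ (f e)) (cong f (trans (cong a (sym ae≡fe)) (α-invol 𝕋 e))))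
          where
          e = f (f d)
          ae≡fe : a e ≡ f e
          ae≡fe = trans (sym (f⁶ (a e))) (cong (f ∘ f ∘ f) (trans (sym (T-𝟙 e)) eq))

        minus : ∀ d → T (⊖ 𝟙) (f (f d)) ≢ d
        minus d eq = σ-nofix 𝕋 d (trans (s≡ d) (trans (sym (f⁶ (f (a d)))) (trans (cong (f ∘ f ∘ f ∘ f) (sym f²d≡)) (f⁶ d))))
          where
          f²d≡ : f (f d) ≡ f (f (f (a d)))
          f²d≡ = trans (sym (T-inverse (⊖ 𝟙) eq)) (T-𝟙 d)

        go : ∀ r q → r ℕ.< 3 → x + y ≡ + r + q * + 3 → ⊥
        go 0 q _ eq = unmoved _ (shifted 0ℤ q (trans eq (e q)))
          where
          e : ∀ q → 0ℤ + q * + 3 ≡ 0ℤ + + 3 * q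
          e = solve-∀
        go 1 q _ eq = plus _ (shifted 1ℤ q (trans eq (e q)))
          where
          e : ∀ q → 1ℤ + q * + 3 ≡ 1ℤ + + 3 * q
          e = solve-∀
        -- The remainder 2 counts as -1, which raises the quotient by 1.
        go 2 q _ eq = minus _ (shifted (- 1ℤ) (1ℤ + q) (trans eq (e q)))
          where
          e : ∀ q → + 2 + q * + 3 ≡ - 1ℤ + + 3 * (1ℤ + q)
          e = solve-∀
        go (suc (suc (suc _))) q (s≤s (s≤s (s≤s ()))) eq

      -- If φ d₀ were a translate of d₀, applying φ once more would make φ² d₀ one as well.
      nofix-rot₁ : ∀ u → T u (f d₀) ≢ d₀
      nofix-rot₁ u eq = nofix-rot₂ (⊖ (ρ (⊖ u) ⊕ (⊖ u))) (T-inverse (ρ (⊖ u) ⊕ (⊖ u)) (begin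
        T (ρ (⊖ u) ⊕ (⊖ u)) d₀       ≡⟨ T-⊕ (ρ (⊖ u)) (⊖ u) d₀ ⟩
        T (ρ (⊖ u)) (T (⊖ u) d₀)     ≡⟨ cong (T (ρ (⊖ u))) fd₀ ⟩
        T (ρ (⊖ u)) (f d₀)           ≡⟨ φ-T (⊖ u) d₀ ⟨
        f (T (⊖ u) d₀)               ≡⟨ cong f fd₀ ⟩
        f (f d₀) ∎))
        where
        open ≡-Reasoning
        fd₀ : T (⊖ u) d₀ ≡ f d₀
        fd₀ = T-inverse u eq

      -- This makes k well defined. Inverting the translation or cancelling φ reduces every unequal
      -- pair to a translate of φ d₀ or φ² d₀ being d₀.
      same-rotation : ∀ k l u → T u (rot k) ≡ rot l → k ≡ l
      same-rotation fzero               fzero               u eq = refl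
      same-rotation (fsuc fzero)        (fsuc fzero)        u eq = refl
      same-rotation (fsuc (fsuc fzero)) (fsuc (fsuc fzero)) u eq = refl
      same-rotation (fsuc fzero)        fzero               u eq = contradiction eq (nofix-rot₁ u)
      same-rotation (fsuc (fsuc fzero)) fzero               u eq = contradiction eq (nofix-rot₂ u)
      same-rotation fzero (fsuc fzero)        u eq = contradiction (T-inverse u eq) (nofix-rot₁ (⊖ u))
      same-rotation fzero (fsuc (fsuc fzero)) u eq = contradiction (T-inverse u eq) (nofix-rot₂ (⊖ u))
      same-rotation (fsuc fzero) (fsuc (fsuc fzero)) u eq =
        contradiction (T-inverse (ρ⁻¹ u) (f-injective (trans (φ-T (ρ⁻¹ u) d₀) (trans (cong (λ z → T z (f d₀)) (ρρ⁻¹ u)) eq)))) (nofix-rot₁ (⊖ ρ⁻¹ u))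
      same-rotation (fsuc (fsuc fzero)) (fsuc fzero) u eq =
        contradiction (f-injective (trans (φ-T (ρ⁻¹ u) (f d₀)) (trans (cong (λ z → T z (f (f d₀))) (ρρ⁻¹ u)) eq))) (nofix-rot₁ (ρ⁻¹ u))

      kernel : ∀ p q → toDart p ≡ toDart q → (proj₂ p ≡ proj₂ q) × Λ (proj₁ p ⊕ (⊖ proj₁ q))
      kernel (v , k) (w , l) eq = k≡l , Λ-stab k (trans difference (cong rot (sym k≡l)))
        where
        difference : T (v ⊕ (⊖ w)) (rot k) ≡ rot l
        difference = trans (cong (λ u → T u (rot k)) (⊕-comm v (⊖ w))) (trans (T-⊕ (⊖ w) v (rot k)) (T-inverse w (sym eq)))
        k≡l : k ≡ l
        k≡l = same-rotation k l (v ⊕ (⊖ w)) difference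

      toDart-cong : ∀ v w k → Λ (v ⊕ (⊖ w)) → toDart (v , k) ≡ toDart (w , k)
      toDart-cong v w k Λv-w = trans (cong (λ u → T u (rot k)) (e v w)) (trans (T-⊕ w (v ⊕ (⊖ w)) (rot k)) (cong (T w) (stab-Λ k Λv-w)))
        where
        e₁ : ∀ x y → x ≡ y + (x - y)
        e₁ = solve-∀
        e : ∀ v w → v ≡ w ⊕ (v ⊕ (⊖ w))
        e (x , y) (x′ , y′) = cong₂ _,_ (e₁ x x′) (e₁ y y′)

      -- α takes the dart at w to the one at -(w + 1), and these two coincide when 2w + 1 ∈ Λ.
      ¬Λ-odd : ∀ w → ¬ Λ ((w ⊕ 𝟙) ⊕ w)
      ¬Λ-odd w (fixes eq) = α-nofix 𝕋 (T w d₀) (begin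
        a (T w d₀)                        ≡⟨ a-T w d₀ ⟩
        T (⊖ (w ⊕ 𝟙)) (f (f (f d₀)))      ≡⟨ cong (T (⊖ (w ⊕ 𝟙))) f³d₀ ⟩
        T (⊖ (w ⊕ 𝟙)) d₀                  ≡⟨ T-inverse (w ⊕ 𝟙) (trans (sym (T-⊕ (w ⊕ 𝟙) w d₀)) eq) ⟩
        T w d₀ ∎)
        where open ≡-Reasoning

      -- If y is odd, then v is ω or 1 + ω modulo 2, and multiplying by ω² or ω brings it to the
      -- form 2w + 1. Applied to the basis vector G (ω - c), this makes G even.
      Λ-even : ∀ {v} → Λ v → + 2 ∣ proj₂ v
      Λ-even {x , y} Λv = go (x %ℕ 2) (y %ℕ 2) (x /ℕ 2) (y /ℕ 2) (n%ℕd<d x 2) (n%ℕd<d y 2) (a≡a%ℕn+[a/ℕn]*n x 2) (a≡a%ℕn+[a/ℕn]*n y 2)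
        where
        go : ∀ i j p q → i ℕ.< 2 → j ℕ.< 2 → x ≡ + i + p * + 2 → y ≡ + j + q * + 2 → + 2 ∣ y
        go i 0 p q _ _ x≡ y≡ = divides q (trans y≡ (e (q * + 2)))
          where
          e : ∀ z → 0ℤ + z ≡ z
          e = solve-∀
        go 0 1 p q _ _ refl refl = contradiction (subst Λ (cong₂ _,_ (e₁ p q) (e₂ p q)) (Λ-ω {ω· (x , y)} (Λ-ω Λv))) (¬Λ-odd (q - p , - p))
          where
          e₁ : ∀ p q → - ((0ℤ + p * + 2) - (1ℤ + q * + 2)) ≡ q - p + 1ℤ + (q - p)
          e₁ = solve-∀
          e₂ : ∀ p q → - (1ℤ + q * + 2) - ((0ℤ + p * + 2) - (1ℤ + q * + 2)) ≡ - p + 0ℤ + - p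
          e₂ = solve-∀
        go 1 1 p q _ _ refl refl = contradiction (subst Λ (cong₂ _,_ (e₁ q) (e₂ p q)) (Λ-ω Λv)) (¬Λ-odd (- 1ℤ - q , p - q))
          where
          e₁ : ∀ q → - (1ℤ + q * + 2) ≡ - 1ℤ - q + 1ℤ + (- 1ℤ - q)
          e₁ = solve-∀
          e₂ : ∀ p q → (1ℤ + p * + 2) - (1ℤ + q * + 2) ≡ p - q + 0ℤ + (p - q)
          e₂ = solve-∀
        go (suc (suc _)) 1 p q (s≤s (s≤s ())) _ _ _
        go _ (suc (suc _)) p q _ (s≤s (s≤s ())) _ _

      period : ∃ λ m → Λ (+ suc m , 0ℤ)
      period = collide (pigeonhole (ℕ.n<1+n n) (λ i → T (+ toℕ i , 0ℤ) d₀))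
        where
        collide : (∃ λ (i : Fin (suc n)) → ∃ λ j → toℕ i ℕ.< toℕ j × T (+ toℕ i , 0ℤ) d₀ ≡ T (+ toℕ j , 0ℤ) d₀) → ∃ λ m → Λ (+ suc m , 0ℤ)
        collide (i , j , i<j , eq) = m , fixes (T-injective (+ toℕ i , 0ℤ)
          (trans (sym (T-⊕ (+ toℕ i , 0ℤ) (+ suc m , 0ℤ) d₀)) (trans (cong (λ z → T (z , 0ℤ) d₀) (cong +_ i+m≡j)) (sym eq))))
          where
          m = toℕ j ℕ.∸ suc (toℕ i)
          i+m≡j : toℕ i ℕ.+ suc m ≡ toℕ j
          i+m≡j = trans (ℕ.+-suc (toℕ i) m) (ℕ.m+[n∸m]≡n i<j)

      coordinates : ∃ λ g → ∃ λ M → ∃ λ c → NonZero g × (c ℕ.< M) × (+ M ∣ F (+ c)) × Coordinates (2 ℕ.* g) M c s a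
      coordinates = build (hermiteNormalForm Λ Λ-⊕ Λ-⊖ Λ-ω Λ? (proj₁ period) (proj₂ period))
        where
        build : (∃ λ G → ∃ λ M → ∃ λ c → NonZero G × (c ℕ.< M) × (+ M ∣ F (+ c)) ×
                  (∀ v → Λ v → Ideal G M c v) × (∀ v → Ideal G M c v → Λ v)) → _
        build (G , M , c , G≢0 , c<M , M∣Fc , Λ⇒I , I⇒Λ) = halve (∣⇒∣ᵤ (Λ-even (I⇒Λ (- (+ G * + c) , + G) generator₂∈Ideal))) G≢0 C
          where
          C : Coordinates G M c s a
          C = record
            { dart = toDart ; coords = λ e → proj₁ (locate e) ; dart-coords = λ e → proj₂ (locate e)
            ; dart-cong = λ v w k d → toDart-cong v w k (I⇒Λ (v ⊕ (⊖ w)) d)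
            ; dart-injective = λ p q eq → proj₁ (kernel p q eq) , Λ⇒I (proj₁ p ⊕ (⊖ proj₁ q)) (proj₂ (kernel p q eq))
            ; dart-σ = toDart-σ ; dart-α = toDart-α }
          halve : ∀ {G} → 2 ℕ.∣ G → NonZero G → Coordinates G M c s a →
            ∃ λ g → ∃ λ M → ∃ λ c → NonZero g × (c ℕ.< M) × (+ M ∣ F (+ c)) × Coordinates (2 ℕ.* g) M c s a
          halve (ℕ.divides g refl) g2≢0 C = g , M , c , ℕ.m*n≢0⇒m≢0 g {{g2≢0}} , c<M , M∣Fc , subst (λ G → Coordinates G M c s a) (ℕ.*-comm g 2) C

    private
      f⁶ = φ^6≡id (σ-cube 𝕋) (σ-nofix 𝕋) (α-invol 𝕋) (α-nofix 𝕋) (faces 𝕋)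

      φ²-nofix : ∀ d → φ 𝕋 (φ 𝕋 d) ≢ d
      φ²-nofix d eq with faces 𝕋 d
      ... | inj₁ (fix , φ≢)      = φ≢ (trans (cong (φ 𝕋) (sym eq)) fix)
      ... | inj₂ (_ , φ²≢ , _)   = φ²≢ eq

      φα³ : ∀ d → φ 𝕋 (a (φ 𝕋 (a (φ 𝕋 (a d))))) ≡ d
      φα³ d = trans (φα _) (trans (cong s (φα _)) (trans (cong (s ∘ s) (φα d)) (σ-cube 𝕋 d)))
        where
        φα : ∀ d → φ 𝕋 (a d) ≡ s d
        φα d = cong s (α-invol 𝕋 d)

    coordinates : ∃ λ g → ∃ λ M → ∃ λ c → NonZero g × (c ℕ.< M) × (+ M ∣ F (+ c)) × Coordinates (2 ℕ.* g) M c (σ 𝕋) (α 𝕋)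
    coordinates = Action.coordinates (φ 𝕋) (λ _ → refl) f⁶ φ³d₀ φ²-nofix (translations (φ 𝕋) a f⁶ (α-invol 𝕋) φα³)

  symmetric⇒coordinates : ∀ {n} (𝕋 : Trihex n) → HasThreefoldSymmetry 𝕋 →
    ∃ λ g → ∃ λ M → ∃ λ c → NonZero g × (c ℕ.< M) × (+ M ∣ F (+ c)) × Coordinates (2 ℕ.* g) M c (σ 𝕋) (α 𝕋)
  symmetric⇒coordinates {n} 𝕋 sym𝕋 with any? {P = λ d → iter (φ 𝕋) 3 d ≡ d} (λ d → iter (φ 𝕋) 3 d ≟ᶠ d)
  ... | yes (d₀ , φ³d₀) = Classification.coordinates 𝕋 d₀ φ³d₀ sym𝕋
  -- Without a triangle, the twelve triangular darts required by Euler's formula would number zero.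
  ... | no none = contradiction (trans (sym (planar⇒triangular≡12 (σ-cube 𝕋) (σ-nofix 𝕋) (α-invol 𝕋) (α-nofix 𝕋) (faces 𝕋) (planar 𝕋)))
      (sum-zero _ (λ d → ind-no (triangular? (σ-cube 𝕋) (σ-nofix 𝕋) (α-invol 𝕋) (α-nofix 𝕋) (faces 𝕋) d) (λ eq → none (d , eq))))) λ ()

-- Finite enumerations and their arithmetic.

module Enumerations where

  open import Data.Nat using (ℕ; _+_; _*_)
  open import Data.Fin using (Fin; combine; remQuot; splitAt; join) renaming (zero to fzero)
  open import Data.Fin.Properties using (combine-remQuot; remQuot-combine; splitAt-join; join-splitAt)
  open import Data.Product using (∃; _×_; _,_; proj₁; proj₂)
  open import Data.Sum using (_⊎_; inj₁; inj₂)
  open import Relation.Nullary using (¬_; contradiction)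
  open import Relation.Binary.PropositionalEquality using (_≡_; refl; sym; trans; cong; cong₂; subst)

  record Enum {A : Set} (P : A → Set) (K : ℕ) : Set where
    field
      at        : Fin K → A
      sound     : ∀ i → P (at i)
      injective : ∀ {i j} → at i ≡ at j → i ≡ j
      complete  : ∀ a → P a → ∃ λ i → at i ≡ a

  open Enum

  module _ {A : Set} {P : A → Set} where

    enum-∅ : (∀ a → ¬ P a) → Enum P 0
    enum-∅ none = record { at = λ () ; sound = λ () ; injective = λ { {()} } ; complete = λ a Pa → contradiction Pa (none a) }

    enum-singleton : ∀ a → P a → (∀ b → P b → a ≡ b) → Enum P 1
    enum-singleton a Pa unique = record
      { at = λ _ → a ; sound = λ _ → Pa ; injective = λ { {fzero} {fzero} _ → refl } ; complete = λ b Pb → fzero , unique b Pb }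

    -- Transports along a relation that is one-to-one between `P` and `Q`; this suits the Chinese
    -- remainder correspondence, which is given by congruences rather than by a formula.
    enum-bijection : ∀ {B : Set} {Q : B → Set} {K} (R : A → B → Set) →
      (∀ a → P a → ∃ λ b → Q b × R a b) → (∀ b → Q b → ∃ λ a → P a × R a b) →
      (∀ a a′ b → P a → P a′ → R a b → R a′ b → a ≡ a′) → (∀ a b b′ → Q b → Q b′ → R a b → R a b′ → b ≡ b′) →
      Enum P K → Enum Q K
    enum-bijection {B} {Q} R forth back left right E = record
      { at = λ i → proj₁ (image i)
      ; sound = λ i → proj₁ (proj₂ (image i))
      ; injective = λ {i} {j} eq → injective E (left _ _ _ (sound E i) (sound E j) (proj₂ (proj₂ (image i)))
                                      (subst (R (at E j)) (sym eq) (proj₂ (proj₂ (image j)))))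
      ; complete = λ b Qb → find b Qb (back b Qb) }
      where
      image : ∀ i → ∃ λ b → Q b × R (at E i) b
      image i = forth (at E i) (sound E i)
      find : ∀ b → Q b → (∃ λ a → P a × R a b) → ∃ λ i → proj₁ (image i) ≡ b
      find b Qb (a , Pa , Rab) = i , right _ _ _ (proj₁ (proj₂ (image i))) Qb (proj₂ (proj₂ (image i))) (subst (λ z → R z b) (sym (proj₂ (complete E a Pa))) Rab)
        where i = proj₁ (complete E a Pa)

    enum-× : ∀ {B : Set} {Q : B → Set} {K L} → Enum P K → Enum Q L → Enum (λ (ab : A × B) → P (proj₁ ab) × Q (proj₂ ab)) (K * L)
    enum-× {K = K} {L} E E′ = record
      { at = λ i → at E (proj₁ (remQuot {K} L i)) , at E′ (proj₂ (remQuot {K} L i))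
      ; sound = λ i → sound E (proj₁ (remQuot {K} L i)) , sound E′ (proj₂ (remQuot {K} L i))
      ; injective = λ {i} {j} eq → trans (sym (combine-remQuot {K} L i)) (trans (cong₂ combine (injective E (cong proj₁ eq)) (injective E′ (cong proj₂ eq)))
                                     (combine-remQuot {K} L j))
      ; complete = λ { (a , b) (Pa , Qb) → let i , ia = complete E a Pa ; j , jb = complete E′ b Qb in
          combine i j , cong₂ _,_ (trans (cong (λ r → at E (proj₁ r)) (remQuot-combine i j)) ia) (trans (cong (λ r → at E′ (proj₂ r)) (remQuot-combine i j)) jb) } }

    enum-⊎ : ∀ {Q : A → Set} {K L} → Enum P K → Enum Q L → (∀ a → P a → ¬ Q a) → Enum (λ a → P a ⊎ Q a) (K + L)
    enum-⊎ {Q} {K} {L} E E′ disjoint = record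
      { at = λ i → at⊎ (splitAt K i)
      ; sound = λ i → sound⊎ (splitAt K i)
      ; injective = λ {i} {j} eq → trans (sym (join-splitAt K L i)) (trans (cong (join K L) (injective⊎ (splitAt K i) (splitAt K j) eq)) (join-splitAt K L j))
      ; complete = λ a PQa → let s , sa = complete⊎ a PQa in join K L s , trans (cong at⊎ (splitAt-join K L s)) sa }
      where
      at⊎ : Fin K ⊎ Fin L → A
      at⊎ (inj₁ i) = at E i
      at⊎ (inj₂ j) = at E′ j
      sound⊎ : ∀ s → P (at⊎ s) ⊎ Q (at⊎ s)
      sound⊎ (inj₁ i) = inj₁ (sound E i)
      sound⊎ (inj₂ j) = inj₂ (sound E′ j)
      injective⊎ : ∀ s t → at⊎ s ≡ at⊎ t → s ≡ t
      injective⊎ (inj₁ i) (inj₁ j) eq = cong inj₁ (injective E eq)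
      injective⊎ (inj₂ i) (inj₂ j) eq = cong inj₂ (injective E′ eq)
      injective⊎ (inj₁ i) (inj₂ j) eq = contradiction (sound E′ j) (disjoint _ (subst P eq (sound E i)))
      injective⊎ (inj₂ i) (inj₁ j) eq = contradiction (sound E′ i) (disjoint _ (subst P (sym eq) (sound E j)))
      complete⊎ : ∀ a → P a ⊎ Q a → ∃ λ s → at⊎ s ≡ a
      complete⊎ a (inj₁ Pa) = inj₁ (proj₁ (complete E a Pa)) , proj₂ (complete E a Pa)
      complete⊎ a (inj₂ Qa) = inj₂ (proj₁ (complete E′ a Qa)) , proj₂ (complete E′ a Qa)

    enum-cong : ∀ {Q : A → Set} {K} → (∀ a → P a → Q a) → (∀ a → Q a → P a) → Enum P K → Enum Q K
    enum-cong to from E = record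
      { at = at E ; sound = λ i → to _ (sound E i) ; injective = injective E ; complete = λ a Qa → complete E a (from a Qa) }

-- Splitting one prime off the norm of an ideal.

module IdealsOfNorm where

  open Enumerations
  open EisensteinIdeals using (F; residue-unique; n∣a-a%n; ∣-resp)
  open import Data.Nat as ℕ using (ℕ; zero; suc; NonZero; _^_)
  import Data.Nat.Properties as ℕ
  import Data.Nat.Divisibility as ℕ
  import Data.Nat.Tactic.RingSolver as ℕ
  open import Data.Nat.Primality using (Prime; euclidsLemma; prime⇒irreducible; prime⇒nonZero)
  open import Data.Nat.Coprimality using (Coprime; coprime-Bézout)
  open import Data.Nat.GCD using (module Bézout)
  open import Data.Integer using (+_; _+_; _*_; -_; _-_; 0ℤ; 1ℤ)
  open import Data.Integer.Properties using (pos-*; pos-+)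
  open import Data.Integer.DivMod using (_%ℕ_; n%ℕd<d)
  open import Data.Integer.Divisibility.Signed using (_∣_; divides; ∣ᵤ⇒∣; ∣-trans; ∣m⇒∣m*n; ∣m⇒∣-m; ∣m∣n⇒∣m+n)
  open import Data.Integer.Tactic.RingSolver using (solve-∀)
  open import Data.Product using (∃; _×_; _,_; proj₁; proj₂)
  open import Data.Sum using (_⊎_; inj₁; inj₂)
  open import Relation.Nullary using (¬_; yes; no; contradiction)
  open import Relation.Binary.PropositionalEquality using (_≡_; refl; sym; trans; cong; cong₂; subst; module ≡-Reasoning)

  Root : ℕ → ℕ → Set
  Root m c = (c ℕ.< m) × (+ m ∣ F (+ c))

  -- The triple (g , M , c) stands for the ideal g ⟨ M , ω − c ⟩ of norm g² M.
  IdealOfNorm : ℕ → ℕ × ℕ × ℕ → Set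
  IdealOfNorm N (g , M , c) = (g ℕ.* g ℕ.* M ≡ N) × Root M c

  F-cong : ∀ {m} x y → m ∣ x - y → m ∣ F y → m ∣ F x
  F-cong x y d Fy = ∣-resp (e x y) (∣m∣n⇒∣m+n (∣m⇒∣m*n (x + y + 1ℤ) d) Fy)
    where
    e : ∀ x y → (x - y) * (x + y + 1ℤ) + (y * y + y + 1ℤ) ≡ x * x + x + 1ℤ
    e = solve-∀

  congruent-sym : ∀ {m} x y → m ∣ x - y → m ∣ y - x
  congruent-sym x y d = ∣-resp (e x y) (∣m⇒∣-m d)
    where
    e : ∀ x y → - (x - y) ≡ y - x
    e = solve-∀

  congruent-trans : ∀ {m} x y z → m ∣ x - y → m ∣ y - z → m ∣ x - z
  congruent-trans x y z d d′ = ∣-resp (e x y z) (∣m∣n⇒∣m+n d d′)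
    where
    e : ∀ x y z → (x - y) + (y - z) ≡ x - z
    e = solve-∀

  Bezout : ℕ → ℕ → Set
  Bezout Q M = ∃ λ u → ∃ λ v → u * + Q + v * + M ≡ 1ℤ

  private
    lift : ∀ x y m n → 1 ℕ.+ y ℕ.* n ≡ x ℕ.* m → + x * + m ≡ 1ℤ + + y * + n
    lift x y m n eq = trans (sym (pos-* x m)) (trans (cong +_ (sym eq)) (trans (pos-+ 1 (y ℕ.* n)) (cong (λ z → 1ℤ + z) (pos-* y n))))

  coprime⇒Bezout : ∀ {Q M} → Coprime Q M → Bezout Q M
  coprime⇒Bezout {Q} {M} c with coprime-Bézout c
  ... | Bézout.+- x y eq = + x , - + y , trans (cong (_+ - + y * + M) (lift x y Q M eq)) (e (+ y) (+ M))
    where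
    e : ∀ y M → 1ℤ + y * M + - y * M ≡ 1ℤ
    e = solve-∀
  ... | Bézout.-+ x y eq = - + x , + y , trans (cong (λ z → - + x * + Q + z) (lift y x M Q eq)) (e (+ x) (+ Q))
    where
    e : ∀ y M → - y * M + (1ℤ + y * M) ≡ 1ℤ
    e = solve-∀

  prime∤⇒coprime : ∀ {p M} → Prime p → ¬ (p ℕ.∣ M) → Coprime p M
  prime∤⇒coprime pp p∤M (d∣p , d∣M) with prime⇒irreducible pp d∣p
  ... | inj₁ d≡1  = d≡1
  ... | inj₂ refl = contradiction d∣M p∤M

  Bezout-* : ∀ {p Q M} → Bezout p M → Bezout Q M → Bezout (p ℕ.* Q) M
  Bezout-* {p} {Q} {M} (u , v , eq) (u′ , v′ , eq′) = u * u′ , v + v′ * (1ℤ - v * + M) , (begin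
    u * u′ * + (p ℕ.* Q) + (v + v′ * (1ℤ - v * + M)) * + M                 ≡⟨ cong (λ z → u * u′ * z + _) (pos-* p Q) ⟩
    u * u′ * (+ p * + Q) + (v + v′ * (1ℤ - v * + M)) * + M                 ≡⟨ e₁ u u′ v v′ (+ p) (+ Q) (+ M) ⟩
    (u * + p) * (u′ * + Q) + v * + M + v′ * + M * (1ℤ - v * + M)           ≡⟨ cong (λ z → (u * + p) * (u′ * + Q) + v * + M + v′ * + M * (z - v * + M)) eq ⟨
    (u * + p) * (u′ * + Q) + v * + M + v′ * + M * ((u * + p + v * + M) - v * + M) ≡⟨ e₂ (u * + p) (u′ * + Q) (v * + M) (v′ * + M) ⟩
    (u * + p) * (u′ * + Q + v′ * + M) + v * + M                            ≡⟨ cong (λ z → (u * + p) * z + v * + M) eq′ ⟩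
    (u * + p) * 1ℤ + v * + M                                               ≡⟨ e₃ (u * + p) (v * + M) ⟩
    u * + p + v * + M                                                      ≡⟨ eq ⟩
    1ℤ ∎)
    where
    open ≡-Reasoning
    e₁ : ∀ u u′ v v′ p Q M → u * u′ * (p * Q) + (v + v′ * (1ℤ - v * M)) * M ≡ (u * p) * (u′ * Q) + v * M + v′ * M * (1ℤ - v * M)
    e₁ = solve-∀
    e₂ : ∀ a b c d → a * b + c + d * ((a + c) - c) ≡ a * (b + d) + c
    e₂ = solve-∀
    e₃ : ∀ a b → a * 1ℤ + b ≡ a + b
    e₃ = solve-∀

  Bezout-^ : ∀ {p M} → Bezout p M → ∀ k → Bezout (p ^ k) M
  Bezout-^ {p} {M} b zero    = 1ℤ , 0ℤ , e (+ M)
    where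
    e : ∀ M → 1ℤ * 1ℤ + 0ℤ * M ≡ 1ℤ
    e = solve-∀
  Bezout-^ b (suc k) = Bezout-* b (Bezout-^ b k)

  module _ {Q M : ℕ} (bezout : Bezout Q M) where
    private
      u = proj₁ bezout
      v = proj₁ (proj₂ bezout)
      uQ+vM≡1 = proj₂ (proj₂ bezout)

    ∣∧∣⇒*∣ : ∀ {z} → + Q ∣ z → + M ∣ z → + (Q ℕ.* M) ∣ z
    ∣∧∣⇒*∣ {z} (divides q z≡qQ) (divides m z≡mM) = divides (u * m + v * q) (begin
      z                                              ≡⟨ e₁ z ⟩
      z * 1ℤ                                         ≡⟨ cong (z *_) uQ+vM≡1 ⟨
      z * (u * + Q + v * + M)                        ≡⟨ e₂ z u (+ Q) v (+ M) ⟩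
      u * + Q * z + v * + M * z                      ≡⟨ cong₂ (λ a b → u * + Q * a + v * + M * b) z≡mM z≡qQ ⟩
      u * + Q * (m * + M) + v * + M * (q * + Q)      ≡⟨ e₃ u (+ Q) m (+ M) v q ⟩
      (u * m + v * q) * (+ Q * + M)                  ≡⟨ cong ((u * m + v * q) *_) (pos-* Q M) ⟨
      (u * m + v * q) * + (Q ℕ.* M) ∎)
      where
      open ≡-Reasoning
      e₁ : ∀ z → z ≡ z * 1ℤ
      e₁ = solve-∀
      e₂ : ∀ z u Q v M → z * (u * Q + v * M) ≡ u * Q * z + v * M * z
      e₂ = solve-∀
      e₃ : ∀ u Q m M v q → u * Q * (m * M) + v * M * (q * Q) ≡ (u * m + v * q) * (Q * M)
      e₃ = solve-∀

    chineseRemainder : .{{_ : NonZero (Q ℕ.* M)}} → ∀ r c → ∃ λ x → (x ℕ.< Q ℕ.* M) × (+ Q ∣ + x - r) × (+ M ∣ + x - c)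
    chineseRemainder r c = z %ℕ (Q ℕ.* M) , n%ℕd<d z (Q ℕ.* M) ,
      congruent-trans (+ (z %ℕ (Q ℕ.* M))) z r (∣-trans Q∣QM near) (divides (u * (c - r)) (trans (e₁ (r * (v * + M)) c u (+ Q) r)
        (trans (cong (λ w → r * (v * + M) + c * (u * + Q) - r * w) (sym uQ+vM≡1)) (e₂ r v (+ M) c u (+ Q))))) ,
      congruent-trans (+ (z %ℕ (Q ℕ.* M))) z c (∣-trans M∣QM near) (divides (v * (r - c)) (trans (e₁ (r * (v * + M)) c u (+ Q) c)
        (trans (cong (λ w → r * (v * + M) + c * (u * + Q) - c * w) (sym uQ+vM≡1)) (e₃ r v (+ M) c u (+ Q)))))
      where
      z = r * (v * + M) + c * (u * + Q)
      near : + (Q ℕ.* M) ∣ + (z %ℕ (Q ℕ.* M)) - z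
      near = congruent-sym z (+ (z %ℕ (Q ℕ.* M))) (n∣a-a%n z (Q ℕ.* M))
      Q∣QM : + Q ∣ + (Q ℕ.* M)
      Q∣QM = ∣ᵤ⇒∣ (ℕ.m∣m*n M)
      M∣QM : + M ∣ + (Q ℕ.* M)
      M∣QM = ∣ᵤ⇒∣ (ℕ.n∣m*n Q)
      e₁ : ∀ a c u Q r → a + c * (u * Q) - r ≡ a + c * (u * Q) - r * 1ℤ
      e₁ = solve-∀
      e₂ : ∀ r v M c u Q → r * (v * M) + c * (u * Q) - r * (u * Q + v * M) ≡ u * (c - r) * Q
      e₂ = solve-∀
      e₃ : ∀ r v M c u Q → r * (v * M) + c * (u * Q) - c * (u * Q + v * M) ≡ v * (r - c) * M
      e₃ = solve-∀

  p^k∣x*y⇒p^k∣y : ∀ {p} → Prime p → ∀ k x y → ¬ (p ℕ.∣ x) → p ^ k ℕ.∣ x ℕ.* y → p ^ k ℕ.∣ y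
  p^k∣x*y⇒p^k∣y pp zero x y p∤x d = ℕ.1∣ y
  p^k∣x*y⇒p^k∣y {p} pp (suc k) x y p∤x d with euclidsLemma x y pp (ℕ.∣-trans (ℕ.m∣m*n (p ^ k)) d)
  ... | inj₁ p∣x = contradiction p∣x p∤x
  ... | inj₂ (ℕ.divides y′ refl) = subst (p ^ suc k ℕ.∣_) (ℕ.*-comm p y′) (ℕ.*-monoʳ-∣ p (p^k∣x*y⇒p^k∣y pp k x y′ p∤x
          (ℕ.*-cancelˡ-∣ p {{prime⇒nonZero pp}} (subst (p ^ suc k ℕ.∣_) (e x y′ p) d))))
    where
    e : ∀ x y p → x ℕ.* (y ℕ.* p) ≡ p ℕ.* (x ℕ.* y)
    e = ℕ.solve-∀

  module _ {p N K} (pp : Prime p) (p∤N : ¬ (p ℕ.∣ N)) (E : Enum (IdealOfNorm N) K) {rootCount : ℕ → ℕ}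
    (roots : ∀ k → Enum (Root (p ^ k)) (rootCount k)) where

    private
      instance
        p≢0 : NonZero p
        p≢0 = prime⇒nonZero pp

      p^k≢0 : ∀ k → NonZero (p ^ k)
      p^k≢0 k = ℕ.m^n≢0 p k

      PrimitiveAtP : ℕ → ℕ × ℕ × ℕ → Set
      PrimitiveAtP k (g , M , c) = IdealOfNorm (p ^ k ℕ.* N) (g , M , c) × ¬ (p ℕ.∣ g)

      M∣N : ∀ {g M} → g ℕ.* g ℕ.* M ≡ N → M ℕ.∣ N
      M∣N {g} eq = ℕ.divides (g ℕ.* g) (sym eq)

      g∣N : ∀ {g M} → g ℕ.* g ℕ.* M ≡ N → g ℕ.∣ N
      g∣N {g} {M} eq = ℕ.divides (g ℕ.* M) (trans (sym eq) (e g M))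
        where
        e : ∀ g M → g ℕ.* g ℕ.* M ≡ g ℕ.* M ℕ.* g
        e = ℕ.solve-∀

      bezoutM : ∀ k {g M} → g ℕ.* g ℕ.* M ≡ N → Bezout (p ^ k) M
      bezoutM k {g} {M} eq = Bezout-^ (coprime⇒Bezout (prime∤⇒coprime pp (λ p∣M → p∤N (ℕ.∣-trans p∣M (M∣N {g} eq))))) k

      Combine : ℕ → ℕ × ℕ × ℕ × ℕ → ℕ × ℕ × ℕ → Set
      Combine k (r , g , M , c) (g′ , M′ , c′) = (g ≡ g′) × (M′ ≡ p ^ k ℕ.* M) × (+ (p ^ k) ∣ + c′ - + r) × (+ M ∣ + c′ - + c)

      -- When p does not divide g, all of p^k divides M′, so M′ = p^k M with p^k and M coprime. A
      -- root modulo M′ is then a root modulo p^k together with a root modulo M, and the latter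
      -- belongs to an ideal of norm N.
      enum-primitive : ∀ k → Enum (PrimitiveAtP k) (rootCount k ℕ.* K)
      enum-primitive k = enum-bijection (Combine k) forth back left right (enum-× (roots k) E)
        where
        Q = p ^ k
        instance
          Q≢0 : NonZero Q
          Q≢0 = p^k≢0 k

        e₁ : ∀ g Q M → g ℕ.* g ℕ.* (Q ℕ.* M) ≡ Q ℕ.* (g ℕ.* g ℕ.* M)
        e₁ = ℕ.solve-∀

        forth : ∀ a → Root Q (proj₁ a) × IdealOfNorm N (proj₂ a) → ∃ λ b → PrimitiveAtP k b × Combine k a b
        forth (r , g , M , c) ((r<Q , Q∣Fr) , norm , c<M , M∣Fc) = finish (chineseRemainder {Q} {M} bez {{QM≢0}} (+ r) (+ c))
          where
          bez = bezoutM k {g} norm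
          QM≢0 : NonZero (Q ℕ.* M)
          QM≢0 = ℕ.m*n≢0 Q M {{Q≢0}} {{ℕ.>-nonZero (ℕ.≤-<-trans ℕ.z≤n c<M)}}
          finish : (∃ λ x → (x ℕ.< Q ℕ.* M) × (+ Q ∣ + x - + r) × (+ M ∣ + x - + c)) → ∃ λ b → PrimitiveAtP k b × Combine k (r , g , M , c) b
          finish (x , x<QM , x≡r , x≡c) = (g , Q ℕ.* M , x) ,
            ((trans (e₁ g Q M) (cong (Q ℕ.*_) norm) , x<QM , ∣∧∣⇒*∣ {Q} {M} bez (F-cong (+ x) (+ r) x≡r Q∣Fr) (F-cong (+ x) (+ c) x≡c M∣Fc)) , λ p∣g → p∤N (ℕ.∣-trans p∣g (g∣N {g} norm))) ,
            refl , refl , x≡r , x≡c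

        back : ∀ b → PrimitiveAtP k b → ∃ λ a → (Root Q (proj₁ a) × IdealOfNorm N (proj₂ a)) × Combine k a b
        back (g , M′ , c′) ((norm , c′<M′ , M′∣Fc′) , p∤g) = go Q∣M′ norm c′<M′ M′∣Fc′
          where
          Q∣M′ : Q ℕ.∣ M′
          Q∣M′ = p^k∣x*y⇒p^k∣y pp k g M′ p∤g (p^k∣x*y⇒p^k∣y pp k g (g ℕ.* M′) p∤g
                   (ℕ.divides N (trans (sym (ℕ.*-assoc g g M′)) (trans norm (ℕ.*-comm Q N)))))
          go : ∀ {M′} → Q ℕ.∣ M′ → g ℕ.* g ℕ.* M′ ≡ Q ℕ.* N → c′ ℕ.< M′ → + M′ ∣ F (+ c′) →
               ∃ λ a → (Root Q (proj₁ a) × IdealOfNorm N (proj₂ a)) × Combine k a (g , M′ , c′)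
          go (ℕ.divides zero refl) _ ()
          go {M′} (ℕ.divides M@(suc _) eq) norm c′<M′ M′∣Fc′ =
            (+ c′ %ℕ Q , g , M , + c′ %ℕ M) ,
            ((n%ℕd<d (+ c′) Q , reduce Q (∣ᵤ⇒∣ (ℕ.divides M eq))) ,
             norm′ , n%ℕd<d (+ c′) M , reduce M (∣ᵤ⇒∣ (ℕ.divides Q (trans eq (ℕ.*-comm M Q))))) ,
            refl , trans eq (ℕ.*-comm M Q) , n∣a-a%n (+ c′) Q , n∣a-a%n (+ c′) M
            where
            reduce : ∀ m .{{_ : NonZero m}} → + m ∣ + M′ → + m ∣ F (+ (+ c′ %ℕ m))
            reduce m d = F-cong (+ (+ c′ %ℕ m)) (+ c′) (congruent-sym (+ c′) (+ (+ c′ %ℕ m)) (n∣a-a%n (+ c′) m)) (∣-trans d M′∣Fc′)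
            norm′ : g ℕ.* g ℕ.* M ≡ N
            norm′ = ℕ.*-cancelˡ-≡ _ _ Q (trans (sym (e₁ g Q M)) (trans (cong (g ℕ.* g ℕ.*_) (trans (ℕ.*-comm Q M) (sym eq))) norm))

        left : ∀ a a′ b → Root Q (proj₁ a) × IdealOfNorm N (proj₂ a) → Root Q (proj₁ a′) × IdealOfNorm N (proj₂ a′) →
               Combine k a b → Combine k a′ b → a ≡ a′
        left (r , g , M , c) (r′ , g′ , M₁ , c′) (gb , Mb , cb) ((r<Q , _) , _ , c<M , _) ((r′<Q , _) , _ , c′<M₁ , _)
          (refl , Mb≡ , d , d′) (refl , Mb≡′ , d₁ , d₁′) = same (ℕ.*-cancelˡ-≡ M M₁ Q (trans (sym Mb≡) Mb≡′)) c′<M₁ d₁′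
          where
          same : ∀ {M₁} → M ≡ M₁ → c′ ℕ.< M₁ → + M₁ ∣ + cb - + c′ → (r , g , M , c) ≡ (r′ , g , M₁ , c′)
          same refl c′<M d₁′ = cong₂ (λ x y → x , g , M , y)
            (residue-unique r<Q r′<Q (congruent-trans (+ r) (+ cb) (+ r′) (congruent-sym (+ cb) (+ r) d) d₁))
            (residue-unique c<M c′<M (congruent-trans (+ c) (+ cb) (+ c′) (congruent-sym (+ cb) (+ c) d′) d₁′))

        right : ∀ a b b′ → PrimitiveAtP k b → PrimitiveAtP k b′ → Combine k a b → Combine k a b′ → b ≡ b′
        right (r , g , M , c) (g₁ , M₁ , c₁) (g₂ , M₂ , c₂) ((norm , c₁<M₁ , _) , _) ((_ , c₂<M₂ , _) , _)
          (refl , refl , d , d′) (refl , refl , e , e′) = cong (λ x → g , Q ℕ.* M , x)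
            (residue-unique c₁<M₁ c₂<M₂ (∣∧∣⇒*∣ {Q} {M} (bezoutM k {g} norm′)
              (congruent-trans (+ c₁) (+ r) (+ c₂) d (congruent-sym (+ c₂) (+ r) e))
              (congruent-trans (+ c₁) (+ c) (+ c₂) d′ (congruent-sym (+ c₂) (+ c) e′))))
          where
          norm′ : g ℕ.* g ℕ.* M ≡ N
          norm′ = ℕ.*-cancelˡ-≡ _ _ Q (trans (sym (e₁ g Q M)) norm)

    -- If p divides g, dividing g by p lowers the exponent of p in the norm by 2; this needs
    -- exponent at least 2. The remaining ideals contribute `rootCount` times K.
    idealCount : ℕ → ℕ
    idealCount 0             = rootCount 0 ℕ.* K
    idealCount 1             = rootCount 1 ℕ.* K
    idealCount (suc (suc k)) = idealCount k ℕ.+ rootCount (suc (suc k)) ℕ.* K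

    private
      DivisibleByP : ℕ → ℕ × ℕ × ℕ → Set
      DivisibleByP k (g , M , c) = IdealOfNorm (p ^ suc (suc k) ℕ.* N) (g , M , c) × (p ℕ.∣ g)

      e₂ : ∀ p g M → p ℕ.* g ℕ.* (p ℕ.* g) ℕ.* M ≡ p ℕ.* (p ℕ.* (g ℕ.* g ℕ.* M))
      e₂ = ℕ.solve-∀

      e₃ : ∀ p Q N → p ℕ.* (p ℕ.* (Q ℕ.* N)) ≡ p ℕ.* (p ℕ.* Q) ℕ.* N
      e₃ = ℕ.solve-∀

      multiply : ∀ k → Enum (IdealOfNorm (p ^ k ℕ.* N)) (idealCount k) → Enum (DivisibleByP k) (idealCount k)
      multiply k = enum-bijection R forth back left right
        where
        R : ℕ × ℕ × ℕ → ℕ × ℕ × ℕ → Set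
        R (g , M , c) (g′ , M′ , c′) = (g′ ≡ p ℕ.* g) × (M ≡ M′) × (c ≡ c′)
        forth : ∀ a → IdealOfNorm (p ^ k ℕ.* N) a → ∃ λ b → DivisibleByP k b × R a b
        forth (g , M , c) (norm , root) = (p ℕ.* g , M , c) ,
          ((trans (e₂ p g M) (trans (cong (λ z → p ℕ.* (p ℕ.* z)) norm) (e₃ p (p ^ k) N)) , root) , ℕ.m∣m*n g) , refl , refl , refl
        back : ∀ b → DivisibleByP k b → ∃ λ a → IdealOfNorm (p ^ k ℕ.* N) a × R a b
        back (g′ , M , c) ((norm , root) , ℕ.divides g g′≡gp) = (g , M , c) ,
          (ℕ.*-cancelˡ-≡ _ _ p (ℕ.*-cancelˡ-≡ _ _ p (trans (sym (e₂ p g M))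
            (trans (cong (λ z → z ℕ.* z ℕ.* M) (trans (ℕ.*-comm p g) (sym g′≡gp))) (trans norm (sym (e₃ p (p ^ k) N)))))) , root) ,
          trans g′≡gp (ℕ.*-comm g p) , refl , refl
        left : ∀ a a′ b → IdealOfNorm (p ^ k ℕ.* N) a → IdealOfNorm (p ^ k ℕ.* N) a′ → R a b → R a′ b → a ≡ a′
        left (g , M , c) (g′ , _ , _) _ _ _ (refl , refl , refl) (eq , refl , refl) = cong (λ z → z , M , c) (ℕ.*-cancelˡ-≡ g g′ p eq)
        right : ∀ a b b′ → DivisibleByP k b → DivisibleByP k b′ → R a b → R a b′ → b ≡ b′
        right _ _ _ _ _ (refl , refl , refl) (refl , refl , refl) = refl

      p∣g⇒ : ∀ k g M → g ℕ.* g ℕ.* M ≡ p ^ k ℕ.* N → p ℕ.∣ g → ¬ (k ℕ.< 2)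
      p∣g⇒ 0 g M norm p∣g _ = p∤N (ℕ.∣-trans p∣g (g∣N {g} {M} (trans norm (ℕ.*-identityˡ N))))
      p∣g⇒ 1 g M norm (ℕ.divides h g≡hp) _ = p∤N (ℕ.divides (h ℕ.* h ℕ.* M) (ℕ.*-cancelˡ-≡ _ _ p
        (trans (cong (ℕ._* N) (sym (ℕ.*-identityʳ p))) (trans (sym norm) (trans (cong (λ z → z ℕ.* z ℕ.* M) g≡hp) (e h p M))))))
        where
        e : ∀ h p M → h ℕ.* p ℕ.* (h ℕ.* p) ℕ.* M ≡ p ℕ.* (h ℕ.* h ℕ.* M ℕ.* p)
        e = ℕ.solve-∀
      p∣g⇒ (suc (suc _)) g M norm p∣g (ℕ.s≤s (ℕ.s≤s ()))

      all-primitive : ∀ k → k ℕ.< 2 → Enum (PrimitiveAtP k) (rootCount k ℕ.* K) → Enum (IdealOfNorm (p ^ k ℕ.* N)) (rootCount k ℕ.* K)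
      all-primitive k k<2 = enum-cong (λ _ → proj₁) (λ { (g , M , c) v@(norm , _) → v , λ p∣g → p∣g⇒ k g M norm p∣g k<2 })

    enum-ideals-p^ : ∀ k → Enum (IdealOfNorm (p ^ k ℕ.* N)) (idealCount k)
    enum-ideals-p^ 0 = all-primitive 0 (ℕ.s≤s ℕ.z≤n) (enum-primitive 0)
    enum-ideals-p^ 1 = all-primitive 1 (ℕ.s≤s (ℕ.s≤s ℕ.z≤n)) (enum-primitive 1)
    enum-ideals-p^ (suc (suc k)) = enum-cong to from
      (enum-⊎ (multiply k (enum-ideals-p^ k)) (enum-primitive (suc (suc k))) (λ { _ (_ , p∣g) (_ , p∤g) → p∤g p∣g }))
      where
      to : ∀ a → DivisibleByP k a ⊎ PrimitiveAtP (suc (suc k)) a → IdealOfNorm (p ^ suc (suc k) ℕ.* N) a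
      to _ (inj₁ (v , _)) = v
      to _ (inj₂ (v , _)) = v
      from : ∀ a → IdealOfNorm (p ^ suc (suc k) ℕ.* N) a → DivisibleByP k a ⊎ PrimitiveAtP (suc (suc k)) a
      from (g , _) v with p ℕ.∣? g
      ... | yes p∣g = inj₁ (v , p∣g)
      ... | no p∤g  = inj₂ (v , p∤g)

-- Roots of z² + z + 1 modulo a prime, through actions of order 3.

module CubeRootsOfUnity where

  open import Defs using (iter)
  open Enumerations
  open OrbitCounting
  open EulerFormula using (exactPeriod-3)
  open IdealsOfNorm
  open EisensteinIdeals using (F; residue-unique; n∣a-a%n; ∣-resp)
  open import Data.Nat as ℕ using (ℕ; suc; _^_; z≤n; s≤s)
  import Data.Nat.Properties as ℕ
  import Data.Nat.Divisibility as ℕ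
  import Data.Nat.DivMod as ℕ
  open import Data.Nat.Primality using (Prime; euclidsLemma; ¬prime[0]; ¬prime[1])
  open import Data.Integer using (ℤ; +_; _+_; _*_; -_; _-_; 0ℤ; 1ℤ) renaming (∣_∣ to abs)
  open import Data.Integer.Properties using (abs-*)
  open import Data.Integer.DivMod using (_%ℕ_; n%ℕd<d)
  open import Data.Integer.Divisibility.Signed using (_∣_; divides; ∣⇒∣ᵤ; ∣ᵤ⇒∣; ∣m⇒∣m*n; ∣m⇒∣-m; ∣m∣n⇒∣m+n; ∣m∣n⇒∣m-n; ∣n⇒∣m*n; ∣-refl)
  open import Data.Integer.Tactic.RingSolver using (solve-∀)
  open import Data.Fin using (Fin; toℕ; fromℕ<; inject₁) renaming (zero to fzero; suc to fsuc)
  open import Data.Fin.Properties using (any?; toℕ<n; toℕ-fromℕ<; toℕ-injective; toℕ-inject₁; suc-injective; inject₁-injective) renaming (_≟_ to _≟ᶠ_)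
  open import Data.Product using (∃; _×_; _,_; proj₁; proj₂)
  open import Data.Sum using (_⊎_; inj₁; inj₂)
  open import Function using (_∘_)
  open import Relation.Nullary using (¬_; Dec; yes; no; contradiction; _×-dec_; ¬?)
  open import Relation.Unary using (Decidable)
  open import Relation.Binary.PropositionalEquality using (_≡_; _≢_; refl; sym; trans; cong; subst; module ≡-Reasoning)

  module _ {p} (pp : Prime p) where

    euclidℤ : ∀ x y → + p ∣ x * y → + p ∣ x ⊎ + p ∣ y
    euclidℤ x y d with euclidsLemma (abs x) (abs y) pp (subst (p ℕ.∣_) (abs-* x y) (∣⇒∣ᵤ d))
    ... | inj₁ d′ = inj₁ (∣ᵤ⇒∣ d′)
    ... | inj₂ d′ = inj₂ (∣ᵤ⇒∣ d′)

    p^k∣x*y⇒p^k∣yℤ : ∀ k x y → ¬ (+ p ∣ x) → + (p ^ k) ∣ x * y → + (p ^ k) ∣ y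
    p^k∣x*y⇒p^k∣yℤ k x y p∤x d = ∣ᵤ⇒∣ (p^k∣x*y⇒p^k∣y pp k (abs x) (abs y) (p∤x ∘ ∣ᵤ⇒∣) (subst (p ^ k ℕ.∣_) (abs-* x y) (∣⇒∣ᵤ d)))

    p∤1 : ¬ (+ p ∣ 1ℤ)
    p∤1 d = contradiction (subst Prime (ℕ.∣1⇒≡1 (∣⇒∣ᵤ d)) pp) ¬prime[1]

    p∣3⇒p≡3 : + p ∣ + 3 → p ≡ 3
    p∣3⇒p≡3 d = cases p (∣⇒∣ᵤ d) pp
      where
      cases : ∀ p → p ℕ.∣ 3 → Prime p → p ≡ 3
      cases 0 d pp = contradiction pp ¬prime[0]
      cases 1 d pp = contradiction pp ¬prime[1]
      cases 2 d pp = contradiction d λ { (ℕ.divides 0 ()) ; (ℕ.divides 1 ()) ; (ℕ.divides (suc (suc _)) ()) }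
      cases 3 d pp = refl
      cases (suc (suc (suc (suc p)))) d pp = contradiction d (ℕ.>⇒∤ (s≤s (s≤s (s≤s (s≤s z≤n)))))

  -- A primitive cube root of unity modulo q acts freely on the q − 1 nonzero residues.
  module _ {q} (pq : Prime (suc q)) (q%3 : suc q ℕ.% 3 ≡ 2) where
    private
      Q = suc q

      module _ (r : ℤ) (Q∣Fr : + Q ∣ F r) where
        π : Fin Q → Fin Q
        π y = fromℕ< (n%ℕd<d (r * + toℕ y) Q)

        π≡ : ∀ y → + Q ∣ + toℕ (π y) - r * + toℕ y
        π≡ y = subst (λ z → + Q ∣ + z - r * + toℕ y) (sym (toℕ-fromℕ< (n%ℕd<d (r * + toℕ y) Q)))
                 (congruent-sym (r * + toℕ y) _ (n∣a-a%n (r * + toℕ y) Q))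

        -- The congruences telescope to multiplication by r³, and r³ - 1 = (r - 1) F(r).
        π³ : ∀ y → iter π 3 y ≡ y
        π³ y = toℕ-injective (residue-unique (toℕ<n (iter π 3 y)) (toℕ<n y)
          (∣-resp (e (+ toℕ y) (+ toℕ (π y)) (+ toℕ (π (π y))) (+ toℕ (iter π 3 y)) r)
            (∣m∣n⇒∣m+n (∣m∣n⇒∣m+n (π≡ (π (π y))) (∣n⇒∣m*n r (π≡ (π y))))
              (∣m∣n⇒∣m+n (∣n⇒∣m*n (r * r) (π≡ y)) (∣n⇒∣m*n ((r - 1ℤ) * + toℕ y) Q∣Fr)))))
          where
          e : ∀ y y₁ y₂ y₃ r → (y₃ - r * y₂) + r * (y₂ - r * y₁) + (r * r * (y₁ - r * y) + (r - 1ℤ) * y * (r * r + r + 1ℤ)) ≡ y₃ - y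
          e = solve-∀

        P? : Decidable (λ (y : Fin Q) → y ≢ fzero)
        P? y = ¬? (y ≟ᶠ fzero)

        π0 : π fzero ≡ fzero
        π0 = toℕ-injective (residue-unique (toℕ<n (π fzero)) (s≤s z≤n) (∣-resp (e (+ toℕ (π fzero)) r) (π≡ fzero)))
          where
          e : ∀ z r → z - r * 0ℤ ≡ z - 0ℤ
          e = solve-∀

        closed : ∀ y → y ≢ fzero → π y ≢ fzero
        closed y y≢0 πy≡0 = y≢0 (trans (sym (π³ y)) (trans (cong (π ∘ π) πy≡0) (trans (cong π π0) π0)))

        -- A fixed nonzero residue forces r ≡ 1, so the prime divides F(1) = 3, against its
        -- remainder 2 modulo 3.
        nofix : ∀ y → y ≢ fzero → π y ≢ y
        nofix y y≢0 eq = go (euclidℤ pq (r - 1ℤ) (+ toℕ y)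
            (∣-resp (e r (+ toℕ y)) (∣m⇒∣-m (subst (λ z → + Q ∣ + toℕ z - r * + toℕ y) eq (π≡ y)))))
          where
          e : ∀ r y → - (y - r * y) ≡ (r - 1ℤ) * y
          e = solve-∀
          e₁ : ∀ y → y ≡ y - 0ℤ
          e₁ = solve-∀
          e₂ : ∀ r → (r * r + r + 1ℤ) - (r - 1ℤ) * (r + + 2) ≡ + 3
          e₂ = solve-∀
          go : ¬ (+ Q ∣ r - 1ℤ ⊎ + Q ∣ + toℕ y)
          go (inj₂ Q∣y) = y≢0 (toℕ-injective (residue-unique (toℕ<n y) (s≤s z≤n) (∣-resp (e₁ (+ toℕ y)) Q∣y)))
          go (inj₁ Q∣r-1) = contradiction (trans (sym q%3) (cong (ℕ._% 3) (p∣3⇒p≡3 pq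
            (∣-resp (e₂ r) (∣m∣n⇒∣m-n Q∣Fr (∣m⇒∣m*n (r + + 2) Q∣r-1)))))) λ ()

        count≡q : count P? ≡ q
        count≡q = count-injective-image P? fsuc suc-injective (λ i ()) (λ { fzero y≢0 → contradiction refl y≢0 ; (fsuc i) _ → i , refl })

    noRoot : ∀ r → ¬ (+ suc q ∣ F r)
    noRoot r Q∣Fr = absurd (count-free (π r Q∣Fr) {2} (π³ r Q∣Fr) (P? r Q∣Fr) (closed r Q∣Fr)
        (λ y y≢0 → exactPeriod-3 (π³ r Q∣Fr y) (nofix r Q∣Fr y y≢0)))
      where
      absurd : ¬ (∃ λ c → count (P? r Q∣Fr) ≡ 3 ℕ.* c)
      absurd (c , eq) = contradiction (trans (sym q%3) (trans (cong (λ z → suc z ℕ.% 3) (trans (sym (count≡q r Q∣Fr)) (trans eq (ℕ.*-comm 3 c)))) (ℕ.[m+kn]%n≡m%n 1 c 3))) λ ()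

  -- x ↦ −1 / (1 + x) permutes the p − 2 residues other than 0 and −1 in cycles of length 3, except for its
  -- fixed points, which are the roots of x² + x + 1.
  module _ {m} (pp : Prime (suc (suc m))) (p%3 : suc (suc m) ℕ.% 3 ≡ 1) where
    private
      p = suc (suc m)

      Good : Fin p → Set
      Good x = (toℕ x ≢ 0) × (toℕ x ≢ suc m)

      good? : Decidable Good
      good? x = ¬? (toℕ x ℕ.≟ 0) ×-dec ¬? (toℕ x ℕ.≟ suc m)

      p∤x : ∀ x → Good x → ¬ (+ p ∣ + toℕ x)
      p∤x x (x≢0 , _) d = x≢0 (residue-unique (toℕ<n x) (s≤s z≤n) (∣-resp (e (+ toℕ x)) d))
        where
        e : ∀ y → y ≡ y - 0ℤ
        e = solve-∀

      p∤1+x : ∀ x → Good x → ¬ (+ p ∣ 1ℤ + + toℕ x)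
      p∤1+x x (_ , x≢-1) d = x≢-1 (residue-unique (toℕ<n x) ℕ.≤-refl (∣-resp (e (+ toℕ x) (+ suc m)) (∣m∣n⇒∣m-n d ∣-refl)))
        where
        e : ∀ x m → (1ℤ + x) - (1ℤ + m) ≡ x - m
        e = solve-∀

      good : ∀ x → ¬ (+ p ∣ + toℕ x) → ¬ (+ p ∣ 1ℤ + + toℕ x) → Good x
      good x p∤x p∤1+x = (λ eq → p∤x (∣-resp (cong +_ (sym eq)) (divides 0ℤ refl))) , (λ eq → p∤1+x (∣-resp (cong (λ z → 1ℤ + + z) (sym eq)) ∣-refl))

      Image : Fin p → Fin p → Set
      Image x y = + p ∣ + toℕ y * (1ℤ + + toℕ x) + 1ℤ

      image : ∀ x → Good x → ∃ (Image x)
      image x gx = finish (coprime⇒Bezout (prime∤⇒coprime pp (λ d → p∤1+x x gx (∣ᵤ⇒∣ d))))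
        where
        finish : Bezout p (suc (toℕ x)) → ∃ (Image x)
        finish (u , v , eq) = fromℕ< (n%ℕd<d (- v) p) ,
          subst (λ z → + p ∣ + z * (1ℤ + + toℕ x) + 1ℤ) (sym (toℕ-fromℕ< (n%ℕd<d (- v) p)))
            (∣-resp (trans (cong (λ w → (+ (- v %ℕ p) - - v) * (1ℤ + + toℕ x) + u * + p + (1ℤ - w)) (sym eq)) (e u v (+ p) (1ℤ + + toℕ x) (+ (- v %ℕ p))))
              (∣m∣n⇒∣m+n (∣m∣n⇒∣m+n (∣m⇒∣m*n (1ℤ + + toℕ x) (congruent-sym (- v) _ (n∣a-a%n (- v) p))) (∣n⇒∣m*n u ∣-refl)) (divides 0ℤ refl)))
          where
          e : ∀ u v p y z → (z - - v) * y + u * p + (1ℤ - (u * p + v * y)) ≡ z * y + 1ℤ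
          e = solve-∀

      image-unique : ∀ x y y′ → Good x → Image x y → Image x y′ → y ≡ y′
      image-unique x y y′ gx d d′ = go (euclidℤ pp (+ toℕ y - + toℕ y′) (1ℤ + + toℕ x)
          (∣-resp (e (+ toℕ y) (+ toℕ y′) (1ℤ + + toℕ x)) (∣m∣n⇒∣m-n d d′)))
        where
        e : ∀ y y′ x → (y * x + 1ℤ) - (y′ * x + 1ℤ) ≡ (y - y′) * x
        e = solve-∀
        go : + p ∣ + toℕ y - + toℕ y′ ⊎ + p ∣ 1ℤ + + toℕ x → y ≡ y′
        go (inj₁ y≡y′)  = toℕ-injective (residue-unique (toℕ<n y) (toℕ<n y′) y≡y′)
        go (inj₂ p∣1+x) = contradiction p∣1+x (p∤1+x x gx)

      image-good : ∀ x y → Good x → Image x y → Good y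
      image-good x y gx d = good y
        (λ p∣y → p∤1 pp (∣-resp (e₁ (+ toℕ y) (1ℤ + + toℕ x)) (∣m∣n⇒∣m-n d (∣m⇒∣m*n (1ℤ + + toℕ x) p∣y))))
        (λ p∣1+y → p∤x x gx (∣-resp (e₂ (+ toℕ y) (+ toℕ x)) (∣m∣n⇒∣m-n (∣m⇒∣m*n (1ℤ + + toℕ x) p∣1+y) d)))
        where
        e₁ : ∀ y x → (y * x + 1ℤ) - y * x ≡ 1ℤ
        e₁ = solve-∀
        e₂ : ∀ y x → (1ℤ + y) * (1ℤ + x) - (y * (1ℤ + x) + 1ℤ) ≡ x
        e₂ = solve-∀

      -- Adding x times the second congruence to the first gives 1 + y times the third, and 1 + y is
      -- invertible.
      image-cycle : ∀ x y z → Good y → Image x y → Image y z → Image z x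
      image-cycle x y z gy d d′ = go (euclidℤ pp (1ℤ + + toℕ y) (+ toℕ x * (1ℤ + + toℕ z) + 1ℤ)
          (∣-resp (e (+ toℕ x) (+ toℕ y) (+ toℕ z)) (∣m∣n⇒∣m+n d (∣n⇒∣m*n (+ toℕ x) d′))))
        where
        e : ∀ x y z → (y * (1ℤ + x) + 1ℤ) + x * (z * (1ℤ + y) + 1ℤ) ≡ (1ℤ + y) * (x * (1ℤ + z) + 1ℤ)
        e = solve-∀
        go : + p ∣ 1ℤ + + toℕ y ⊎ Image z x → Image z x
        go (inj₁ p∣1+y) = contradiction p∣1+y (p∤1+x y gy)
        go (inj₂ d″)    = d″

      step : ∀ x → Dec (Good x) → Fin p
      step x (yes gx) = proj₁ (image x gx)
      step x (no _)   = x

      π : Fin p → Fin p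
      π x = step x (good? x)

      π-image : ∀ x → Good x → Image x (π x)
      π-image x gx = go (good? x)
        where
        go : ∀ g → Image x (step x g)
        go (yes gx′) = proj₂ (image x gx′)
        go (no ¬gx)  = contradiction gx ¬gx

      π-bad : ∀ x → ¬ Good x → π x ≡ x
      π-bad x ¬gx = go (good? x)
        where
        go : ∀ g → step x g ≡ x
        go (yes gx) = contradiction gx ¬gx
        go (no _)   = refl

      π-good : ∀ x → Good x → Good (π x)
      π-good x gx = image-good x (π x) gx (π-image x gx)

      π³ : ∀ x → iter π 3 x ≡ x
      π³ x = go (good? x)
        where
        go : Dec (Good x) → iter π 3 x ≡ x
        go (no ¬gx) = trans (cong (π ∘ π) (π-bad x ¬gx)) (trans (cong π (π-bad x ¬gx)) (π-bad x ¬gx))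
        go (yes gx) = image-unique (π (π x)) (iter π 3 x) x (π-good (π x) (π-good x gx)) (π-image (π (π x)) (π-good (π x) (π-good x gx)))
          (image-cycle x (π x) (π (π x)) (π-good x gx) (π-image x gx) (π-image (π x) (π-good x gx)))

      count≡m : count good? ≡ m
      count≡m = count-injective-image good? (λ i → fsuc (inject₁ i)) (λ eq → inject₁-injective (suc-injective eq))
        (λ i → (λ ()) , λ eq → contradiction (trans (sym (toℕ-inject₁ i)) (ℕ.suc-injective eq)) (ℕ.<⇒≢ (toℕ<n i)))
        (λ { fzero (≢0 , _) → contradiction refl ≢0
           ; (fsuc i) (_ , ≢) → let i<m = ℕ.≤∧≢⇒< (ℕ.≤-pred (toℕ<n i)) (λ eq → ≢ (cong suc eq)) in
               fromℕ< i<m , cong fsuc (toℕ-injective (trans (toℕ-inject₁ (fromℕ< i<m)) (toℕ-fromℕ< i<m))) })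

    rootExists : ∃ λ r → + suc (suc m) ∣ F r
    rootExists = search (any? (λ x → good? x ×-dec (π x ≟ᶠ x)))
      where
      search : Dec (∃ λ x → Good x × π x ≡ x) → ∃ λ r → + p ∣ F r
      search (yes (x , gx , eq)) = + toℕ x , ∣-resp (e (+ toℕ x)) (subst (Image x) eq (π-image x gx))
        where
        e : ∀ x → x * (1ℤ + x) + 1ℤ ≡ x * x + x + 1ℤ
        e = solve-∀
      -- With no fixed point among the good residues, 3 would divide p - 2, against p ≡ 1 modulo 3.
      search (no none) = contradiction (count-free π {2} π³ good? π-good (λ x gx → exactPeriod-3 (π³ x) (λ eq → none (x , gx , eq)))) absurd
        where
        absurd : ¬ (∃ λ c → count good? ≡ 3 ℕ.* c)
        absurd (c , eq) = contradiction (trans (sym p%3) (trans (cong (λ z → suc (suc z) ℕ.% 3) (trans (sym count≡m) (trans eq (ℕ.*-comm 3 c)))) (ℕ.[m+kn]%n≡m%n 2 c 3))) λ ()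

-- Local factors at split, inert and ramified primes.

module IdealCounts where

  open Enumerations
  open IdealsOfNorm
  open CubeRootsOfUnity
  open EisensteinIdeals using (F; residue-unique; n∣a-a%n; ∣-resp)
  open import Data.Nat as ℕ using (ℕ; zero; suc; NonZero; _^_; z≤n; s≤s)
  import Data.Nat.Properties as ℕ
  import Data.Nat.Divisibility as ℕ
  import Data.Nat.DivMod as ℕ
  import Data.Nat.Tactic.RingSolver as ℕ
  open import Data.Nat.Primality using (Prime; prime⇒nonZero; prime?; ¬prime[0]; ¬prime[1])
  open import Data.Integer using (+_; _+_; _*_; -_; _-_; 0ℤ; 1ℤ)
  open import Data.Integer.Properties using (pos-*; pos-+)
  open import Data.Integer.DivMod using (_%ℕ_; _/ℕ_; n%ℕd<d; a≡a%ℕn+[a/ℕn]*n)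
  open import Data.Integer.Divisibility.Signed using (_∣_; _∣?_; divides; ∣⇒∣ᵤ; ∣ᵤ⇒∣; ∣-trans; ∣m⇒∣m*n; ∣m⇒∣-m; ∣m∣n⇒∣m+n; ∣m∣n⇒∣m-n; ∣n⇒∣m*n; ∣-refl)
  open import Data.Integer.Tactic.RingSolver using (solve-∀)
  open import Data.Product using (∃; _,_; proj₁; proj₂)
  open import Data.Sum using (_⊎_; inj₁; inj₂)
  open import Relation.Nullary using (¬_; Dec; yes; no; contradiction)
  open import Relation.Nullary.Decidable using (toWitness)
  open import Relation.Binary.PropositionalEquality using (_≡_; _≢_; refl; sym; trans; cong; subst; module ≡-Reasoning)

  enum-root-1 : Enum (Root 1) 1
  enum-root-1 = enum-singleton 0 (s≤s z≤n , divides (F 0ℤ) refl) (λ { zero _ → refl ; (suc _) (s≤s () , _) })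

  p∣p^1+k : ∀ p k → + p ∣ + (p ^ suc k)
  p∣p^1+k p k = ∣ᵤ⇒∣ (ℕ.m∣m*n (p ^ k))

  ∣-*-∣ : ∀ {a b x y} → a ∣ x → b ∣ y → a * b ∣ x * y
  ∣-*-∣ {a} {b} (divides q refl) (divides q′ refl) = divides (q * q′) (e q a q′ b)
    where
    e : ∀ q a q′ b → q * a * (q′ * b) ≡ q * q′ * (a * b)
    e = solve-∀

  module _ {p} (pp : Prime p) (p%3≡1 : p ℕ.% 3 ≡ 1) where
    private
      instance
        p≢0 : NonZero p
        p≢0 = prime⇒nonZero pp

      a = p ℕ./ 3

      p≡1+3a : + p ≡ 1ℤ + + a * + 3
      p≡1+3a = trans (cong +_ (trans (ℕ.m≡m%n+[m/n]*n p 3) (cong (ℕ._+ a ℕ.* 3) p%3≡1))) (trans (pos-+ 1 (a ℕ.* 3)) (cong (λ z → 1ℤ + z) (pos-* a 3)))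

      root-mod-p : ∃ λ r → + p ∣ F r
      root-mod-p = go p pp p%3≡1
        where
        go : ∀ p → Prime p → p ℕ.% 3 ≡ 1 → ∃ λ r → + p ∣ F r
        go 0 pp _ = contradiction pp ¬prime[0]
        go 1 pp _ = contradiction pp ¬prime[1]
        go (suc (suc m)) pp eq = rootExists pp eq

      -- Newton's step; since (2r + 1)² ≡ −3 and −3 a ≡ 1, the inverse of F′(r) = 2r + 1 is (2r + 1) a.
      hensel : ∀ k → ∃ λ r → + (p ^ suc k) ∣ F r
      hensel zero    = proj₁ root-mod-p , subst (λ z → + z ∣ F (proj₁ root-mod-p)) (sym (ℕ.*-identityʳ p)) (proj₂ root-mod-p)
      hensel (suc k) = lift (hensel k)
        where
        lift : (∃ λ r → + (p ^ suc k) ∣ F r) → ∃ λ r → + (p ^ suc (suc k)) ∣ F r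
        lift (r , d) = r - F r * (+ 2 * r + 1ℤ) * + a ,
          ∣-resp (trans (cong (λ z → z * F r + F r * F r * (+ a * + a * (+ 2 * r + 1ℤ) * (+ 2 * r + 1ℤ) - + 4 * + a)) p≡1+3a) (e r (+ a)))
            (subst (_∣ + p * F r + F r * F r * (+ a * + a * (+ 2 * r + 1ℤ) * (+ 2 * r + 1ℤ) - + 4 * + a)) (sym (pos-* p (p ^ suc k)))
              (∣m∣n⇒∣m+n (∣-*-∣ {+ p} {+ (p ^ suc k)} {+ p} {F r} ∣-refl d) (∣m⇒∣m*n (+ a * + a * (+ 2 * r + 1ℤ) * (+ 2 * r + 1ℤ) - + 4 * + a) (∣-*-∣ {+ p} {+ (p ^ suc k)} {F r} {F r} (∣-trans (p∣p^1+k p k) d) d))))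
          where
          e : ∀ r a → (1ℤ + a * + 3) * (r * r + r + 1ℤ) + (r * r + r + 1ℤ) * (r * r + r + 1ℤ) * (a * a * (+ 2 * r + 1ℤ) * (+ 2 * r + 1ℤ) - + 4 * a)
                ≡ (r - (r * r + r + 1ℤ) * (+ 2 * r + 1ℤ) * a) * (r - (r * r + r + 1ℤ) * (+ 2 * r + 1ℤ) * a) + (r - (r * r + r + 1ℤ) * (+ 2 * r + 1ℤ) * a) + 1ℤ
          e = solve-∀

      module _ (k : ℕ) where
        Q = p ^ suc k
        instance
          Q≢0 : NonZero Q
          Q≢0 = ℕ.m^n≢0 p (suc k)

        root : ∀ r → + Q ∣ F r → Root Q (r %ℕ Q)
        root r d = n%ℕd<d r Q , F-cong (+ (r %ℕ Q)) r (congruent-sym r (+ (r %ℕ Q)) (n∣a-a%n r Q)) d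

        c₁ = proj₁ (hensel k) %ℕ Q

        root₁ : Root Q c₁
        root₁ = root (proj₁ (hensel k)) (proj₂ (hensel k))

        -- The two roots of z² + z + 1 add up to -1.
        c₂ = (- 1ℤ - + c₁) %ℕ Q

        root₂ : Root Q c₂
        root₂ = root (- 1ℤ - + c₁) (∣-resp (e (+ c₁)) (proj₂ root₁))
          where
          e : ∀ c → c * c + c + 1ℤ ≡ (- 1ℤ - c) * (- 1ℤ - c) + (- 1ℤ - c) + 1ℤ
          e = solve-∀

        -- The discriminant is -3: (2c + 1)² = 4 F(c) - 3, so p would divide 3.
        p∤2c+1 : ¬ (+ p ∣ + 2 * + c₁ + 1ℤ)
        p∤2c+1 d = contradiction (trans (sym p%3≡1) (cong (ℕ._% 3) (p∣3⇒p≡3 pp (∣-resp (e (+ c₁))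
          (∣m∣n⇒∣m-n (∣n⇒∣m*n (+ 4) (∣-trans (p∣p^1+k p k) (proj₂ root₁))) (∣m⇒∣m*n (+ 2 * + c₁ + 1ℤ) d)))))) λ ()
          where
          e : ∀ c → + 4 * (c * c + c + 1ℤ) - (+ 2 * c + 1ℤ) * (+ 2 * c + 1ℤ) ≡ + 3
          e = solve-∀

        c₁≢c₂ : c₁ ≢ c₂
        c₁≢c₂ eq = p∤2c+1 (∣-resp (e (+ c₁)) (∣m⇒∣-m (∣-trans (p∣p^1+k p k)
          (subst (λ z → + Q ∣ (- 1ℤ - + c₁) - + z) (sym eq) (n∣a-a%n (- 1ℤ - + c₁) Q)))))
          where
          e : ∀ c → - ((- 1ℤ - c) - c) ≡ + 2 * c + 1ℤ
          e = solve-∀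

        -- The product (b - c₁)(b + c₁ + 1) vanishes modulo the prime power. The factors differ by
        -- 2c₁ + 1, so p divides at most one of them, and that one absorbs the whole power.
        twoRoots : ∀ b → Root Q b → (c₁ ≡ b) ⊎ (c₂ ≡ b)
        twoRoots b (b<Q , Q∣Fb) = go (+ p ∣? + b - + c₁)
          where
          e₁ : ∀ b c → (b * b + b + 1ℤ) - (c * c + c + 1ℤ) ≡ (b - c) * (b + c + 1ℤ)
          e₁ = solve-∀
          e₂ : ∀ b c → (b - c) * (b + c + 1ℤ) ≡ (b + c + 1ℤ) * (b - c)
          e₂ = solve-∀
          e₃ : ∀ b c → (b + c + 1ℤ) - (b - c) ≡ + 2 * c + 1ℤ
          e₃ = solve-∀
          e₄ : ∀ b c c₂ → - ((- 1ℤ - c) - c₂) - (b + c + 1ℤ) ≡ c₂ - b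
          e₄ = solve-∀
          product : + Q ∣ (+ b - + c₁) * (+ b + + c₁ + 1ℤ)
          product = ∣-resp (e₁ (+ b) (+ c₁)) (∣m∣n⇒∣m-n Q∣Fb (proj₂ root₁))
          go : Dec (+ p ∣ + b - + c₁) → (c₁ ≡ b) ⊎ (c₂ ≡ b)
          go (yes p∣b-c) = inj₁ (sym (residue-unique b<Q (proj₁ root₁)
            (p^k∣x*y⇒p^k∣yℤ pp (suc k) (+ b + + c₁ + 1ℤ) (+ b - + c₁) (λ d → p∤2c+1 (∣-resp (e₃ (+ b) (+ c₁)) (∣m∣n⇒∣m-n d p∣b-c)))
              (∣-resp (e₂ (+ b) (+ c₁)) product))))
          go (no p∤b-c) = inj₂ (residue-unique (proj₁ root₂) b<Q (∣-resp (e₄ (+ b) (+ c₁) (+ c₂))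
            (∣m∣n⇒∣m-n (∣m⇒∣-m (n∣a-a%n (- 1ℤ - + c₁) Q)) (p^k∣x*y⇒p^k∣yℤ pp (suc k) (+ b - + c₁) (+ b + + c₁ + 1ℤ) p∤b-c product))))

        enum-two-roots : Enum (Root (p ^ suc k)) 2
        enum-two-roots = enum-cong (λ { _ (inj₁ refl) → root₁ ; _ (inj₂ refl) → root₂ }) twoRoots
          (enum-⊎ (enum-singleton c₁ refl (λ _ eq → eq)) (enum-singleton c₂ refl (λ _ eq → eq))
            (λ _ eq eq′ → c₁≢c₂ (trans eq (sym eq′))))

      rootCount : ℕ → ℕ
      rootCount zero    = 1
      rootCount (suc _) = 2

      enum-roots : ∀ k → Enum (Root (p ^ k)) (rootCount k)
      enum-roots zero    = enum-root-1
      enum-roots (suc k) = enum-two-roots k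

    enum-ideals-split : ∀ {N K} → ¬ (p ℕ.∣ N) → Enum (IdealOfNorm N) K → ∀ k → Enum (IdealOfNorm (p ^ k ℕ.* N)) (suc k ℕ.* K)
    enum-ideals-split {N} {K} p∤N E k = subst (Enum _) (total k) (enum-ideals-p^ pp p∤N E enum-roots k)
      where
      -- The recursion starts with K and 2K and adds 2K for every two steps.
      total : ∀ k → idealCount pp p∤N E enum-roots k ≡ suc k ℕ.* K
      total 0 = refl
      total 1 = refl
      total (suc (suc k)) = trans (cong (ℕ._+ (K ℕ.+ (K ℕ.+ 0))) (total k)) (e k K)
        where
        e : ∀ k K → suc k ℕ.* K ℕ.+ (K ℕ.+ (K ℕ.+ 0)) ≡ suc (suc (suc k)) ℕ.* K
        e = ℕ.solve-∀

  -- The local factor of an inert prime q, whose only ideals of q-power norm are the powers of (q),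
  -- of norm q² each.
  evenCount : ℕ → ℕ
  evenCount 0             = 1
  evenCount 1             = 0
  evenCount (suc (suc k)) = evenCount k

  module _ {q} (pq : Prime q) (q%3≡2 : q ℕ.% 3 ≡ 2) where
    private
      no-root : ∀ r → ¬ (+ q ∣ F r)
      no-root = go q pq q%3≡2
        where
        go : ∀ q → Prime q → q ℕ.% 3 ≡ 2 → ∀ r → ¬ (+ q ∣ F r)
        go 0 pq _ = contradiction pq ¬prime[0]
        go (suc q) pq eq = noRoot pq eq

      rootCount : ℕ → ℕ
      rootCount zero    = 1
      rootCount (suc _) = 0

      enum-roots : ∀ k → Enum (Root (q ^ k)) (rootCount k)
      enum-roots zero    = enum-root-1
      enum-roots (suc k) = enum-∅ (λ c (_ , d) → no-root (+ c) (∣-trans (p∣p^1+k q k) d))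

    enum-ideals-inert : ∀ {N K} → ¬ (q ℕ.∣ N) → Enum (IdealOfNorm N) K → ∀ k → Enum (IdealOfNorm (q ^ k ℕ.* N)) (evenCount k ℕ.* K)
    enum-ideals-inert {N} {K} q∤N E k = subst (Enum _) (total k) (enum-ideals-p^ pq q∤N E enum-roots k)
      where
      total : ∀ k → idealCount pq q∤N E enum-roots k ≡ evenCount k ℕ.* K
      total 0 = refl
      total 1 = refl
      total (suc (suc k)) = trans (ℕ.+-identityʳ _) (total k)

  prime[3] : Prime 3
  prime[3] = toWitness {a? = prime? 3} _

  private
    rootCount₃ : ℕ → ℕ
    rootCount₃ 0             = 1
    rootCount₃ 1             = 1
    rootCount₃ (suc (suc _)) = 0

    -- F(x) is 3 modulo 9 when x ≡ 1 modulo 3, and 1 modulo 3 otherwise.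
    no-root-9 : ∀ x → ¬ (+ 9 ∣ F x)
    no-root-9 x d = go (x %ℕ 3) (x /ℕ 3) (n%ℕd<d x 3) (a≡a%ℕn+[a/ℕn]*n x 3) d
      where
      3∣9 : + 3 ∣ + 9
      3∣9 = divides (+ 3) refl
      3∤1 : ¬ (+ 3 ∣ + 1)
      3∤1 d = ℕ.>⇒∤ (s≤s (s≤s z≤n)) (∣⇒∣ᵤ d)
      9∤3 : ¬ (+ 9 ∣ + 3)
      9∤3 d = ℕ.>⇒∤ (s≤s (s≤s (s≤s (s≤s z≤n)))) (∣⇒∣ᵤ d)
      e₀ : ∀ q → (0ℤ + q * + 3) * (0ℤ + q * + 3) + (0ℤ + q * + 3) + 1ℤ - (+ 3 * q * q + q) * + 3 ≡ 1ℤ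
      e₀ = solve-∀
      e₁ : ∀ q → (1ℤ + q * + 3) * (1ℤ + q * + 3) + (1ℤ + q * + 3) + 1ℤ - (q * q + q) * + 9 ≡ + 3
      e₁ = solve-∀
      e₂ : ∀ q → (+ 2 + q * + 3) * (+ 2 + q * + 3) + (+ 2 + q * + 3) + 1ℤ - (+ 3 * q * q + + 5 * q + + 2) * + 3 ≡ 1ℤ
      e₂ = solve-∀
      go : ∀ r q → r ℕ.< 3 → x ≡ + r + q * + 3 → ¬ (+ 9 ∣ F x)
      go 0 q _ refl d = 3∤1 (∣-resp (e₀ q) (∣m∣n⇒∣m-n (∣-trans 3∣9 d) (∣n⇒∣m*n (+ 3 * q * q + q) ∣-refl)))
      go 1 q _ refl d = 9∤3 (∣-resp (e₁ q) (∣m∣n⇒∣m-n d (∣n⇒∣m*n (q * q + q) ∣-refl)))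
      go 2 q _ refl d = 3∤1 (∣-resp (e₂ q) (∣m∣n⇒∣m-n (∣-trans 3∣9 d) (∣n⇒∣m*n (+ 3 * q * q + + 5 * q + + 2) ∣-refl)))
      go (suc (suc (suc _))) q (s≤s (s≤s (s≤s ()))) _ _

    enum-roots₃ : ∀ k → Enum (Root (3 ^ k)) (rootCount₃ k)
    enum-roots₃ 0 = enum-root-1
    enum-roots₃ 1 = enum-singleton 1 (s≤s (s≤s z≤n) , divides 1ℤ refl) λ
      { 0 (_ , d) → contradiction (∣⇒∣ᵤ d) (ℕ.>⇒∤ (s≤s (s≤s z≤n)))
      ; 1 _ → refl
      ; 2 (_ , d) → contradiction (∣⇒∣ᵤ d) 3∤7
      ; (suc (suc (suc _))) (s≤s (s≤s (s≤s ())) , _) }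
      where
      3∤7 : ¬ (3 ℕ.∣ 7)
      3∤7 (ℕ.divides 0 ())
      3∤7 (ℕ.divides 1 ())
      3∤7 (ℕ.divides 2 ())
      3∤7 (ℕ.divides (suc (suc (suc _))) ())
    enum-roots₃ (suc (suc k)) = enum-∅ (λ c (_ , d) → no-root-9 (+ c)
      (∣-trans (∣ᵤ⇒∣ (ℕ.divides (3 ^ k) (trans (sym (ℕ.*-assoc 3 3 (3 ^ k))) (ℕ.*-comm 9 (3 ^ k))))) d))

  -- One root modulo 1 and modulo 3 starts the recursion with K twice; from 9 on there are no roots,
  -- so nothing is added.
  enum-ideals-ramified : ∀ {N K} → ¬ (3 ℕ.∣ N) → Enum (IdealOfNorm N) K → ∀ k → Enum (IdealOfNorm (3 ^ k ℕ.* N)) K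
  enum-ideals-ramified {N} {K} 3∤N E k = subst (Enum _) (total k) (enum-ideals-p^ prime[3] 3∤N E enum-roots₃ k)
    where
    total : ∀ k → idealCount prime[3] 3∤N E enum-roots₃ k ≡ K
    total 0 = ℕ.+-identityʳ K
    total 1 = ℕ.+-identityʳ K
    total (suc (suc k)) = trans (ℕ.+-identityʳ _) (total k)

  enum-ideals-1 : Enum (IdealOfNorm 1) 1
  enum-ideals-1 = enum-singleton (1 , 1 , 0) (refl , s≤s z≤n , divides (F 0ℤ) refl) unique
    where
    unique : ∀ b → IdealOfNorm 1 b → (1 , 1 , 0) ≡ b
    unique (g , M , c) (norm , c<M , _) = go (ℕ.m*n≡1⇒m≡1 g g (ℕ.m*n≡1⇒m≡1 (g ℕ.* g) M norm)) (ℕ.m*n≡1⇒n≡1 (g ℕ.* g) M norm) c<M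
      where
      go : ∀ {g M c} → g ≡ 1 → M ≡ 1 → c ℕ.< M → (1 , 1 , 0) ≡ (g , M , c)
      go refl refl (s≤s z≤n) = refl

-- From ideals to isomorphism classes, and assembly over all primes.

open import Defs
open EisensteinIdeals using (F; Ideal-unique)
open DartCoordinates using (Coordinates; coordinates⇒iso; iso⇒Ideal-⊆)
open IdealTrihexes using (IdealTrihex; idealTrihex; 3*numVertices)
open SymmetricTrihexes using (symmetric⇒coordinates)
open Enumerations
open IdealsOfNorm using (IdealOfNorm)
open IdealCounts
open import Data.Nat using (ℕ; zero; suc; NonZero; ≢-nonZero; ≢-nonZero⁻¹; >-nonZero; _+_; _*_; _^_; _≤_; _<_; _%_; z≤n)
open import Data.Nat.Properties hiding (suc-injective)
open import Data.Nat.Divisibility using (∣1⇒≡1; _∣0) renaming (_∣_ to _∣ℕ_)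
open import Data.Nat.Primality using (Prime; euclidsLemma; prime⇒irreducible; ¬prime[1])
open import Data.Integer using (+_)
open import Data.Integer.Divisibility.Signed using (_∣_)
open import Data.Fin using (Fin) renaming (zero to fzero; suc to fsuc)
open import Data.Fin.Properties using (injective⇒≤; suc-injective)
open import Data.List using (tabulate)
open import Data.List.Properties using (length-tabulate)
open import Data.List.Membership.Propositional using (_∈_)
open import Data.List.Membership.Propositional.Properties using (∈-tabulate⁺; ∈-tabulate⁻)
open import Data.Product using (Σ; ∃; _×_; _,_; proj₁; proj₂)
open import Data.Sum using (inj₁; inj₂)
open import Function using (_∘_)
open import Function.Definitions using (Injective)
open import Relation.Nullary using (¬_; contradiction)
open import Relation.Binary.PropositionalEquality using (_≡_; _≢_; refl; sym; trans; cong; cong₂; subst; subst₂; module ≡-Reasoning)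

Iso-sym : ∀ {n m} {T : Trihex n} {U : Trihex m} → Iso T U → Iso U T
Iso-sym {T = T} {U} h = record
  { to = from ; from = to ; from-to = to-from ; to-from = from-to
  ; pres-σ = λ e → trans (cong (from ∘ σ U) (sym (to-from e))) (trans (cong from (sym (pres-σ (from e)))) (from-to _))
  ; pres-α = λ e → trans (cong (from ∘ α U) (sym (to-from e))) (trans (cong from (sym (pres-α (from e)))) (from-to _)) }
  where open Iso h

Iso-numVertices : ∀ {n m} {T : Trihex n} {U : Trihex m} → Iso T U → numVertices T ≡ numVertices U
Iso-numVertices {n} {m} {T} {U} h = *-cancelˡ-≡ _ _ 3 (trans (3*numVertices T) (trans n≡m (sym (3*numVertices U))))
  where
  open Iso h
  n≡m : n ≡ m
  n≡m = ≤-antisym (injective⇒≤ {f = to} (λ {x} {y} eq → trans (sym (from-to x)) (trans (cong from eq) (from-to y))))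
                  (injective⇒≤ {f = from} (λ {x} {y} eq → trans (sym (to-from x)) (trans (cong to eq) (to-from y))))

Distinct-tabulate : ∀ {K} (f : Fin K → AnyTrihex) → (∀ i j → i ≢ j → ¬ (f i ≅ f j)) → Distinct (tabulate f)
Distinct-tabulate {zero}  f apart = []
Distinct-tabulate {suc K} f apart = head ∷ Distinct-tabulate (f ∘ fsuc) (λ i j i≢j → apart (fsuc i) (fsuc j) (i≢j ∘ suc-injective))
  where
  head : ∀ {u} → u ∈ tabulate (f ∘ fsuc) → ¬ (f fzero ≅ u)
  head u∈ with ∈-tabulate⁻ u∈
  ... | i , refl = apart fzero (fsuc i) λ ()

module _ {N K} .{{_ : NonZero N}} (E : Enum (IdealOfNorm N) K) where
  open Enum E

  private
    g M c : Fin K → ℕ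
    g i = proj₁ (at i)
    M i = proj₁ (proj₂ (at i))
    c i = proj₂ (proj₂ (at i))

    norm : ∀ i → g i * g i * M i ≡ N
    norm i = proj₁ (sound i)

    c<M : ∀ i → c i < M i
    c<M i = proj₁ (proj₂ (sound i))

    instance
      g≢0 : ∀ {i} → NonZero (g i)
      g≢0 {i} = m*n≢0⇒m≢0 (g i) {{m*n≢0⇒m≢0 (g i * g i) {{subst NonZero (sym (norm i)) (≢-nonZero (≢-nonZero⁻¹ N))}}}}
      M≢0 : ∀ {i} → NonZero (M i)
      M≢0 {i} = >-nonZero (≤-<-trans z≤n (c<M i))
      2g≢0 : ∀ {i} → NonZero (2 * g i)
      2g≢0 {i} = m*n≢0 2 (g i)

    rep : ∀ i → IdealTrihex (g i) (M i) (c i)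
    rep i = idealTrihex (proj₂ (proj₂ (sound i)))

    module R i = IdealTrihex (rep i)

    reps : Fin K → AnyTrihex
    reps i = R.n i , R.T i

    same-index : ∀ i j → Iso (R.T i) (R.T j) → i ≡ j
    same-index i j h = injective (triple≡ (Ideal-unique {2 * g i} {M i} {c i} {2 * g j} {M j} {c j} (c<M i) (c<M j)
        (iso⇒Ideal-⊆ (R.T i) (R.T j) (R.coordinates i) (R.coordinates j) h)
        (iso⇒Ideal-⊆ (R.T j) (R.T i) (R.coordinates j) (R.coordinates i) (Iso-sym h))))
      where
      triple≡ : (2 * g i ≡ 2 * g j) × (M i ≡ M j) × (c i ≡ c j) → at i ≡ at j
      triple≡ (2g≡ , M≡ , c≡) = cong₂ _,_ (*-cancelˡ-≡ (g i) (g j) 2 2g≡) (cong₂ _,_ M≡ c≡)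

    represent : ∀ {n} (T : Trihex n) → numVertices T ≡ 4 * N →
      (∃ λ g → ∃ λ M → ∃ λ c → NonZero g × (c < M) × (+ M ∣ F (+ c)) × Coordinates (2 * g) M c (σ T) (α T)) →
      ∃ λ i → Iso T (R.T i)
    represent T V≡ (g₀ , M₀ , c₀ , g₀≢0 , c₀<M₀ , M₀∣Fc₀ , C) = index , coordinates⇒iso T (R.T index) C
        (subst (λ t → Coordinates (2 * proj₁ t) (proj₁ (proj₂ t)) (proj₂ (proj₂ t)) (σ (R.T index)) (α (R.T index))) (proj₂ found) (R.coordinates index))
      where
      instance
        _ = g₀≢0
        _ = >-nonZero (≤-<-trans z≤n c₀<M₀)
      module U = IdealTrihex (idealTrihex {g₀} {M₀} {c₀} M₀∣Fc₀)
      -- The trihex already built from this ideal is isomorphic to `T`, so its known vertex count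
      -- determines the norm.
      norm₀ : g₀ * g₀ * M₀ ≡ N
      norm₀ = *-cancelˡ-≡ _ _ 4 (trans (sym U.vertices) (trans (sym (Iso-numVertices (coordinates⇒iso T U.T C U.coordinates))) V≡))
      found = complete (g₀ , M₀ , c₀) (norm₀ , c₀<M₀ , M₀∣Fc₀)
      index = proj₁ found

  enum-ideals⇒δ : δ≡ (4 * N) K
  enum-ideals⇒δ = tabulate reps , length-tabulate reps , sym-reps , Distinct-tabulate reps (λ i j i≢j h → i≢j (same-index i j h)) , all-reps
    where
    sym-reps : ∀ {t} → t ∈ tabulate reps → SymTrihexV (4 * N) t
    sym-reps t∈ with ∈-tabulate⁻ t∈
    ... | i , refl = trans (R.vertices i) (cong (4 *_) (norm i)) , R.symmetric i
    all-reps : ∀ t → SymTrihexV (4 * N) t → Σ AnyTrihex λ u → (u ∈ tabulate reps) × (t ≅ u)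
    all-reps (n , T) (V≡ , s) = let i , h = represent T V≡ (symmetric⇒coordinates T s) in reps i , ∈-tabulate⁺ i , h

prime∣prime⇒≡ : ∀ {p q} → Prime p → Prime q → p ∣ℕ q → p ≡ q
prime∣prime⇒≡ pp pq d with prime⇒irreducible pq d
... | inj₁ refl = contradiction pp ¬prime[1]
... | inj₂ p≡q  = p≡q

prime∤prime^ : ∀ {p q} → Prime p → Prime q → p ≢ q → ∀ k → ¬ (p ∣ℕ q ^ k)
prime∤prime^ pp pq p≢q zero d = contradiction (subst Prime (∣1⇒≡1 d) pp) ¬prime[1]
prime∤prime^ {p} {q} pp pq p≢q (suc k) d with euclidsLemma q (q ^ k) pp d
... | inj₁ p∣q = p≢q (prime∣prime⇒≡ pp pq p∣q)
... | inj₂ d′  = prime∤prime^ pp pq p≢q k d′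

prime∤prodF : ∀ {p r N} → Prime p → (q k : Fin r → ℕ) → (∀ i → Prime (q i)) → (∀ i → p ≢ q i) → ¬ (p ∣ℕ N) → ¬ (p ∣ℕ prodF (λ i → q i ^ k i) * N)
prime∤prodF {p} {zero}  {N} pp q k pq p≢q p∤N d = p∤N (subst (p ∣ℕ_) (*-identityˡ N) d)
prime∤prodF {p} {suc r} {N} pp q k pq p≢q p∤N d
  with euclidsLemma (q fzero ^ k fzero) (prodF (λ i → q (fsuc i) ^ k (fsuc i)) * N) pp (subst (p ∣ℕ_) (*-assoc (q fzero ^ k fzero) _ N) d)
... | inj₁ d′ = prime∤prime^ pp (pq fzero) (p≢q fzero) (k fzero) d′
... | inj₂ d′ = prime∤prodF pp (q ∘ fsuc) (k ∘ fsuc) (pq ∘ fsuc) (p≢q ∘ fsuc) p∤N d′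

-- `weight` is the local factor, `suc` at split primes and `evenCount` at inert ones. Injectivity of
-- `p` keeps each added prime coprime to the norm assembled so far.
enum-ideals-prodF : ∀ {r N K} (weight : ℕ → ℕ) (p k : Fin r → ℕ) → (∀ i → Prime (p i)) → Injective _≡_ _≡_ p → (∀ i → ¬ (p i ∣ℕ N)) →
  (∀ i {N K} → ¬ (p i ∣ℕ N) → Enum (IdealOfNorm N) K → Enum (IdealOfNorm (p i ^ k i * N)) (weight (k i) * K)) →
  Enum (IdealOfNorm N) K → Enum (IdealOfNorm (prodF (λ i → p i ^ k i) * N)) (prodF (λ i → weight (k i)) * K)
enum-ideals-prodF {zero} {N} {K} weight p k pp inj p∤N extend E =
  subst₂ (λ a b → Enum (IdealOfNorm a) b) (sym (*-identityˡ N)) (sym (*-identityˡ K)) E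
enum-ideals-prodF {suc r} {N} {K} weight p k pp inj p∤N extend E =
  subst₂ (λ a b → Enum (IdealOfNorm a) b) (sym (*-assoc (p fzero ^ k fzero) _ N)) (sym (*-assoc (weight (k fzero)) _ K))
    (extend fzero
      (prime∤prodF (pp fzero) (p ∘ fsuc) (k ∘ fsuc) (pp ∘ fsuc) (λ i eq → contradiction (inj eq) λ ()) (p∤N fzero))
      (enum-ideals-prodF weight (p ∘ fsuc) (k ∘ fsuc) (pp ∘ fsuc) (suc-injective ∘ inj) (p∤N ∘ fsuc) (λ i → extend (fsuc i)) E))

evenCount-odd : ∀ ℓ → ℓ % 2 ≡ 1 → evenCount ℓ ≡ 0
evenCount-odd 1             _  = refl
evenCount-odd (suc (suc ℓ)) eq = evenCount-odd ℓ eq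

evenCount-even : ∀ ℓ → ℓ % 2 ≡ 0 → evenCount ℓ ≡ 1
evenCount-even 0             _  = refl
evenCount-even (suc (suc ℓ)) eq = evenCount-even ℓ eq

prodF-zero : ∀ {r} (f : Fin r → ℕ) i → f i ≡ 0 → prodF f ≡ 0
prodF-zero f fzero    eq = cong (_* prodF (f ∘ fsuc)) eq
prodF-zero f (fsuc i) eq = trans (cong (f fzero *_) (prodF-zero (f ∘ fsuc) i eq)) (*-zeroʳ (f fzero))

prodF-one : ∀ {r} (f : Fin r → ℕ) → (∀ i → f i ≡ 1) → prodF f ≡ 1
prodF-one {zero}  f eq = refl
prodF-one {suc r} f eq = cong₂ _*_ (eq fzero) (prodF-one (f ∘ fsuc) (eq ∘ fsuc))

%-≢ : ∀ {a b x y} → x ≢ y → a % 3 ≡ x → b % 3 ≡ y → a ≢ b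
%-≢ x≢y a≡ b≡ a≡b = x≢y (trans (sym a≡) (trans (cong (_% 3) a≡b) b≡))

theorem11 : (V m r s : ℕ) (p k : Fin r → ℕ) (q ℓ : Fin s → ℕ) →
    (∀ i → Prime (p i)) → Injective _≡_ _≡_ p → (∀ i → p i % 3 ≡ 1) →
    (∀ j → Prime (q j)) → Injective _≡_ _≡_ q → (∀ j → q j % 3 ≡ 2) →
    (∀ i → 1 ≤ k i) → (∀ j → 1 ≤ ℓ j) →
    V ≡ 4 * (3 ^ m * prodF (λ i → p i ^ k i) * prodF (λ j → q j ^ ℓ j)) →
    ((∃ λ j → ℓ j % 2 ≡ 1) → δ≡ V 0) ×
    ((∀ j → ℓ j % 2 ≡ 0) → δ≡ V (prodF (λ i → suc (k i))))
theorem11 V m r s p k q ℓ pp p-inj p%3 pq q-inj q%3 _ _ refl =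
  -- A single count serves both claims: the inert factors multiply to 0 once some exponent is odd,
  -- and to 1 when all are even.
  (λ (j , odd) → subst (δ≡ V) (count-odd j odd) δ) , (λ even → subst (δ≡ V) (count-even even) δ)
  where
  Np = prodF (λ i → p i ^ k i)
  Nq = prodF (λ j → q j ^ ℓ j)
  Kp = prodF (λ i → suc (k i))
  Kq = prodF (λ j → evenCount (ℓ j))

  -- The factor 1 is the norm of the unit ideal, to which the inert primes, then the split ones and
  -- finally 3 are added.
  E-q : Enum (IdealOfNorm (Nq * 1)) (Kq * 1)
  E-q = enum-ideals-prodF evenCount q ℓ pq q-inj (λ j d → contradiction (subst Prime (∣1⇒≡1 d) (pq j)) ¬prime[1])
    (λ j {N} {K} q∤N E → enum-ideals-inert (pq j) (q%3 j) q∤N E (ℓ j)) enum-ideals-1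

  E-pq : Enum (IdealOfNorm (Np * (Nq * 1))) (Kp * (Kq * 1))
  E-pq = enum-ideals-prodF suc p k pp p-inj
    (λ i → prime∤prodF (pp i) q ℓ pq (λ j → %-≢ (λ ()) (p%3 i) (q%3 j)) (λ d → contradiction (subst Prime (∣1⇒≡1 d) (pp i)) ¬prime[1]))
    (λ i {N} {K} p∤N E → enum-ideals-split (pp i) (p%3 i) p∤N E (k i)) E-q

  3∤ : ¬ (3 ∣ℕ Np * (Nq * 1))
  3∤ = prime∤prodF prime[3] p k pp (λ i → %-≢ {3} {p i} (λ ()) refl (p%3 i))
    (prime∤prodF prime[3] q ℓ pq (λ j → %-≢ {3} {q j} (λ ()) refl (q%3 j)) (λ d → contradiction (∣1⇒≡1 d) λ ()))

  N≡ : 3 ^ m * (Np * (Nq * 1)) ≡ 3 ^ m * Np * Nq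
  N≡ = trans (cong (λ z → 3 ^ m * (Np * z)) (*-identityʳ Nq)) (sym (*-assoc (3 ^ m) Np Nq))

  N≢0 : NonZero (3 ^ m * (Np * (Nq * 1)))
  N≢0 = m*n≢0 (3 ^ m) _ {{m^n≢0 3 m}} {{≢-nonZero (λ eq → 3∤ (subst (3 ∣ℕ_) (sym eq) (3 ∣0)))}}

  δ : δ≡ V (Kp * (Kq * 1))
  δ = subst (λ N → δ≡ (4 * N) (Kp * (Kq * 1))) N≡ (enum-ideals⇒δ {{N≢0}} (enum-ideals-ramified 3∤ E-pq m))

  count-odd : ∀ j → ℓ j % 2 ≡ 1 → Kp * (Kq * 1) ≡ 0
  count-odd j odd = trans (cong (λ z → Kp * (z * 1)) (prodF-zero _ j (evenCount-odd (ℓ j) odd))) (*-zeroʳ Kp)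

  count-even : (∀ j → ℓ j % 2 ≡ 0) → Kp * (Kq * 1) ≡ Kp
  count-even even = trans (cong (λ z → Kp * (z * 1)) (prodF-one _ (λ j → evenCount-even (ℓ j) (even j)))) (*-identityʳ Kp)
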